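{- Let $k$ and $\ell$ be positive integers and write $m:=2^{\mathrm{ord}_2(\gcd(k,\ell))}$. Suppose that $q:=2^k$ and $Q:=2^\ell$ satisfy $\gcd(Q+1,q+1)=1$. Write $A(X):=1+aX+bX^v+cX^u$ where $a,b,c\in\mathbb{F}_{q^2}$ and $u,v$ are positive integers such that $u(Q+1)\equiv 1\pmod{q+1}$ and $v(Q+1)\equiv Q\pmod{q+1}$. Then $f(X):=XA(X^{q-1})$ permutes $\mathbb{F}_{q^2}$ if and only if all of the following hold: (1) $e:=1+a^{q+1}+b^{q+1}+c^{q+1}$ is nonzero; (2) $(a^qb+c^q)^Q=e^{Q-1}(a^qc+b^q)$; (3) $\mathrm{Tr}_{\mathbb{F}_q/\mathbb{F}_{2^m}}\Bigl(\frac{b^{q+1}+c^{q+1}}{e}\Bigr)=0$.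
   Context: For a positive integer $n$, $\mathrm{ord}_2(n)$ is the largest integer $i\ge0$ with $2^i\mid n$. A polynomial permutes $\mathbb{F}_{q^2}$ if it induces a bijection of $\mathbb{F}_{q^2}$. $\mathrm{Tr}_{\mathbb{F}_q/\mathbb{F}_{2^m}}$ is the trace map (note $m\mid k$). -}

module Defs where

open import Algebra.Bundles using (CommutativeRing)
import Algebra.Definitions as AlgDefs
import Algebra.Properties.Semiring.Exp as Exp
import Algebra.Properties.Semiring.Sum as Sum
open import Data.Fin.Base using (Fin; toℕ)
open import Data.List.Base as List using (List; []; _∷_)
open import Data.List.Extrema.Nat using (max; argmax-all; xs≤max)
open import Data.List.Membership.Propositional.Properties using (∈-filter⁺; ∈-upTo⁺)
import Data.List.Relation.Unary.All as All
open import Data.List.Relation.Unary.All.Properties using (all-filter)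
open import Data.Nat.Base as ℕ using (ℕ; zero; suc; s≤s; z≤n; NonZero)
open import Data.Nat.Divisibility using (_∣_; _∣?_; quotient; 1∣_; ∣-trans; ∣⇒≤)
open import Data.Nat.GCD using (gcd; gcd[m,n]∣m)
import Data.Nat.Properties as ℕₚ
open import Data.Product.Base using (proj₁)
open import Function.Base using (id)
open import Function.Bundles using (Inverse)
open import Function.Definitions using (Bijective)
open import Level using (_⊔_) renaming (suc to lsuc)
import Relation.Binary.PropositionalEquality as ≡
open import Relation.Nullary.Negation using (¬_)

infix 4 _≡_[mod_]

_≡_[mod_] : ℕ → ℕ → ℕ → Set
a ≡ b [mod n ] = n ∣ ℕ.∣ a - b ∣

-- The search stops at n because 2 ^ i ∣ n forces i < n when n is positive;
-- ord₂-divides and ord₂-greatest show that the result is the largest such i.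
ord₂ : ℕ → ℕ
ord₂ n = max 0 (List.filter (λ i → 2 ℕ.^ i ∣? n) (List.upTo (suc n)))

ord₂-divides : ∀ n → 2 ℕ.^ ord₂ n ∣ n
ord₂-divides n =
  argmax-all id {P = λ i → 2 ℕ.^ i ∣ n} (1∣ n)
    (all-filter (λ i → 2 ℕ.^ i ∣? n) (List.upTo (suc n)))

i<2^i : ∀ i → i ℕ.< 2 ℕ.^ i
i<2^i zero    = s≤s z≤n
i<2^i (suc i) = ℕₚ.≤-trans (ℕₚ.+-mono-≤ (ℕₚ.m^n>0 2 i) (i<2^i i))
  (ℕₚ.≤-reflexive (≡.cong (2 ℕ.^ i ℕ.+_) (≡.sym (ℕₚ.+-identityʳ (2 ℕ.^ i)))))

ord₂-greatest : ∀ n .{{_ : NonZero n}} i → 2 ℕ.^ i ∣ n → i ℕ.≤ ord₂ n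
ord₂-greatest n i 2^i∣n =
  All.lookup (xs≤max 0 _) (∈-filter⁺ (λ i → 2 ℕ.^ i ∣? n) (∈-upTo⁺ i<1+n) 2^i∣n)
  where
  i<1+n : i ℕ.< suc n
  i<1+n = ℕₚ.m<n⇒m<1+n (ℕₚ.<-≤-trans (i<2^i i) (∣⇒≤ 2^i∣n))

2^ord₂[gcd]∣ˡ : ∀ k ℓ → 2 ℕ.^ ord₂ (gcd k ℓ) ∣ k
2^ord₂[gcd]∣ˡ k ℓ = ∣-trans (ord₂-divides (gcd k ℓ)) (gcd[m,n]∣m k ℓ)

-- Finiteness makes _≈_ decidable, so "nonzero" can be read as the negation of
-- _≈ 0# and no apartness relation is needed.
record FiniteField c ℓ (n : ℕ) : Set (lsuc (c ⊔ ℓ)) where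
  field
    commutativeRing : CommutativeRing c ℓ

  open CommutativeRing commutativeRing public
  open AlgDefs _≈_ using (Invertible)

  field
    0≉1         : ¬ 0# ≈ 1#
    invertible  : ∀ {x} → ¬ x ≈ 0# → Invertible 1# _*_ x
    enumeration : Inverse setoid (≡.setoid (Fin n))

  open Exp semiring public using (_^_)
  open Sum semiring using (sum)

  infixl 7 _/_⟨_⟩

  _/_⟨_⟩ : Carrier → (y : Carrier) → ¬ y ≈ 0# → Carrier
  x / y ⟨ y≉0 ⟩ = x * proj₁ (invertible y≉0)

  -- The trace from the subfield 𝔽_{2^k} to its subfield 𝔽_{2^m}, as the sum of
  -- the k/m conjugates x ^ (2^m)^i.  The formula makes sense on all of the
  -- field, but is the trace only at x with x ^ 2^k ≈ x.
  Tr : ∀ {m k} → m ∣ k → Carrier → Carrier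
  Tr {m} m∣k x = sum {quotient m∣k} (λ i → x ^ ((2 ℕ.^ m) ℕ.^ toℕ i))

-- Univariate polynomials as coefficient lists, constant term first.  Trailing
-- zeros are allowed; they do not affect the induced function.
module Polynomials {c ℓ} (R : CommutativeRing c ℓ) where

  open CommutativeRing R

  Poly : Set c
  Poly = List Carrier

  infixl 6 _⊕_
  infixl 7 _⊗_
  infixr 8 _^ₚ_
  infixr 9 _∘ₚ_

  con : Carrier → Poly
  con a = a ∷ []

  X : Poly
  X = 0# ∷ 1# ∷ []

  _⊕_ : Poly → Poly → Poly
  []      ⊕ q       = q
  (a ∷ p) ⊕ []      = a ∷ p
  (a ∷ p) ⊕ (b ∷ q) = (a + b) ∷ (p ⊕ q)

  _⊗_ : Poly → Poly → Poly
  []      ⊗ q = []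
  (a ∷ p) ⊗ q = List.map (a *_) q ⊕ (0# ∷ (p ⊗ q))

  _^ₚ_ : Poly → ℕ → Poly
  p ^ₚ zero  = con 1#
  p ^ₚ suc n = p ⊗ (p ^ₚ n)

  _∘ₚ_ : Poly → Poly → Poly
  []      ∘ₚ q = []
  (a ∷ p) ∘ₚ q = con a ⊕ q ⊗ (p ∘ₚ q)

  eval : Poly → Carrier → Carrier
  eval []      x = 0#
  eval (a ∷ p) x = a + x * eval p x

  Permutes : Poly → Set (c ⊔ ℓ)
  Permutes p = Bijective _≈_ _≈_ (eval p)

{-# OPTIONS --safe #-}

-- Write q = 2^k, Q = 2^ℓ, x̄ = x^q.  On w^(Q+1) the polynomial f takes the value
-- φ(w) = Φ(w^Q, w) with Φ(z, w) = z w + a z̄ w̄ + b z̄ w + c z w̄, so f permutes 𝔽_{q²}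
-- exactly when φ is injective on the q + 1 lines of 𝔽_{q²} over 𝔽_q, i.e. when
-- φ(w) ∧ φ(h) = 0 forces w ∧ h = 0, where x ∧ y = x ȳ + x̄ y.  With U = c̄ + ā b and
-- V = b̄ + ā c, the product φ(w) ∧ φ(h) is, for z = w^Q and g = h^Q, equal to
--   (e z ḡ + T(V z g)) (w ∧ h) + (e w h̄ + T(U w h)) (z ∧ g) + (1 + a ā) (z ∧ g) (w ∧ h),
-- where T x = x + x̄.
--
-- If e ≠ 0 and (2) holds, this is e (w ∧ h)^(Q+1) (r^Q + r + 1 + t) with
-- t = (b b̄ + c c̄) / e and r̄ = r + 1.  So a collision makes t = 1 + r + r^Q, and the trace of
-- such a t to 𝔽_{2^m} is k/m + ℓ/m = 1, contradicting (3).  Conversely every r with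
-- r̄ = r + 1 comes from some w and h, and additive Hilbert 90 provides a collision
-- whenever the trace of t is nonzero.
--
-- For the necessity of (1) and (2), note that φ(w) ∧ φ(x w + h) is, for x in 𝔽_q, an
-- additive polynomial in x plus a constant, with coefficients given by the quadratic forms
-- β(w) = e w w̄ + T(U w²) and γ(z) = e z z̄ + T(V z²); hence zeros of β are zeros of γ.  This
-- settles the case e = 0 and the case of isotropic β.  If e ≠ 0 and β is anisotropic,
-- changes of coordinates turn φ into x (A x^Q + A′ x̄^Q), where Hermite's criterion gives
-- A A′ = 0, which is (2).

module Submission where

open import Defs
open import Algebra.Bundles using (CommutativeMonoid; CommutativeRing; RawRing)
import Algebra.Properties.CommutativeMonoid.Sum as MonoidSum
import Algebra.Properties.CommutativeSemigroup as CommutativeSemigroupProperties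
import Algebra.Properties.CommutativeSemiring.Exp as CommExp
import Algebra.Properties.Monoid.Mult as MonoidMult
import Algebra.Properties.Semiring.Exp as SemiringExp
import Algebra.Properties.Semiring.Mult as SemiringMult
import Algebra.Properties.Semiring.Sum as SemiringSum
import Algebra.Solver.Ring as RingSolver
open import Algebra.Solver.Ring.AlmostCommutativeRing
open import Data.Bool.Base as Bool using (Bool; true; false; _xor_)
import Data.Bool.Properties as Boolₚ
open import Data.Fin.Base as Fin using (Fin; zero; suc; punchOut; _↑ˡ_; _↑ʳ_)
import Data.Fin.Permutation as Permutation
import Data.Fin.Properties as Finₚ
open import Data.List.Base as List using ([]; _∷_)
open import Data.Maybe.Base using (just; nothing)
open import Data.Nat.Base as ℕ using (ℕ; zero; suc; NonZero; z≤n; s≤s)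
open import Data.Nat.Divisibility using (_∣_; divides; quotient; ∣-refl; ∣-trans; n∣m*n; ∣m+n∣m⇒∣n; ∣1⇒≡1)
import Data.Nat.DivMod as DivMod
open import Data.Nat.GCD using (gcd; gcd-greatest; gcd[m,n]∣n; gcd[m,n]≢0)
import Data.Nat.Properties as ℕₚ
open import Data.Nat.Tactic.RingSolver using (solve-∀)
open import Data.Product.Base using (Σ; ∃; ∃₂; _×_; _,_; proj₁; proj₂)
open import Data.Sum.Base using (_⊎_; inj₁; inj₂; [_,_]′)
open import Data.Vec.Base as Vec using (Vec; []; _∷_; lookup; _++_)
open import Data.Vec.Functional using (Vector)
open import Data.Vec.Properties using (lookup-++ˡ; lookup-++ʳ; lookup-map)
open import Function.Base using (id; _∘_)
open import Function.Bundles using (Inverse; _⇔_; mk⇔)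
open import Function.Definitions using (Injective)
import Level
open import Relation.Binary.Definitions using (Decidable; WeaklyDecidable)
open import Relation.Binary.PropositionalEquality as ≡ using (_≡_; _≢_)
import Relation.Binary.Reasoning.Setoid as SetoidReasoning
import Relation.Binary.Reflection as Reflection
open import Relation.Nullary using (yes; no; ¬_; contradiction)
open import Relation.Nullary.Decidable using (map′)

-- A collision needs one r that satisfies both r̄ = r + 1 and r^Q = r + 1 + t, and additive Hilbert
-- 90 solves only one such equation. The way out is a y with y² + y = N θ, where θ = U / e. Since N
-- θ + (N θ)^Q = t + t², this y satisfies both equations with each 1 replaced by a bit, ν or ε, of
-- 𝔽₂. Adding an s with s^(2^m) = s + 1 changes ν by k/m and ε by ℓ/m. Exactly one of these numbers
-- is odd, so exactly one bit can be corrected, and the other bit is the trace of t. In the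
-- anisotropic case the coordinates of the values change as well as those of the arguments: η Φ + η′
-- Φ̄ has the same collisions as Φ if N η + N η′ is nonzero, and some such combination is a linear
-- form in z times a linear form in w. Finding it requires a root in 𝔽_q of a quadratic that is, up
-- to a shift by an element of 𝔽_q, the quadratic Y² + e Y + N U. The latter has no root in 𝔽_q
-- exactly when β is isotropic, so one of the two arguments always applies.

-- Injections of finite sets, and sums with one exceptional term

injective⇒surjective : ∀ {n} {f : Fin n → Fin n} → Injective _≡_ _≡_ f →
                       ∀ j → ∃ λ i → f i ≡ j
injective⇒surjective {suc n} {f} f-inj j with Finₚ.any? (λ i → f i Finₚ.≟ j)
... | yes hit = hit
... | no  miss = contradiction (Finₚ.injective⇒≤ dodge-injective) ℕₚ.1+n≰n
  where
  j≢f : ∀ i → j ≢ f i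
  j≢f i j≡fi = miss (i , ≡.sym j≡fi)

  dodge-injective : Injective _≡_ _≡_ (λ i → punchOut (j≢f i))
  dodge-injective eq = f-inj (Finₚ.punchOut-injective (j≢f _) (j≢f _) eq)

injective⇒permutation : ∀ {n} {f : Fin n → Fin n} → Injective _≡_ _≡_ f →
                        Permutation.Permutation n n
injective⇒permutation {f = f} f-inj =
  Permutation.permutation f (proj₁ ∘ f-surj) (proj₂ ∘ f-surj) (λ i → f-inj (proj₂ (f-surj (f i))))
  where f-surj = injective⇒surjective f-inj

module SumProperties {c ℓ} (M : CommutativeMonoid c ℓ) where
  open CommutativeMonoid M
  open MonoidSum M
  open MonoidMult monoid using () renaming (_×_ to _·_)

  sum-all-ε : ∀ {n} (t : Vector Carrier n) → (∀ i → t i ≈ ε) → sum t ≈ ε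
  sum-all-ε {n} t t≈ε = trans (sum-cong-≋ t≈ε) (sum-replicate-zero n)

  sum-single : ∀ {n} (t : Vector Carrier n) i → (∀ j → j ≢ i → t j ≈ ε) → sum t ≈ t i
  sum-single {suc n} t i rest = trans (sum-remove t)
    (trans (∙-congˡ (sum-all-ε _ λ j → rest _ (Finₚ.punchInᵢ≢i i j))) (identityʳ _))

  -- The `a` in front stands in for the exceptional term, so the count is `n` and not `n - 1`. For
  -- products over a field this gives `a ^ n` without subtraction in the exponent.
  sum-constant-but-one : ∀ {n} a (t : Vector Carrier n) i → t i ≈ ε →
                         (∀ j → j ≢ i → t j ≈ a) → a ∙ sum t ≈ n · a
  sum-constant-but-one {suc n} a t i tᵢ≈ε rest = ∙-congˡ (trans (sum-remove t)
    (trans (∙-cong tᵢ≈ε (trans (sum-cong-≋ λ j → rest _ (Finₚ.punchInᵢ≢i i j)) (sum-replicate n)))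
           (identityˡ _)))

-- Finite fields: cancellation, reindexing, and x^n = x

module FiniteFieldProperties {c ℓ n} (F : FiniteField c ℓ n) where
  open FiniteField F hiding (zero)
  open SetoidReasoning setoid
  open Inverse enumeration using () renaming
    (to to index; from to element; to-cong to index-cong
    ; strictlyInverseˡ to index-element; strictlyInverseʳ to element-index)
  open SemiringExp semiring hiding (_^_)
  open SemiringSum semiring using (sum; sum-cong-≋; sum-replicate; ∑-distrib-+; sum-permute)
  open MonoidSum *-commutativeMonoid using () renaming
    (sum to product; sum-cong-≋ to product-cong; ∑-distrib-+ to product-distrib-*; sum-permute to product-permute)
  open SumProperties *-commutativeMonoid using () renaming (sum-constant-but-one to product-constant-but-one)
  open MonoidMult +-monoid using () renaming (_×_ to _·_)

  index-injective : ∀ {x y} → index x ≡ index y → x ≈ y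
  index-injective {x} {y} eq =
    trans (sym (element-index x)) (trans (reflexive (≡.cong element eq)) (element-index y))

  infix 4 _≟_
  _≟_ : Decidable _≈_
  x ≟ y = map′ index-injective index-cong (index x Finₚ.≟ index y)

  element-injective : ∀ {i j} → element i ≈ element j → i ≡ j
  element-injective {i} {j} eq =
    ≡.trans (≡.sym (index-element i)) (≡.trans (index-cong eq) (index-element j))

  infix 8 _⁻¹⟨_⟩
  _⁻¹⟨_⟩ : ∀ x → ¬ x ≈ 0# → Carrier
  x ⁻¹⟨ x≉0 ⟩ = proj₁ (invertible x≉0)

  inverseˡ : ∀ {x} (x≉0 : ¬ x ≈ 0#) → x ⁻¹⟨ x≉0 ⟩ * x ≈ 1#
  inverseˡ x≉0 = proj₁ (proj₂ (invertible x≉0))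

  inverseʳ : ∀ {x} (x≉0 : ¬ x ≈ 0#) → x * x ⁻¹⟨ x≉0 ⟩ ≈ 1#
  inverseʳ x≉0 = proj₂ (proj₂ (invertible x≉0))

  *-cancelˡ : ∀ {x y z} → ¬ x ≈ 0# → x * y ≈ x * z → y ≈ z
  *-cancelˡ {x} {y} {z} x≉0 xy≈xz = begin
    y                  ≈⟨ undo y ⟨
    x⁻¹ * (x * y)      ≈⟨ *-congˡ xy≈xz ⟩
    x⁻¹ * (x * z)      ≈⟨ undo z ⟩
    z                  ∎
    where
    x⁻¹ = x ⁻¹⟨ x≉0 ⟩
    undo : ∀ y → x⁻¹ * (x * y) ≈ y
    undo y = trans (sym (*-assoc _ _ _)) (trans (*-congʳ (inverseˡ x≉0)) (*-identityˡ y))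

  x*y≈0⇒y≈0 : ∀ {x y} → ¬ x ≈ 0# → x * y ≈ 0# → y ≈ 0#
  x*y≈0⇒y≈0 x≉0 xy≈0 = *-cancelˡ x≉0 (trans xy≈0 (sym (zeroʳ _)))

  *-≉0 : ∀ {x y} → ¬ x ≈ 0# → ¬ y ≈ 0# → ¬ x * y ≈ 0#
  *-≉0 x≉0 y≉0 xy≈0 = y≉0 (x*y≈0⇒y≈0 x≉0 xy≈0)

  x*y≈0⇒x≈0∨y≈0 : ∀ {x y} → x * y ≈ 0# → x ≈ 0# ⊎ y ≈ 0#
  x*y≈0⇒x≈0∨y≈0 {x} xy≈0 with x ≟ 0#
  ... | yes x≈0 = inj₁ x≈0
  ... | no  x≉0 = inj₂ (x*y≈0⇒y≈0 x≉0 xy≈0)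

  ^-≉0 : ∀ {x} m → ¬ x ≈ 0# → ¬ x ^ m ≈ 0#
  ^-≉0 zero    x≉0 1≈0 = 0≉1 (sym 1≈0)
  ^-≉0 (suc m) x≉0     = *-≉0 x≉0 (^-≉0 m x≉0)

  x^m≈0⇒x≈0 : ∀ {x} m → x ^ m ≈ 0# → x ≈ 0#
  x^m≈0⇒x≈0 {x} m x^m≈0 with x ≟ 0#
  ... | yes x≈0 = x≈0
  ... | no  x≉0 = contradiction x^m≈0 (^-≉0 m x≉0)

  0^m≈0 : ∀ m .{{_ : NonZero m}} → 0# ^ m ≈ 0#
  0^m≈0 (suc m) = zeroˡ _

  1^m≈1 : ∀ m → 1# ^ m ≈ 1#
  1^m≈1 zero    = refl
  1^m≈1 (suc m) = trans (*-identityˡ _) (1^m≈1 m)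

  product-≉0 : ∀ {m} (t : Vector Carrier m) → (∀ i → ¬ t i ≈ 0#) → ¬ product t ≈ 0#
  product-≉0 {zero}  t t≉0 1≈0 = 0≉1 (sym 1≈0)
  product-≉0 {suc m} t t≉0     = *-≉0 (t≉0 zero) (product-≉0 (t ∘ suc) (t≉0 ∘ suc))

  module _ {g : Carrier → Carrier} (g-cong : ∀ {x y} → x ≈ y → g x ≈ g y)
           (g-inj : ∀ {x y} → g x ≈ g y → x ≈ y) where

    transported-injective : Injective _≡_ _≡_ (λ i → index (g (element i)))
    transported-injective eq = element-injective (g-inj (index-injective eq))

    field-injective⇒surjective : ∀ y → ∃ λ x → g x ≈ y
    field-injective⇒surjective y with injective⇒surjective transported-injective (index y)
    ... | i , eq = element i , index-injective eq

    transported : Permutation.Permutation n n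
    transported = injective⇒permutation transported-injective

  ∑ᶠ : (Carrier → Carrier) → Carrier
  ∑ᶠ f = sum (f ∘ element)

  ∏ᶠ : (Carrier → Carrier) → Carrier
  ∏ᶠ f = product (f ∘ element)

  ∑ᶠ-cong : ∀ {f g} → (∀ x → f x ≈ g x) → ∑ᶠ f ≈ ∑ᶠ g
  ∑ᶠ-cong f≈g = sum-cong-≋ (f≈g ∘ element)

  ∑ᶠ-reindex : ∀ f g → (∀ {x y} → x ≈ y → f x ≈ f y) → (∀ {x y} → x ≈ y → g x ≈ g y) →
               (∀ {x y} → g x ≈ g y → x ≈ y) → ∑ᶠ f ≈ ∑ᶠ (f ∘ g)
  ∑ᶠ-reindex f g f-cong g-cong g-inj =
    trans (sum-permute (f ∘ element) (transported g-cong g-inj)) (sum-cong-≋ {n} λ i → f-cong (element-index (g (element i))))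

  ∏ᶠ-reindex : ∀ f g → (∀ {x y} → x ≈ y → f x ≈ f y) → (∀ {x y} → x ≈ y → g x ≈ g y) →
               (∀ {x y} → g x ≈ g y → x ≈ y) → ∏ᶠ f ≈ ∏ᶠ (f ∘ g)
  ∏ᶠ-reindex f g f-cong g-cong g-inj =
    trans (product-permute (f ∘ element) (transported g-cong g-inj)) (product-cong {n} λ i → f-cong (element-index (g (element i))))

  -- Translation by 1 permutes the field, so the sum of all elements absorbs `n · 1#`.
  n·1≈0 : n · 1# ≈ 0#
  n·1≈0 = begin
    n · 1#                      ≈⟨ sum-replicate n ⟨
    ∑ᶠ (λ _ → 1#)               ≈⟨ +-identityˡ _ ⟨
    0# + ∑ᶠ (λ _ → 1#)          ≈⟨ +-congʳ (-‿inverseˡ (∑ᶠ (λ x → x))) ⟨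
    - s + s + ∑ᶠ (λ _ → 1#)     ≈⟨ +-assoc _ _ _ ⟩
    - s + (s + ∑ᶠ (λ _ → 1#))   ≈⟨ +-congˡ (∑-distrib-+ element (λ _ → 1#)) ⟨
    - s + ∑ᶠ (λ x → x + 1#)     ≈⟨ +-congˡ (∑ᶠ-reindex (λ x → x) (_+ 1#) (λ eq → eq) +-congʳ cancel) ⟨
    - s + s                     ≈⟨ -‿inverseˡ s ⟩
    0#                          ∎
    where
    s = ∑ᶠ (λ x → x)
    cancel : ∀ {x y} → x + 1# ≈ y + 1# → x ≈ y
    cancel {x} {y} eq = trans (sym (undo x)) (trans (+-congʳ eq) (undo y))
      where
      undo : ∀ x → x + 1# - 1# ≈ x
      undo x = trans (+-assoc _ _ _) (trans (+-congˡ (-‿inverseʳ 1#)) (+-identityʳ x))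

  -- The product of all h x is invariant under x ↦ a x, which multiplies every
  -- factor except the one at 0 by a.
  x^n≈x : ∀ a → a ^ n ≈ a
  x^n≈x a with a ≟ 0#
  ... | yes a≈0 = trans (^-congˡ n a≈0) (trans (0^n≈0 (index 0#)) (sym a≈0))
    where
    0^n≈0 : ∀ {m} → Fin m → 0# ^ m ≈ 0#
    0^n≈0 {suc m} _ = zeroˡ _
  ... | no  a≉0 = begin
    a ^ n                         ≈⟨ product-constant-but-one a (scale ∘ element) (index 0#) (scale-0 (element-index 0#))
                                      (λ j j≢ → scale-≉0 λ eq → j≢ (≡.trans (≡.sym (index-element j)) (index-cong eq))) ⟨
    a * ∏ᶠ scale                  ≈⟨ *-congˡ (*-cancelˡ ∏h≉0 (trans (*-comm _ _) (trans ∏scale*∏h (sym (*-identityʳ _))))) ⟩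
    a * 1#                        ≈⟨ *-identityʳ a ⟩
    a                             ∎
    where
    ifZero : Carrier → Carrier → Carrier → Carrier
    ifZero x s t with x ≟ 0#
    ... | yes _ = s
    ... | no  _ = t

    ifZero-yes : ∀ {x s t} → x ≈ 0# → ifZero x s t ≈ s
    ifZero-yes {x} x≈0 with x ≟ 0#
    ... | yes _   = refl
    ... | no  x≉0 = contradiction x≈0 x≉0

    ifZero-no : ∀ {x s t} → ¬ x ≈ 0# → ifZero x s t ≈ t
    ifZero-no {x} x≉0 with x ≟ 0#
    ... | yes x≈0 = contradiction x≈0 x≉0
    ... | no  _   = refl

    -- The value 1 at zero keeps the product of `h` nonzero, so that it can be cancelled.
    h scale : Carrier → Carrier
    h x     = ifZero x 1# x
    scale x = ifZero x 1# a

    scale-0 : ∀ {x} → x ≈ 0# → scale x ≈ 1#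
    scale-0 = ifZero-yes

    scale-≉0 : ∀ {x} → ¬ x ≈ 0# → scale x ≈ a
    scale-≉0 = ifZero-no

    h-cong : ∀ {x y} → x ≈ y → h x ≈ h y
    h-cong {x} {y} x≈y with x ≟ 0# | y ≟ 0#
    ... | yes _   | yes _   = refl
    ... | yes x≈0 | no  y≉0 = contradiction (trans (sym x≈y) x≈0) y≉0
    ... | no  x≉0 | yes y≈0 = contradiction (trans x≈y y≈0) x≉0
    ... | no  _   | no  _   = x≈y

    h-≉0 : ∀ x → ¬ h x ≈ 0#
    h-≉0 x with x ≟ 0#
    ... | yes _   = λ 1≈0 → 0≉1 (sym 1≈0)
    ... | no  x≉0 = x≉0

    h-scale : ∀ x → scale x * h x ≈ h (a * x)
    h-scale x with x ≟ 0#
    ... | yes x≈0 = trans (*-identityˡ 1#) (sym (ifZero-yes (trans (*-congˡ x≈0) (zeroʳ a))))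
    ... | no  x≉0 = sym (ifZero-no (*-≉0 a≉0 x≉0))

    ∏h≉0 : ¬ ∏ᶠ h ≈ 0#
    ∏h≉0 = product-≉0 _ (h-≉0 ∘ element)

    ∏scale*∏h : ∏ᶠ scale * ∏ᶠ h ≈ ∏ᶠ h
    ∏scale*∏h = begin
      ∏ᶠ scale * ∏ᶠ h               ≈⟨ product-distrib-* (scale ∘ element) (h ∘ element) ⟨
      ∏ᶠ (λ x → scale x * h x)      ≈⟨ product-cong (h-scale ∘ element) ⟩
      ∏ᶠ (λ x → h (a * x))          ≈⟨ ∏ᶠ-reindex h (a *_) h-cong *-congˡ (*-cancelˡ a≉0) ⟨
      ∏ᶠ h                          ∎

-- Ring endomorphisms and a solver for identities with conjugates

record IsEndomorphism {c ℓ} (R : CommutativeRing c ℓ)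
                      (h : CommutativeRing.Carrier R → CommutativeRing.Carrier R) : Set (c Level.⊔ ℓ) where
  open CommutativeRing R
  field
    cong   : ∀ {x y} → x ≈ y → h x ≈ h y
    0-homo : h 0# ≈ 0#
    1-homo : h 1# ≈ 1#
    +-homo : ∀ x y → h (x + y) ≈ h x + h y
    *-homo : ∀ x y → h (x * y) ≈ h x * h y

-- A ring solver for commutative rings of characteristic two with an involution:
-- the involution is pushed to the variables, and the remaining identity between
-- polynomials with coefficients in 𝔽₂ is decided by normalisation.
module InvolutionSolver {c ℓ} (R : CommutativeRing c ℓ)
  (x+x≈0 : ∀ x → CommutativeRing._≈_ R (CommutativeRing._+_ R x x) (CommutativeRing.0# R))
  (conj : CommutativeRing.Carrier R → CommutativeRing.Carrier R)
  (conj-isEndomorphism : IsEndomorphism R conj)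
  (conj-involutive : ∀ x → CommutativeRing._≈_ R (conj (conj x)) x)
  where

  open CommutativeRing R hiding (zero)
  private module C = IsEndomorphism conj-isEndomorphism

  𝔽₂ : RawRing _ _
  𝔽₂ = record
    { Carrier = Bool ; _≈_ = _≡_ ; _+_ = _xor_ ; _*_ = Bool._∧_ ; -_ = id ; 0# = false ; 1# = true }

  almostCommutativeRing : AlmostCommutativeRing _ _
  almostCommutativeRing = fromCommutativeSemiring commutativeSemiring

  fromBool : Bool → Carrier
  fromBool false = 0#
  fromBool true  = 1#

  fromBool-morphism : 𝔽₂ -Raw-AlmostCommutative⟶ almostCommutativeRing
  fromBool-morphism = record
    { ⟦_⟧    = fromBool
    ; +-homo = λ { false y → sym (+-identityˡ _) ; true false → sym (+-identityʳ _) ; true true → sym (x+x≈0 1#) }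
    ; *-homo = λ { false y → sym (zeroˡ _) ; true y → sym (*-identityˡ _) }
    ; -‿homo = λ _ → refl
    ; 0-homo = refl
    ; 1-homo = refl
    }

  fromBool-≟ : WeaklyDecidable (Induced-equivalence fromBool-morphism)
  fromBool-≟ x y with x Boolₚ.≟ y
  ... | yes ≡.refl = just refl
  ... | no  _      = nothing

  open RingSolver 𝔽₂ almostCommutativeRing fromBool-morphism fromBool-≟
    using (Polynomial; con; var; _:+_; _:*_)
    renaming (⟦_⟧ to ⟦_⟧ₚ; ⟦_⟧↓ to ⟦_⟧ₚ↓; correct to correctₚ)

  infix  9 _⁻
  infixl 7 _⊗_
  infixl 6 _⊕_

  data Expr (n : ℕ) : Set where
    #_      : Fin n → Expr n
    :0 :1   : Expr n
    _⊕_ _⊗_ : Expr n → Expr n → Expr n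
    _⁻      : Expr n → Expr n

  ⟦_⟧ : ∀ {n} → Expr n → Vec Carrier n → Carrier
  ⟦ # i   ⟧ ρ = lookup ρ i
  ⟦ :0    ⟧ ρ = 0#
  ⟦ :1    ⟧ ρ = 1#
  ⟦ s ⊕ t ⟧ ρ = ⟦ s ⟧ ρ + ⟦ t ⟧ ρ
  ⟦ s ⊗ t ⟧ ρ = ⟦ s ⟧ ρ * ⟦ t ⟧ ρ
  ⟦ s ⁻   ⟧ ρ = conj (⟦ s ⟧ ρ)

  -- A variable and its conjugate become two independent indeterminates, in the left and the right
  -- half of `n + n`.
  push push⁻ : ∀ {n} → Expr n → Polynomial (n ℕ.+ n)
  push {n} (# i) = var (i ↑ˡ n)
  push :0        = con false
  push :1        = con true
  push (s ⊕ t)   = push s :+ push t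
  push (s ⊗ t)   = push s :* push t
  push (s ⁻)     = push⁻ s
  push⁻ {n} (# i) = var (n ↑ʳ i)
  push⁻ :0        = con false
  push⁻ :1        = con true
  push⁻ (s ⊕ t)   = push⁻ s :+ push⁻ t
  push⁻ (s ⊗ t)   = push⁻ s :* push⁻ t
  push⁻ (s ⁻)     = push s

  env : ∀ {n} → Vec Carrier n → Vec Carrier (n ℕ.+ n)
  env ρ = ρ ++ Vec.map conj ρ

  push-correct  : ∀ {n} (s : Expr n) ρ → ⟦ push s ⟧ₚ (env ρ) ≈ ⟦ s ⟧ ρ
  push⁻-correct : ∀ {n} (s : Expr n) ρ → ⟦ push⁻ s ⟧ₚ (env ρ) ≈ conj (⟦ s ⟧ ρ)
  push-correct (# i)   ρ = reflexive (lookup-++ˡ ρ _ i)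
  push-correct :0      ρ = refl
  push-correct :1      ρ = refl
  push-correct (s ⊕ t) ρ = +-cong (push-correct s ρ) (push-correct t ρ)
  push-correct (s ⊗ t) ρ = *-cong (push-correct s ρ) (push-correct t ρ)
  push-correct (s ⁻)   ρ = push⁻-correct s ρ
  push⁻-correct (# i)   ρ = reflexive (≡.trans (lookup-++ʳ ρ _ i) (lookup-map i conj ρ))
  push⁻-correct :0      ρ = sym C.0-homo
  push⁻-correct :1      ρ = sym C.1-homo
  push⁻-correct (s ⊕ t) ρ = trans (+-cong (push⁻-correct s ρ) (push⁻-correct t ρ)) (sym (C.+-homo _ _))
  push⁻-correct (s ⊗ t) ρ = trans (*-cong (push⁻-correct s ρ) (push⁻-correct t ρ)) (sym (C.*-homo _ _))
  push⁻-correct (s ⁻)   ρ = trans (push-correct s ρ) (sym (conj-involutive _))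

  ⟦_⟧↓ : ∀ {n} → Expr n → Vec Carrier n → Carrier
  ⟦ s ⟧↓ ρ = ⟦ push s ⟧ₚ↓ (env ρ)

  correct : ∀ {n} (s : Expr n) ρ → ⟦ s ⟧↓ ρ ≈ ⟦ s ⟧ ρ
  correct s ρ = trans (correctₚ (push s) (env ρ)) (push-correct s ρ)

  open Reflection setoid #_ ⟦_⟧ ⟦_⟧↓ correct public using (solve; _⊜_)

  -- Carries a Frobenius map through a whole form such as `:B` or `:N` at once.
  ⟦⟧-homo : ∀ {h} → IsEndomorphism R h → (∀ x → h (conj x) ≈ conj (h x)) →
            ∀ {n} (s : Expr n) ρ → h (⟦ s ⟧ ρ) ≈ ⟦ s ⟧ (Vec.map h ρ)
  ⟦⟧-homo {h} h-endo h-conj = go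
    where
    open IsEndomorphism h-endo
    go : ∀ {n} (s : Expr n) ρ → h (⟦ s ⟧ ρ) ≈ ⟦ s ⟧ (Vec.map h ρ)
    go (# i)   ρ = reflexive (≡.sym (lookup-map i h ρ))
    go :0      ρ = 0-homo
    go :1      ρ = 1-homo
    go (s ⊕ t) ρ = trans (+-homo _ _) (+-cong (go s ρ) (go t ρ))
    go (s ⊗ t) ρ = trans (*-homo _ _) (*-cong (go s ρ) (go t ρ))
    go (s ⁻)   ρ = trans (h-conj _) (C.cong (go s ρ))

-- Characteristic two, Frobenius maps and conjugation

module QuadraticField {c ℓ} (k : ℕ) .{{_ : NonZero k}} (F : FiniteField c ℓ ((2 ℕ.^ k) ℕ.^ 2)) where
  open FiniteField F hiding (zero) public
  open FiniteFieldProperties F public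
  open SemiringExp semiring hiding (_^_) public
  open CommExp commutativeSemiring using (^-distrib-*) public
  open MonoidMult +-monoid using () renaming (_×_ to _·_)
  open SemiringMult semiring using (×1-homo-*)
  open SetoidReasoning setoid

  q : ℕ
  q = 2 ℕ.^ k

  m^j·1≈[m·1]^j : ∀ m j → (m ℕ.^ j) · 1# ≈ (m · 1#) ^ j
  m^j·1≈[m·1]^j m zero    = +-identityʳ 1#
  m^j·1≈[m·1]^j m (suc j) = trans (×1-homo-* m (m ℕ.^ j)) (*-congˡ (m^j·1≈[m·1]^j m j))

  -- The characteristic is read off from the number of elements: `n · 1#` is a power of `2 · 1#`,
  -- and a field has no nilpotents.
  2·1≈0 : 2 · 1# ≈ 0#
  2·1≈0 = x^m≈0⇒x≈0 k (trans (sym (m^j·1≈[m·1]^j 2 k))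
            (x^m≈0⇒x≈0 2 (trans (sym (m^j·1≈[m·1]^j q 2)) n·1≈0)))

  x+x≈0 : ∀ x → x + x ≈ 0#
  x+x≈0 x = begin
    x + x                ≈⟨ +-cong (*-identityʳ x) (*-identityʳ x) ⟨
    x * 1# + x * 1#      ≈⟨ distribˡ x 1# 1# ⟨
    x * (1# + 1#)        ≈⟨ *-congˡ (+-congˡ (+-identityʳ 1#)) ⟨
    x * (2 · 1#)         ≈⟨ *-congˡ 2·1≈0 ⟩
    x * 0#               ≈⟨ zeroʳ x ⟩
    0#                   ∎

  id-isEndomorphism : IsEndomorphism commutativeRing id
  id-isEndomorphism = record
    { cong = id ; 0-homo = refl ; 1-homo = refl ; +-homo = λ _ _ → refl ; *-homo = λ _ _ → refl }

  -- With the identity as involution this is an ordinary solver in characteristic two. It is at hand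
  -- before `frob` is known to be additive, and that proof uses it.
  module Plain = InvolutionSolver commutativeRing x+x≈0 id id-isEndomorphism (λ _ → refl)

  x+y≈0⇒x≈y : ∀ {x y} → x + y ≈ 0# → x ≈ y
  x+y≈0⇒x≈y {x} {y} x+y≈0 = trans (solve 2 (λ x y → x ⊜ x ⊕ y ⊕ y) refl x y) (trans (+-congʳ x+y≈0) (+-identityˡ y))
    where open Plain

  x≈y⇒x+y≈0 : ∀ {x y} → x ≈ y → x + y ≈ 0#
  x≈y⇒x+y≈0 {y = y} x≈y = trans (+-congʳ x≈y) (x+x≈0 y)

  frob : ℕ → Carrier → Carrier
  frob j x = x ^ (2 ℕ.^ j)

  frob-+ : ∀ j x y → frob j (x + y) ≈ frob j x + frob j y
  frob-+ zero    x y = trans (*-identityʳ _) (+-cong (sym (*-identityʳ x)) (sym (*-identityʳ y)))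
  frob-+ (suc j) x y = begin
    (x + y) ^ (2 ℕ.* 2 ℕ.^ j)                       ≈⟨ ^-assocʳ (x + y) 2 (2 ℕ.^ j) ⟨
    frob j ((x + y) ^ 2)                            ≈⟨ ^-congˡ (2 ℕ.^ j) (Plain.solve 2 (λ x y →
                                                       (x ⊕ y) ⊗ ((x ⊕ y) ⊗ :1) ⊜ x ⊗ (x ⊗ :1) ⊕ y ⊗ (y ⊗ :1)) refl x y) ⟩
    frob j (x ^ 2 + y ^ 2)                          ≈⟨ frob-+ j (x ^ 2) (y ^ 2) ⟩
    frob j (x ^ 2) + frob j (y ^ 2)                 ≈⟨ +-cong (^-assocʳ x 2 (2 ℕ.^ j)) (^-assocʳ y 2 (2 ℕ.^ j)) ⟩
    frob (suc j) x + frob (suc j) y                 ∎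
    where open Plain

  frob-isEndomorphism : ∀ j → IsEndomorphism commutativeRing (frob j)
  frob-isEndomorphism j = record
    { cong   = ^-congˡ (2 ℕ.^ j)
    ; 0-homo = 0^m≈0 (2 ℕ.^ j) {{ℕₚ.m^n≢0 2 j}}
    ; 1-homo = 1^m≈1 (2 ℕ.^ j)
    ; +-homo = frob-+ j
    ; *-homo = λ x y → ^-distrib-* x y (2 ℕ.^ j)
    }

  ^-swap : ∀ x m m′ → (x ^ m) ^ m′ ≈ (x ^ m′) ^ m
  ^-swap x m m′ = trans (^-assocʳ x m m′) (trans (^-congʳ x (ℕₚ.*-comm m m′)) (sym (^-assocʳ x m′ m)))

  frob-∘ : ∀ i j x → frob j (frob i x) ≈ frob (i ℕ.+ j) x
  frob-∘ i j x = trans (^-assocʳ x (2 ℕ.^ i) (2 ℕ.^ j)) (^-congʳ x (≡.sym (ℕₚ.^-distribˡ-+-* 2 i j)))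

  conj : Carrier → Carrier
  conj = frob k

  conj-involutive : ∀ x → conj (conj x) ≈ x
  conj-involutive x = trans (^-assocʳ x q q)
    (trans (^-congʳ x (≡.cong (q ℕ.*_) (≡.sym (ℕₚ.*-identityʳ q)))) (x^n≈x x))

  module Solver = InvolutionSolver commutativeRing x+x≈0 conj (frob-isEndomorphism k) conj-involutive

  frob-conj : ∀ j x → frob j (conj x) ≈ conj (frob j x)
  frob-conj j x = ^-swap x q (2 ℕ.^ j)

  frob-⟦⟧ : ∀ j {n} (s : Solver.Expr n) ρ → frob j (Solver.⟦ s ⟧ ρ) ≈ Solver.⟦ s ⟧ (Vec.map (frob j) ρ)
  frob-⟦⟧ j = Solver.⟦⟧-homo (frob-isEndomorphism j) (frob-conj j)

-- Sums over ranges and polynomial functions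

module RangeSums {c ℓ} (k : ℕ) .{{_ : NonZero k}} (F : FiniteField c ℓ ((2 ℕ.^ k) ℕ.^ 2)) where
  open QuadraticField k F
  open SemiringSum semiring using (sum; ∑-distrib-+; *-distribˡ-sum; sum-replicate-zero)
  open SetoidReasoning setoid

  ∑< : ℕ → (ℕ → Carrier) → Carrier
  ∑< zero    f = 0#
  ∑< (suc n) f = ∑< n f + f n

  ∑<-cong : ∀ n {f g} → (∀ i → i ℕ.< n → f i ≈ g i) → ∑< n f ≈ ∑< n g
  ∑<-cong zero    f≈g = refl
  ∑<-cong (suc n) f≈g = +-cong (∑<-cong n λ i i<n → f≈g i (ℕₚ.m<n⇒m<1+n i<n)) (f≈g n ℕₚ.≤-refl)

  ∑<-+ : ∀ n f g → ∑< n (λ i → f i + g i) ≈ ∑< n f + ∑< n g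
  ∑<-+ zero    f g = sym (+-identityˡ 0#)
  ∑<-+ (suc n) f g = trans (+-congʳ (∑<-+ n f g))
    (Plain.solve 4 (λ a b c d → a ⊕ b ⊕ (c ⊕ d) ⊜ a ⊕ c ⊕ (b ⊕ d)) refl _ _ _ _)
    where open Plain

  ∑<-*ˡ : ∀ n x f → ∑< n (λ i → x * f i) ≈ x * ∑< n f
  ∑<-*ˡ zero    x f = sym (zeroʳ x)
  ∑<-*ˡ (suc n) x f = trans (+-congʳ (∑<-*ˡ n x f)) (sym (distribˡ x _ _))

  ∑<-split : ∀ m n f → ∑< (m ℕ.+ n) f ≈ ∑< m f + ∑< n (λ i → f (m ℕ.+ i))
  ∑<-split m zero    f = trans (reflexive (≡.cong (λ m → ∑< m f) (ℕₚ.+-identityʳ m))) (sym (+-identityʳ _))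
  ∑<-split m (suc n) f = begin
    ∑< (m ℕ.+ suc n) f                                       ≡⟨ ≡.cong (λ m → ∑< m f) (ℕₚ.+-suc m n) ⟩
    ∑< (m ℕ.+ n) f + f (m ℕ.+ n)                             ≈⟨ +-congʳ (∑<-split m n f) ⟩
    ∑< m f + ∑< n (λ i → f (m ℕ.+ i)) + f (m ℕ.+ n)          ≈⟨ +-assoc _ _ _ ⟩
    ∑< m f + ∑< (suc n) (λ i → f (m ℕ.+ i))                  ∎

  ∑<-suc : ∀ n f → ∑< (suc n) f ≈ f 0 + ∑< n (f ∘ suc)
  ∑<-suc n f = trans (∑<-split 1 n f) (+-congʳ (+-identityˡ _))

  ∑<-shift : ∀ n f → ∑< n (f ∘ suc) ≈ ∑< n f + (f 0 + f n)
  ∑<-shift n f = begin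
    ∑< n (f ∘ suc)                     ≈⟨ Plain.solve 2 (λ a b → a ⊜ b ⊕ (b ⊕ a)) refl _ _ ⟩
    f 0 + (f 0 + ∑< n (f ∘ suc))       ≈⟨ +-congˡ (∑<-suc n f) ⟨
    f 0 + (∑< n f + f n)               ≈⟨ Plain.solve 3 (λ a b c → a ⊕ (b ⊕ c) ⊜ b ⊕ (a ⊕ c)) refl _ _ _ ⟩
    ∑< n f + (f 0 + f n)               ∎
    where open Plain

  ∑<-all-0 : ∀ n {f} → (∀ i → i ℕ.< n → f i ≈ 0#) → ∑< n f ≈ 0#
  ∑<-all-0 zero    f≈0 = refl
  ∑<-all-0 (suc n) f≈0 =
    trans (+-cong (∑<-all-0 n λ i i<n → f≈0 i (ℕₚ.m<n⇒m<1+n i<n)) (f≈0 n ℕₚ.≤-refl)) (+-identityˡ 0#)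

  ∑<-single : ∀ n {f} i → i ℕ.< n → (∀ j → j ℕ.< n → j ≢ i → f j ≈ 0#) → ∑< n f ≈ f i
  ∑<-single (suc n) {f} i i<1+n rest with i ℕₚ.≟ n
  ... | yes ≡.refl = trans (+-congʳ (∑<-all-0 n λ j j<n → rest j (ℕₚ.m<n⇒m<1+n j<n) (ℕₚ.<⇒≢ j<n))) (+-identityˡ _)
  ... | no  i≢n    = trans (+-cong (∑<-single n i (ℕₚ.≤∧≢⇒< (ℕₚ.≤-pred i<1+n) i≢n)
                                     λ j j<n → rest j (ℕₚ.m<n⇒m<1+n j<n))
                                   (rest n ℕₚ.≤-refl (i≢n ∘ ≡.sym)))
                           (+-identityʳ _)

  frob-∑< : ∀ j n f → frob j (∑< n f) ≈ ∑< n (frob j ∘ f)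
  frob-∑< j zero    f = IsEndomorphism.0-homo (frob-isEndomorphism j)
  frob-∑< j (suc n) f = trans (frob-+ j _ _) (+-congʳ (frob-∑< j n f))

  sum≈∑< : ∀ n f → sum {n} (f ∘ Fin.toℕ) ≈ ∑< n f
  sum≈∑< zero    f = refl
  sum≈∑< (suc n) f = trans (+-congˡ (sum≈∑< n (f ∘ suc))) (sym (∑<-suc n f))

  ∑ᶠ-∑< : ∀ n (f : ℕ → Carrier → Carrier) → ∑ᶠ (λ x → ∑< n (λ i → f i x)) ≈ ∑< n (λ i → ∑ᶠ (f i))
  ∑ᶠ-∑< zero    f = sum-replicate-zero (q ℕ.^ 2)
  ∑ᶠ-∑< (suc n) f = trans (∑-distrib-+ {q ℕ.^ 2} _ _) (+-congʳ (∑ᶠ-∑< n f))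

  ∑ᶠ-*ˡ : ∀ x f → ∑ᶠ (λ y → x * f y) ≈ x * ∑ᶠ f
  ∑ᶠ-*ˡ x f = sym (*-distribˡ-sum {q ℕ.^ 2} x _)

  -- In characteristic two all binomial coefficients of 2^j − 1 are odd.
  [x+y]^[2^j-1] : ∀ j x y → (x + y) ^ (2 ℕ.^ j ℕ.∸ 1) ≈ ∑< (2 ℕ.^ j) (λ i → x ^ (2 ℕ.^ j ℕ.∸ 1 ℕ.∸ i) * y ^ i)
  [x+y]^[2^j-1] zero    x y = sym (trans (+-identityˡ _) (*-identityˡ 1#))
  [x+y]^[2^j-1] (suc j) x y = begin
    (x + y) ^ (M ℕ.+ (M ℕ.+ 0) ℕ.∸ 1)                        ≡⟨ ≡.cong (λ n → (x + y) ^ (M ℕ.+ n ℕ.∸ 1)) (ℕₚ.+-identityʳ M) ⟩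
    (x + y) ^ (M ℕ.+ M ℕ.∸ 1)                                ≡⟨ ≡.cong ((x + y) ^_) (ℕₚ.+-∸-assoc M 1≤M) ⟩
    (x + y) ^ (M ℕ.+ (M ℕ.∸ 1))                              ≈⟨ ^-homo-* (x + y) M (M ℕ.∸ 1) ⟩
    (x + y) ^ M * (x + y) ^ (M ℕ.∸ 1)                        ≈⟨ *-cong (frob-+ j x y) ([x+y]^[2^j-1] j x y) ⟩
    (x ^ M + y ^ M) * ∑< M (t M)                             ≈⟨ distribʳ _ _ _ ⟩
    x ^ M * ∑< M (t M) + y ^ M * ∑< M (t M)                  ≈⟨ +-cong (sym (∑<-*ˡ M _ _)) (sym (∑<-*ˡ M _ _)) ⟩
    ∑< M (λ i → x ^ M * t M i) + ∑< M (λ i → y ^ M * t M i)  ≈⟨ +-cong (∑<-cong M low) (∑<-cong M high) ⟩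
    ∑< M (t (M ℕ.+ M)) + ∑< M (λ i → t (M ℕ.+ M) (M ℕ.+ i))  ≈⟨ ∑<-split M M (t (M ℕ.+ M)) ⟨
    ∑< (M ℕ.+ M) (t (M ℕ.+ M))                               ≡⟨ ≡.cong (λ n → ∑< (M ℕ.+ n) (t (M ℕ.+ n))) (ℕₚ.+-identityʳ M) ⟨
    ∑< (M ℕ.+ (M ℕ.+ 0)) (t (M ℕ.+ (M ℕ.+ 0)))               ∎
    where
    M = 2 ℕ.^ j
    1≤M : 1 ℕ.≤ M
    1≤M = ℕₚ.m^n>0 2 j
    t : ℕ → ℕ → Carrier
    t n i = x ^ (n ℕ.∸ 1 ℕ.∸ i) * y ^ i
    low : ∀ i → i ℕ.< M → x ^ M * t M i ≈ t (M ℕ.+ M) i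
    low i i<M = begin
      x ^ M * (x ^ (M ℕ.∸ 1 ℕ.∸ i) * y ^ i)   ≈⟨ *-assoc _ _ _ ⟨
      x ^ M * x ^ (M ℕ.∸ 1 ℕ.∸ i) * y ^ i     ≈⟨ *-congʳ (^-homo-* x M _) ⟨
      x ^ (M ℕ.+ (M ℕ.∸ 1 ℕ.∸ i)) * y ^ i     ≡⟨ ≡.cong (λ n → x ^ n * y ^ i)
                                                   (≡.trans (≡.sym (ℕₚ.+-∸-assoc M (ℕₚ.≤-pred (≡.subst (i ℕ.<_) (≡.sym (ℕₚ.m+[n∸m]≡n 1≤M)) i<M))))
                                                            (≡.cong (ℕ._∸ i) (≡.sym (ℕₚ.+-∸-assoc M 1≤M)))) ⟩
      t (M ℕ.+ M) i                           ∎
    high : ∀ i → i ℕ.< M → y ^ M * t M i ≈ t (M ℕ.+ M) (M ℕ.+ i)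
    high i i<M = begin
      y ^ M * (x ^ (M ℕ.∸ 1 ℕ.∸ i) * y ^ i)   ≈⟨ Plain.solve 3 (λ a b c → a Plain.⊗ (b Plain.⊗ c) Plain.⊜ b Plain.⊗ (a Plain.⊗ c)) refl _ _ _ ⟩
      x ^ (M ℕ.∸ 1 ℕ.∸ i) * (y ^ M * y ^ i)   ≈⟨ *-congˡ (^-homo-* y M i) ⟨
      x ^ (M ℕ.∸ 1 ℕ.∸ i) * y ^ (M ℕ.+ i)     ≡⟨ ≡.cong (λ n → x ^ n * y ^ (M ℕ.+ i))
                                                  (≡.trans (≡.cong (ℕ._∸ i) (≡.sym (≡.trans (≡.cong (ℕ._∸ M) (ℕₚ.+-∸-assoc M 1≤M)) (ℕₚ.m+n∸m≡n M (M ℕ.∸ 1)))))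
                                                           (ℕₚ.∸-+-assoc (M ℕ.+ M ℕ.∸ 1) M i)) ⟩
      t (M ℕ.+ M) (M ℕ.+ i)                   ∎

  -- Horner form as a predicate on functions. Coefficients occur only as witnesses and are never
  -- compared; all that is drawn from it is a bound on the number of roots.
  Monic : ℕ → (Carrier → Carrier) → Set _
  Monic zero    f = ∀ x → f x ≈ 1#
  Monic (suc d) f = ∃₂ λ g a → Monic d g × (∀ x → f x ≈ a + x * g x)

  DegreeBelow : ℕ → (Carrier → Carrier) → Set _
  DegreeBelow zero    f = ∀ x → f x ≈ 0#
  DegreeBelow (suc d) f = ∃₂ λ g a → DegreeBelow d g × (∀ x → f x ≈ a + x * g x)

  x^d-monic : ∀ d → Monic d (_^ d)
  x^d-monic zero    = λ _ → refl
  x^d-monic (suc d) = (_^ d) , 0# , x^d-monic d , λ x → sym (+-identityˡ _)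

  monic⇒degreeBelow : ∀ d {f} → Monic d f → DegreeBelow (suc d) f
  monic⇒degreeBelow zero    f≈1               = (λ _ → 0#) , 1# , (λ _ → refl) , λ x →
    trans (f≈1 x) (sym (trans (+-congˡ (zeroʳ x)) (+-identityʳ 1#)))
  monic⇒degreeBelow (suc d) (g , a , g-monic , f≈) = g , a , monic⇒degreeBelow d g-monic , f≈

  0-degreeBelow : ∀ d → DegreeBelow d (λ _ → 0#)
  0-degreeBelow zero    = λ _ → refl
  0-degreeBelow (suc d) = (λ _ → 0#) , 0# , 0-degreeBelow d , λ x → sym (trans (+-identityˡ _) (zeroʳ x))

  degreeBelow-cong : ∀ d {f g} → (∀ x → g x ≈ f x) → DegreeBelow d f → DegreeBelow d g
  degreeBelow-cong zero    g≈f f≈0              = λ x → trans (g≈f x) (f≈0 x)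
  degreeBelow-cong (suc d) g≈f (h , a , hd , f≈) = h , a , hd , λ x → trans (g≈f x) (f≈ x)

  degreeBelow-mono : ∀ {d d′ f} → d ℕ.≤ d′ → DegreeBelow d f → DegreeBelow d′ f
  degreeBelow-mono {d′ = d′} z≤n f≈0            = degreeBelow-cong d′ f≈0 (0-degreeBelow d′)
  degreeBelow-mono (s≤s d≤d′) (g , a , gd , f≈) = g , a , degreeBelow-mono d≤d′ gd , f≈

  +-horner : ∀ {f g f₁ g₁ : Carrier → Carrier} {a b} → (∀ x → f x ≈ a + x * f₁ x) → (∀ x → g x ≈ b + x * g₁ x) →
             ∀ x → f x + g x ≈ a + b + x * (f₁ x + g₁ x)
  +-horner f≈ g≈ x = trans (+-cong (f≈ x) (g≈ x))
    (Plain.solve 5 (λ a b x u v → a ⊕ x ⊗ u ⊕ (b ⊕ x ⊗ v) ⊜ a ⊕ b ⊕ x ⊗ (u ⊕ v)) refl _ _ x _ _)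
    where open Plain

  degreeBelow-+ : ∀ d {f g} → DegreeBelow d f → DegreeBelow d g → DegreeBelow d (λ x → f x + g x)
  degreeBelow-+ zero    f≈0 g≈0 x = trans (+-cong (f≈0 x) (g≈0 x)) (+-identityˡ 0#)
  degreeBelow-+ (suc d) (f₁ , a , fd , f≈) (g₁ , b , gd , g≈) =
    _ , _ , degreeBelow-+ d fd gd , +-horner f≈ g≈

  monic-+ : ∀ d {f g} → Monic d f → DegreeBelow d g → Monic d (λ x → f x + g x)
  monic-+ zero    f≈1 g≈0 x = trans (+-cong (f≈1 x) (g≈0 x)) (+-identityʳ 1#)
  monic-+ (suc d) (f₁ , a , fd , f≈) (g₁ , b , gd , g≈) =
    _ , _ , monic-+ d fd gd , +-horner f≈ g≈

  -- Synthetic division, with `x + r` for x - r in characteristic two. The quotient is again in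
  -- Horner form.
  monic-factor : ∀ d {f} → Monic (suc d) f → ∀ r → ∃ λ g → Monic d g × (∀ x → f x ≈ f r + (x + r) * g x)
  monic-factor zero {f} (g , a , g≈1 , f≈) r = g , g≈1 , λ x → begin
    f x                            ≈⟨ f≈ x ⟩
    a + x * g x                    ≈⟨ +-congˡ (*-congˡ (g≈1 x)) ⟩
    a + x * 1#                     ≈⟨ Plain.solve 3 (λ a x r → a ⊕ x ⊗ :1 ⊜ a ⊕ r ⊗ :1 ⊕ (x ⊕ r) ⊗ :1) refl a x r ⟩
    a + r * 1# + (x + r) * 1#      ≈⟨ +-cong (+-congˡ (*-congˡ (g≈1 r))) (*-congˡ (g≈1 x)) ⟨
    a + r * g r + (x + r) * g x    ≈⟨ +-congʳ (f≈ r) ⟨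
    f r + (x + r) * g x            ∎
    where open Plain
  monic-factor (suc d) {f} (h , a , h-monic , f≈) r with monic-factor d h-monic r
  ... | g , g-monic , h≈ = (λ x → h r + x * g x) , (g , h r , g-monic , λ _ → refl) , λ x → begin
    f x                                            ≈⟨ f≈ x ⟩
    a + x * h x                                    ≈⟨ +-congˡ (*-congˡ (h≈ x)) ⟩
    a + x * (h r + (x + r) * g x)                  ≈⟨ Plain.solve 5 (λ a x r u v → a ⊕ x ⊗ (u ⊕ (x ⊕ r) ⊗ v) ⊜
                                                         a ⊕ r ⊗ u ⊕ (x ⊕ r) ⊗ (u ⊕ x ⊗ v)) refl a x r (h r) (g x) ⟩
    a + r * h r + (x + r) * (h r + x * g x)        ≈⟨ +-congʳ (f≈ r) ⟨
    f r + (x + r) * (h r + x * g x)                ∎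
    where open Plain

  monic-roots : ∀ d {f} → Monic d f → (t : Fin (suc d) → Carrier) → (∀ {i j} → t i ≈ t j → i ≡ j) →
                ¬ (∀ i → f (t i) ≈ 0#)
  monic-roots zero    f≈1     t t-inj f≈0 = 0≉1 (trans (sym (f≈0 zero)) (f≈1 _))
  monic-roots (suc d) {f} f-monic t t-inj f≈0 with monic-factor d f-monic (t zero)
  ... | g , g-monic , f≈ = monic-roots d g-monic (t ∘ suc) (Finₚ.suc-injective ∘ t-inj) λ i →
    x*y≈0⇒y≈0 (λ eq → contradiction (t-inj (x+y≈0⇒x≈y eq)) λ ())
      (trans (sym (+-identityˡ _)) (trans (+-congʳ (sym (f≈0 zero))) (trans (sym (f≈ (t (suc i)))) (f≈0 (suc i)))))

  abstract
    monic-nonvanishing : ∀ d {f} → Monic d f → d ℕ.< q ℕ.^ 2 → ∃ λ x → ¬ f x ≈ 0#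
    monic-nonvanishing d {f} f-monic d<q² with Finₚ.¬∀⟶∃¬ (q ℕ.^ 2) _ (λ i → f (element i) ≟ 0#)
      (λ f≈0 → monic-roots d f-monic (λ i → element (Fin.inject≤ i d<q²))
                 (Finₚ.inject≤-injective d<q² d<q² _ _ ∘ element-injective) (λ i → f≈0 _))
      where open Inverse enumeration using () renaming (from to element)
    ... | i , f≉0 = element i , f≉0
      where open Inverse enumeration using () renaming (from to element)

-- Power sums and additive Hilbert 90

module PowerSums {c ℓ} (k : ℕ) .{{_ : NonZero k}} (F : FiniteField c ℓ ((2 ℕ.^ k) ℕ.^ 2)) where
  open QuadraticField k F
  open RangeSums k F
  open Inverse enumeration using () renaming (to to index; to-cong to index-cong; from to element
    ; strictlyInverseˡ to index-element; strictlyInverseʳ to element-index)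
  open SemiringSum semiring using (sum-replicate; ∑-distrib-+)
  open SumProperties +-commutativeMonoid using (sum-single)
  open SetoidReasoning setoid

  frob-0 : ∀ j → frob j 0# ≈ 0#
  frob-0 j = IsEndomorphism.0-homo (frob-isEndomorphism j)

  frob-1 : ∀ j → frob j 1# ≈ 1#
  frob-1 j = IsEndomorphism.1-homo (frob-isEndomorphism j)

  frob-* : ∀ j x y → frob j (x * y) ≈ frob j x * frob j y
  frob-* j = IsEndomorphism.*-homo (frob-isEndomorphism j)

  frob-cong : ∀ j {x y} → x ≈ y → frob j x ≈ frob j y
  frob-cong j = ^-congˡ (2 ℕ.^ j)

  frob≈0 : ∀ j {x} → frob j x ≈ 0# → x ≈ 0#
  frob≈0 j = x^m≈0⇒x≈0 (2 ℕ.^ j)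

  frob-injective : ∀ j {x y} → frob j x ≈ frob j y → x ≈ y
  frob-injective j eq = x+y≈0⇒x≈y (frob≈0 j (trans (frob-+ j _ _) (x≈y⇒x+y≈0 eq)))

  q-1 : ℕ
  q-1 = q ℕ.∸ 1

  2≤q : 2 ℕ.≤ q
  2≤q = ℕₚ.≤-trans (ℕₚ.≤-reflexive (≡.sym (ℕₚ.^-identityʳ 2))) (ℕₚ.^-monoʳ-≤ 2 (ℕ.>-nonZero⁻¹ k))

  q≡1+[q-1] : q ≡ suc q-1
  q≡1+[q-1] = ≡.sym (ℕₚ.m+[n∸m]≡n (ℕₚ.m^n>0 2 k))

  0<q-1 : 0 ℕ.< q-1
  0<q-1 = ℕₚ.∸-monoˡ-≤ 1 2≤q

  q²≡1+[q-1][q+1] : q ℕ.^ 2 ≡ suc (q-1 ℕ.* (q ℕ.+ 1))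
  q²≡1+[q-1][q+1] = ≡.subst (λ n → n ℕ.^ 2 ≡ suc (q-1 ℕ.* (n ℕ.+ 1))) (≡.sym q≡1+[q-1]) (identity q-1)
    where
    identity : ∀ p → suc p ℕ.* (suc p ℕ.* 1) ≡ suc (p ℕ.* (suc p ℕ.+ 1))
    identity = solve-∀

  x^[q²-1]≈1 : ∀ {x} → ¬ x ≈ 0# → x ^ (q-1 ℕ.* (q ℕ.+ 1)) ≈ 1#
  x^[q²-1]≈1 {x} x≉0 = *-cancelˡ x≉0 (begin
    x ^ suc (q-1 ℕ.* (q ℕ.+ 1))   ≡⟨ ≡.cong (x ^_) q²≡1+[q-1][q+1] ⟨
    x ^ (q ℕ.^ 2)                 ≈⟨ x^n≈x x ⟩
    x                             ≈⟨ *-identityʳ x ⟨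
    x * 1#                        ∎)

  -- Scaling the summation variable by `x` multiplies the sum by `x ^ E`. The hypothesis packs
  -- `x ≉ 0` and `x ^ E ≉ 1` into a single non-root condition, the form in which root counting
  -- supplies `x`.
  ∑ᶠ-power≈0-by : ∀ E x → ¬ x ^ suc E + x ≈ 0# → ∑ᶠ (_^ E) ≈ 0#
  ∑ᶠ-power≈0-by E x x^[1+E]+x≉0 =
    x*y≈0⇒y≈0 x^E+1≉0 (trans (distribʳ _ _ _) (x≈y⇒x+y≈0 (trans (sym scaled) (sym (*-identityˡ _)))))
    where
    x≉0 : ¬ x ≈ 0#
    x≉0 x≈0 = x^[1+E]+x≉0 (trans (+-cong (trans (*-congʳ x≈0) (zeroˡ _)) x≈0) (+-identityˡ 0#))
    x^E+1≉0 : ¬ x ^ E + 1# ≈ 0#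
    x^E+1≉0 eq = x^[1+E]+x≉0 (trans (+-congˡ (sym (*-identityʳ x))) (trans (sym (distribˡ x _ _)) (trans (*-congˡ eq) (zeroʳ x))))
    scaled : ∑ᶠ (_^ E) ≈ x ^ E * ∑ᶠ (_^ E)
    scaled = trans (∑ᶠ-reindex (_^ E) (x *_) (^-congˡ E) *-congˡ (*-cancelˡ x≉0))
      (trans (∑ᶠ-cong λ y → ^-distrib-* x y E) (∑ᶠ-*ˡ (x ^ E) (_^ E)))

  ∑ᶠ-power≈0 : ∀ E → 0 ℕ.< E → suc E ℕ.< q ℕ.^ 2 → ∑ᶠ (_^ E) ≈ 0#
  ∑ᶠ-power≈0 E 0<E E<q²-1 = ∑ᶠ-power≈0-by E (proj₁ nonvanishing) (proj₂ nonvanishing)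
    where
    monic : Monic (suc E) (λ x → x ^ suc E + x)
    monic = monic-+ (suc E) (x^d-monic (suc E)) (degreeBelow-mono (s≤s 0<E)
      (degreeBelow-cong 2 (λ x → sym (*-identityʳ x)) (monic⇒degreeBelow 1 (x^d-monic 1))))
    nonvanishing : ∃ λ x → ¬ x ^ suc E + x ≈ 0#
    nonvanishing = monic-nonvanishing (suc E) monic E<q²-1

  -- The exponent is q² - 1, so `x ^ E + 1#` is the indicator function of zero. The remaining copies
  -- of `1#` add up to `n · 1#`, which vanishes.
  ∑ᶠ-power≈1 : ∑ᶠ (_^ (q-1 ℕ.* (q ℕ.+ 1))) ≈ 1#
  ∑ᶠ-power≈1 = begin
    ∑ᶠ (_^ E)                              ≈⟨ ∑ᶠ-cong (λ x → Plain.solve 2 (λ a b → a Plain.⊜ a Plain.⊕ b Plain.⊕ b) refl (x ^ E) 1#) ⟩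
    ∑ᶠ (λ x → x ^ E + 1# + 1#)             ≈⟨ ∑-distrib-+ (λ i → element i ^ E + 1#) (λ _ → 1#) ⟩
    ∑ᶠ (λ x → x ^ E + 1#) + ∑ᶠ (λ _ → 1#)  ≈⟨ +-cong (sum-single (λ i → element i ^ E + 1#) (index 0#) away) (trans (sum-replicate (q ℕ.^ 2)) n·1≈0) ⟩
    element (index 0#) ^ E + 1# + 0#       ≈⟨ +-identityʳ _ ⟩
    element (index 0#) ^ E + 1#            ≈⟨ +-congʳ (trans (^-congˡ E (element-index 0#)) (0^m≈0 E {{ℕ.>-nonZero 0<E}})) ⟩
    0# + 1#                                ≈⟨ +-identityˡ 1# ⟩
    1#                                     ∎
    where
    E = q-1 ℕ.* (q ℕ.+ 1)
    0<E : 0 ℕ.< E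
    0<E = ℕₚ.*-mono-< 0<q-1 (ℕₚ.m≤n⇒m≤o+n q ℕₚ.≤-refl)
    away : ∀ j → j ≢ index 0# → element j ^ E + 1# ≈ 0#
    away j j≢ = x≈y⇒x+y≈0 (x^[q²-1]≈1 λ eq → j≢ (≡.trans (≡.sym (index-element j)) (index-cong eq)))

  zero-or-unit : ∀ {p} {P : Set p} x → (x ≈ 0# → P) → (¬ x ≈ 0# → P) → P
  zero-or-unit x case0 case≉0 with x ≟ 0#
  ... | yes x≈0 = case0 x≈0
  ... | no  x≉0 = case≉0 x≉0

  x^[q²-1+m]≈x^m : ∀ x m .{{_ : NonZero m}} → x ^ (q-1 ℕ.* (q ℕ.+ 1) ℕ.+ m) ≈ x ^ m
  x^[q²-1+m]≈x^m x (suc m) = begin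
    x ^ (q-1 ℕ.* (q ℕ.+ 1) ℕ.+ suc m)     ≈⟨ ^-homo-* x (q-1 ℕ.* (q ℕ.+ 1)) (suc m) ⟩
    x ^ (q-1 ℕ.* (q ℕ.+ 1)) * (x * x ^ m) ≈⟨ Plain.solve 3 (λ a x b → a ⊗ (x ⊗ b) ⊜ x ⊗ a ⊗ b) refl _ x (x ^ m) ⟩
    x ^ suc (q-1 ℕ.* (q ℕ.+ 1)) * x ^ m   ≡⟨ ≡.cong (λ n → x ^ n * x ^ m) q²≡1+[q-1][q+1] ⟨
    x ^ (q ℕ.^ 2) * x ^ m                 ≈⟨ *-congʳ (x^n≈x x) ⟩
    x ^ suc m                             ∎
    where open Plain

  ∑ᶠ-power-multiple-below : ∀ J → 0 ℕ.< J → J ℕ.< q ℕ.+ 1 → ∑ᶠ (_^ (q-1 ℕ.* J)) ≈ 0#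
  ∑ᶠ-power-multiple-below J 0<J J<q+1 = ∑ᶠ-power≈0 (q-1 ℕ.* J) (ℕₚ.*-mono-< 0<q-1 0<J)
    (≡.subst (suc (q-1 ℕ.* J) ℕ.<_) (≡.sym q²≡1+[q-1][q+1])
      (s≤s (ℕₚ.*-monoʳ-< q-1 {{ℕ.>-nonZero 0<q-1}} J<q+1)))

  -- Positive exponents matter only modulo q² - 1, and a single reduction covers the range that
  -- Hermite's criterion meets. The excluded `J` gives the exponent q² - 1 itself, whose sum is 1.
  ∑ᶠ-power-multiple≈0 : ∀ J → 0 ℕ.< J → J ℕ.< (q ℕ.+ 1) ℕ.+ (q ℕ.+ 1) → J ≢ q ℕ.+ 1 → ∑ᶠ (_^ (q-1 ℕ.* J)) ≈ 0#
  ∑ᶠ-power-multiple≈0 J 0<J J<2[q+1] J≢q+1 =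
    [ ∑ᶠ-power-multiple-below J 0<J , above ]′ (ℕₚ.<-≤-connex J (q ℕ.+ 1))
    where
    above : q ℕ.+ 1 ℕ.≤ J → ∑ᶠ (_^ (q-1 ℕ.* J)) ≈ 0#
    above q+1≤J = trans (∑ᶠ-cong reduce) (∑ᶠ-power-multiple-below J′ 0<J′ J′<q+1)
      where
      J′ = J ℕ.∸ (q ℕ.+ 1)
      J≡ : J ≡ q ℕ.+ 1 ℕ.+ J′
      J≡ = ≡.sym (ℕₚ.m+[n∸m]≡n q+1≤J)
      0<J′ : 0 ℕ.< J′
      0<J′ = ℕₚ.m<n⇒0<n∸m (ℕₚ.≤∧≢⇒< q+1≤J (J≢q+1 ∘ ≡.sym))
      J′<q+1 : J′ ℕ.< q ℕ.+ 1
      J′<q+1 = ℕₚ.+-cancelˡ-< (q ℕ.+ 1) _ _ (≡.subst (ℕ._< (q ℕ.+ 1) ℕ.+ (q ℕ.+ 1)) J≡ J<2[q+1])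
      reduce : ∀ x → x ^ (q-1 ℕ.* J) ≈ x ^ (q-1 ℕ.* J′)
      reduce x = begin
        x ^ (q-1 ℕ.* J)                                    ≡⟨ ≡.cong (λ n → x ^ (q-1 ℕ.* n)) J≡ ⟩
        x ^ (q-1 ℕ.* (q ℕ.+ 1 ℕ.+ J′))                     ≡⟨ ≡.cong (x ^_) (ℕₚ.*-distribˡ-+ q-1 (q ℕ.+ 1) J′) ⟩
        x ^ (q-1 ℕ.* (q ℕ.+ 1) ℕ.+ q-1 ℕ.* J′)             ≈⟨ x^[q²-1+m]≈x^m x (q-1 ℕ.* J′) {{ℕ.>-nonZero (ℕₚ.*-mono-< 0<q-1 0<J′)}} ⟩
        x ^ (q-1 ℕ.* J′)                                   ∎

  frob-2k : ∀ x → frob (k ℕ.+ k) x ≈ x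
  frob-2k x = trans (sym (frob-∘ k k x)) (conj-involutive x)

module AdditiveHilbert90 {c ℓ} (k : ℕ) .{{_ : NonZero k}} (F : FiniteField c ℓ ((2 ℕ.^ k) ℕ.^ 2))
  where
  open QuadraticField k F
  open RangeSums k F
  open PowerSums k F
  open SetoidReasoning setoid

  module _ (e n : ℕ) .{{_ : NonZero e}} (ne≡2k : n ℕ.* e ≡ k ℕ.+ k) where

    -- The trace onto the fixed field of `frob e`. Hilbert 90 is needed over three subfields: those
    -- of 2, 2^m and 2^k elements.
    trace : Carrier → Carrier
    trace x = ∑< n (λ i → frob (i ℕ.* e) x)

    frob-ne : ∀ x → frob (n ℕ.* e) x ≈ x
    frob-ne x = trans (reflexive (≡.cong (λ m → frob m x) ne≡2k)) (frob-2k x)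

    frob-suc : ∀ i x → frob e (frob (i ℕ.* e) x) ≈ frob (suc i ℕ.* e) x
    frob-suc i x = trans (frob-∘ (i ℕ.* e) e x) (reflexive (≡.cong (λ m → frob m x) (ℕₚ.+-comm (i ℕ.* e) e)))

    frob-0e : ∀ x → frob 0 x ≈ x
    frob-0e x = *-identityʳ x

    trace-fixed : ∀ x → frob e (trace x) ≈ trace x
    trace-fixed x = begin
      frob e (trace x)                                   ≈⟨ frob-∑< e n _ ⟩
      ∑< n (λ i → frob e (frob (i ℕ.* e) x))             ≈⟨ ∑<-cong n (λ i _ → frob-suc i x) ⟩
      ∑< n (λ i → frob (suc i ℕ.* e) x)                  ≈⟨ ∑<-shift n (λ i → frob (i ℕ.* e) x) ⟩
      trace x + (frob 0 x + frob (n ℕ.* e) x)            ≈⟨ +-congˡ (x≈y⇒x+y≈0 (trans (frob-0e x) (sym (frob-ne x)))) ⟩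
      trace x + 0#                                       ≈⟨ +-identityʳ _ ⟩
      trace x                                            ∎

    abstract
      -- As a polynomial the trace is monic of degree 2^((n-1)e), less than q² = 2^(ne), so the
      -- field has too many elements for all of them to be roots.
      trace-nonzero : ∃ λ x → ¬ trace x ≈ 0#
      trace-nonzero = go n ne≡2k
        where
        go : ∀ n → n ℕ.* e ≡ k ℕ.+ k → ∃ λ x → ¬ ∑< n (λ i → frob (i ℕ.* e) x) ≈ 0#
        go zero    0≡2k = contradiction (≡.sym 0≡2k) (ℕ.≢-nonZero⁻¹ (k ℕ.+ k) {{ℕ.>-nonZero (ℕₚ.≤-trans (ℕ.>-nonZero⁻¹ k) (ℕₚ.m≤m+n k k))}})
        go (suc n) 1+n*e≡2k with monic-nonvanishing (2 ℕ.^ (n ℕ.* e)) monic bound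
          where
          lower : ∀ m → m ℕ.≤ n → DegreeBelow (2 ℕ.^ (n ℕ.* e)) (λ x → ∑< m (λ i → frob (i ℕ.* e) x))
          lower zero    _   = 0-degreeBelow (2 ℕ.^ (n ℕ.* e))
          lower (suc m) m<n = degreeBelow-+ (2 ℕ.^ (n ℕ.* e)) (lower m (ℕₚ.<⇒≤ m<n))
            (degreeBelow-mono (ℕₚ.^-monoʳ-< 2 (s≤s (s≤s z≤n)) (ℕₚ.*-monoˡ-< e m<n))
              (monic⇒degreeBelow (2 ℕ.^ (m ℕ.* e)) (x^d-monic (2 ℕ.^ (m ℕ.* e)))))
          monic : Monic (2 ℕ.^ (n ℕ.* e)) (λ x → frob (n ℕ.* e) x + ∑< n (λ i → frob (i ℕ.* e) x))
          monic = monic-+ (2 ℕ.^ (n ℕ.* e)) (x^d-monic (2 ℕ.^ (n ℕ.* e))) (lower n ℕₚ.≤-refl)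
          bound : 2 ℕ.^ (n ℕ.* e) ℕ.< q ℕ.^ 2
          bound = ≡.subst (2 ℕ.^ (n ℕ.* e) ℕ.<_)
            (≡.trans (≡.cong (2 ℕ.^_) (≡.trans 1+n*e≡2k (≡.trans (≡.cong (k ℕ.+_) (≡.sym (ℕₚ.+-identityʳ k))) (ℕₚ.*-comm 2 k))))
                     (≡.sym (ℕₚ.^-*-assoc 2 k 2)))
            (ℕₚ.^-monoʳ-< 2 (s≤s (s≤s z≤n)) (ℕₚ.m<n+m (n ℕ.* e) (ℕ.>-nonZero⁻¹ e)))
        ... | x , ≉0 = x , λ ≈0 → ≉0 (trans (+-comm _ _) ≈0)

      frob-fixed : ∀ {x} → frob e x ≈ x → ∀ i → frob (i ℕ.* e) x ≈ x
      frob-fixed {x} fixed zero    = *-identityʳ x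
      frob-fixed {x} fixed (suc i) = trans (sym (frob-suc i x)) (trans (frob-cong e (frob-fixed fixed i)) fixed)

      -- A nonzero value of the trace is fixed by `frob e`, hence so is its inverse, and the trace
      -- is linear in such factors.
      trace-one : ∃ λ x → trace x ≈ 1#
      trace-one with trace-nonzero
      ... | x , τ≉0 = τ⁻¹ * x , (begin
        trace (τ⁻¹ * x)                        ≈⟨ ∑<-cong n (λ i _ → trans (frob-* (i ℕ.* e) τ⁻¹ x) (*-congʳ (frob-fixed τ⁻¹-fixed i))) ⟩
        ∑< n (λ i → τ⁻¹ * frob (i ℕ.* e) x)    ≈⟨ ∑<-*ˡ n τ⁻¹ _ ⟩
        τ⁻¹ * trace x                          ≈⟨ inverseˡ τ≉0 ⟩
        1#                                     ∎)
        where
        τ⁻¹ : Carrier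
        τ⁻¹ = (trace x) ⁻¹⟨ τ≉0 ⟩
        τ⁻¹-fixed : frob e τ⁻¹ ≈ τ⁻¹
        τ⁻¹-fixed = *-cancelˡ τ≉0 (begin
          trace x * frob e τ⁻¹            ≈⟨ *-congʳ (trace-fixed x) ⟨
          frob e (trace x) * frob e τ⁻¹   ≈⟨ frob-* e _ _ ⟨
          frob e (trace x * τ⁻¹)          ≈⟨ frob-cong e (inverseʳ τ≉0) ⟩
          frob e 1#                       ≈⟨ frob-1 e ⟩
          1#                              ≈⟨ inverseʳ τ≉0 ⟨
          trace x * τ⁻¹                   ∎)

      -- Additive Hilbert 90: y = Σⱼ Sⱼ(a) x^(2^(e j)), where Sⱼ(a) is the j-th
      -- partial sum of the trace of a and x has trace 1.
      hilbert90 : ∀ a → trace a ≈ 0# → ∃ λ y → frob e y ≈ y + a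
      hilbert90 a τa≈0 with trace-one
      ... | x , τx≈1 = ∑< n G , (begin
        frob e (∑< n G)                                               ≈⟨ frob-∑< e n G ⟩
        ∑< n (frob e ∘ G)                                             ≈⟨ ∑<-cong n (λ j _ → step j) ⟩
        ∑< n (λ j → G (suc j) + a * frob (suc j ℕ.* e) x)             ≈⟨ ∑<-+ n (G ∘ suc) _ ⟩
        ∑< n (G ∘ suc) + ∑< n (λ j → a * frob (suc j ℕ.* e) x)        ≈⟨ +-cong G-shift (trans (∑<-*ˡ n a _) (*-congˡ X-shift)) ⟩
        ∑< n G + a * 1#                                               ≈⟨ +-congˡ (*-identityʳ a) ⟩
        ∑< n G + a                                                    ∎)
        where
        S G : ℕ → Carrier
        S j = ∑< j (λ i → frob (i ℕ.* e) a)
        G j = S j * frob (j ℕ.* e) x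
        frob-S : ∀ j → frob e (S j) ≈ S (suc j) + a
        frob-S j = begin
          frob e (S j)                                     ≈⟨ frob-∑< e j _ ⟩
          ∑< j (λ i → frob e (frob (i ℕ.* e) a))           ≈⟨ ∑<-cong j (λ i _ → frob-suc i a) ⟩
          ∑< j (λ i → frob (suc i ℕ.* e) a)                ≈⟨ ∑<-shift j (λ i → frob (i ℕ.* e) a) ⟩
          S j + (frob 0 a + frob (j ℕ.* e) a)              ≈⟨ +-congˡ (+-congʳ (*-identityʳ a)) ⟩
          S j + (a + frob (j ℕ.* e) a)                     ≈⟨ Plain.solve 3 (λ s a f → s ⊕ (a ⊕ f) ⊜ s ⊕ f ⊕ a) refl _ _ _ ⟩
          S (suc j) + a                                    ∎
          where open Plain
        step : ∀ j → frob e (G j) ≈ G (suc j) + a * frob (suc j ℕ.* e) x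
        step j = begin
          frob e (G j)                                     ≈⟨ frob-* e _ _ ⟩
          frob e (S j) * frob e (frob (j ℕ.* e) x)         ≈⟨ *-cong (frob-S j) (frob-suc j x) ⟩
          (S (suc j) + a) * frob (suc j ℕ.* e) x           ≈⟨ distribʳ _ _ _ ⟩
          G (suc j) + a * frob (suc j ℕ.* e) x             ∎
        -- Both boundary terms vanish: `S 0` is an empty sum and `S n` is the trace of `a`.
        G-shift : ∑< n (G ∘ suc) ≈ ∑< n G
        G-shift = trans (∑<-shift n G) (trans (+-congˡ (trans (+-cong (zeroˡ _) (trans (*-congʳ τa≈0) (zeroˡ _))) (+-identityˡ 0#))) (+-identityʳ _))
        X-shift : ∑< n (λ j → frob (suc j ℕ.* e) x) ≈ 1#
        X-shift = trans (sym (trans (frob-∑< e n _) (∑<-cong n (λ i _ → frob-suc i x)))) (trans (trace-fixed x) τx≈1)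

-- Lines over 𝔽_q and Hermite's criterion

module Wedge {c ℓ} (k : ℕ) .{{_ : NonZero k}} (F : FiniteField c ℓ ((2 ℕ.^ k) ℕ.^ 2)) where
  open QuadraticField k F
  open RangeSums k F
  open PowerSums k F
  open AdditiveHilbert90 k F
  open SetoidReasoning setoid
  open Solver using (Expr; #_; _⊕_; _⊗_; _⁻; _⊜_; solve)

  infixl 7 _∧_ _:∧_

  -- x ∧ y vanishes exactly when x and y are linearly dependent over 𝔽_q.
  _∧_ : Carrier → Carrier → Carrier
  x ∧ y = x * conj y + conj x * y

  N T : Carrier → Carrier
  N x = x * conj x
  T x = x + conj x

  _:∧_ : ∀ {n} → Expr n → Expr n → Expr n
  x :∧ y = x ⊗ y ⁻ ⊕ x ⁻ ⊗ y

  :N :T : ∀ {n} → Expr n → Expr n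
  :N x = x ⊗ x ⁻
  :T x = x ⊕ x ⁻

  conj-cong : ∀ {x y} → x ≈ y → conj x ≈ conj y
  conj-cong = frob-cong k

  conj-≉0 : ∀ {x} → ¬ x ≈ 0# → ¬ conj x ≈ 0#
  conj-≉0 x≉0 = x≉0 ∘ frob≈0 k

  N-≉0 : ∀ {x} → ¬ x ≈ 0# → ¬ N x ≈ 0#
  N-≉0 x≉0 = *-≉0 x≉0 (conj-≉0 x≉0)

  ∧-cong : ∀ {x x′ y y′} → x ≈ x′ → y ≈ y′ → x ∧ y ≈ x′ ∧ y′
  ∧-cong x≈x′ y≈y′ = +-cong (*-cong x≈x′ (conj-cong y≈y′)) (*-cong (conj-cong x≈x′) y≈y′)

  x∧x≈0 : ∀ x → x ∧ x ≈ 0#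
  x∧x≈0 x = trans (+-congˡ (*-comm _ _)) (x+x≈0 _)

  0∧x≈0 : ∀ {x y} → x ≈ 0# → x ∧ y ≈ 0#
  0∧x≈0 {x} {y} x≈0 = trans (+-cong (trans (*-congʳ x≈0) (zeroˡ _)) (trans (*-congʳ (trans (conj-cong x≈0) (frob-0 k))) (zeroˡ _))) (+-identityˡ 0#)

  ∧-comm : ∀ x y → x ∧ y ≈ y ∧ x
  ∧-comm = solve 2 (λ x y → x :∧ y ⊜ y :∧ x) refl

  conj-∧ : ∀ x y → conj (x ∧ y) ≈ x ∧ y
  conj-∧ = solve 2 (λ x y → (x :∧ y) ⁻ ⊜ x :∧ y) refl

  conj-N : ∀ x → conj (N x) ≈ N x
  conj-N = solve 1 (λ x → (:N x) ⁻ ⊜ :N x) refl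

  frob-∧ : ∀ j x y → frob j (x ∧ y) ≈ frob j x ∧ frob j y
  frob-∧ j x y = frob-⟦⟧ j (# zero :∧ # suc zero) (x ∷ y ∷ [])

  frob-N : ∀ j x → frob j (N x) ≈ N (frob j x)
  frob-N j x = frob-⟦⟧ j (:N (# zero)) (x ∷ [])

  frob-T : ∀ j x → frob j (T x) ≈ T (frob j x)
  frob-T j x = frob-⟦⟧ j (:T (# zero)) (x ∷ [])

  frob-fixes : ∀ j {x} → conj x ≈ x → conj (frob j x) ≈ frob j x
  frob-fixes j {x} x-fixed = trans (sym (frob-conj j x)) (frob-cong j x-fixed)

  abstract
    -- Hilbert 90 applies over 𝔽_q because 1 has trace 1 + 1 = 0. Since `T ρ ≈ 1#`, this ρ yields
    -- vectors independent of a given one and writes every fixed element as a value of `T`.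
    trace-one-over-𝔽q : ∃ λ ρ → conj ρ ≈ ρ + 1#
    trace-one-over-𝔽q = hilbert90 k 2 (≡.cong (k ℕ.+_) (ℕₚ.+-identityʳ k)) 1#
      (trans (+-cong (trans (+-identityˡ _) (frob-1 0)) (frob-1 (k ℕ.+ 0))) (x+x≈0 1#))

    independent : ∀ {x} → ¬ x ≈ 0# → ∃ λ h → ¬ x ∧ h ≈ 0#
    independent {x} x≉0 with trace-one-over-𝔽q
    ... | ρ , ρ̄≈ρ+1 = ρ * x , λ x∧ρx≈0 → N-≉0 x≉0 (begin
      N x                       ≈⟨ *-identityʳ _ ⟨
      N x * 1#                  ≈⟨ *-congˡ (Plain.solve 2 (λ a b → a Plain.⊜ b Plain.⊕ (b Plain.⊕ a)) refl 1# ρ) ⟩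
      N x * (ρ + (ρ + 1#))      ≈⟨ *-congˡ (+-congˡ ρ̄≈ρ+1) ⟨
      N x * T ρ                 ≈⟨ solve 2 (λ x ρ → :N x ⊗ :T ρ ⊜ x :∧ (ρ ⊗ x)) refl x ρ ⟩
      x ∧ (ρ * x)               ≈⟨ x∧ρx≈0 ⟩
      0#                        ∎)

    dependent⇒multiple : ∀ {x y} → ¬ x ≈ 0# → x ∧ y ≈ 0# → ∃ λ s → conj s ≈ s × y ≈ s * x
    dependent⇒multiple {x} {y} x≉0 x∧y≈0 = s , *-cancelˡ (N-≉0 x≉0) (begin
      N x * conj s            ≈⟨ solve 2 (λ x s → :N x ⊗ s ⁻ ⊜ x ⊗ (s ⊗ x) ⁻) refl x s ⟩
      x * conj (s * x)        ≈⟨ *-congˡ (conj-cong y≈sx) ⟨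
      x * conj y              ≈⟨ x+y≈0⇒x≈y x∧y≈0 ⟩
      conj x * y              ≈⟨ *-congˡ y≈sx ⟩
      conj x * (s * x)        ≈⟨ solve 2 (λ x s → x ⁻ ⊗ (s ⊗ x) ⊜ :N x ⊗ s) refl x s ⟩
      N x * s                 ∎) , y≈sx
      where
      s : Carrier
      s = y * x ⁻¹⟨ x≉0 ⟩
      y≈sx : y ≈ s * x
      y≈sx = sym (trans (*-assoc _ _ _) (trans (*-congˡ (inverseˡ x≉0)) (*-identityʳ y)))

  LineInjective : (Carrier → Carrier) → Set _
  LineInjective g = ∀ x y → g x ∧ g y ≈ 0# → x ∧ y ≈ 0#

  lineInjective⇒≉0 : ∀ {g} → LineInjective g → ∀ {x} → ¬ x ≈ 0# → ¬ g x ≈ 0#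
  lineInjective⇒≉0 g-inj {x} x≉0 gx≈0 = proj₂ (independent x≉0) (g-inj x _ (0∧x≈0 gx≈0))

  s^q-1≈1 : ∀ {s} → conj s ≈ s → ¬ s ≈ 0# → s ^ q-1 ≈ 1#
  s^q-1≈1 {s} s-fixed s≉0 = *-cancelˡ s≉0 (begin
    s ^ suc q-1   ≡⟨ ≡.cong (s ^_) q≡1+[q-1] ⟨
    conj s        ≈⟨ s-fixed ⟩
    s             ≈⟨ *-identityʳ s ⟨
    s * 1#        ∎)

  -- Hermite's criterion.  The factor N x ^ J makes the map homogeneous of degree
  -- one over 𝔽_q, hence injective, and disappears in the (q − 1)-st power.
  module Hermite (r : ℕ) (r<k : r ℕ.< k) (P P′ : Carrier)
    (g-inj : LineInjective (λ x → frob r x * (P * x + P′ * conj x))) where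

    R J : ℕ
    R = 2 ℕ.^ r
    -- Over 𝔽_q, `g` has degree R + 1 and `N` has degree 2. Total degree 1 modulo q - 1 asks that q
    -- - 1 divide R + 2J; with J = R (q/2 - 1) this number is R (q - 1).
    J = R ℕ.* (2 ℕ.^ (k ℕ.∸ 1) ℕ.∸ 1)

    R<q : R ℕ.< q
    R<q = ℕₚ.^-monoʳ-< 2 (s≤s (s≤s z≤n)) r<k

    R+2J≡[q-1]R : R ℕ.+ (J ℕ.+ J) ≡ q-1 ℕ.* R
    R+2J≡[q-1]R = ≡.trans (identity R (h ℕ.∸ 1)) (≡.cong (ℕ._* R) 1+2[h-1]≡q-1)
      where
      h = 2 ℕ.^ (k ℕ.∸ 1)
      identity : ∀ R m → R ℕ.+ (R ℕ.* m ℕ.+ R ℕ.* m) ≡ (m ℕ.+ suc m) ℕ.* R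
      identity = solve-∀
      1+2[h-1]≡q-1 : h ℕ.∸ 1 ℕ.+ suc (h ℕ.∸ 1) ≡ q-1
      1+2[h-1]≡q-1 = ≡.trans (≡.cong (λ n → n ℕ.+ n ℕ.∸ 1) (ℕₚ.m+[n∸m]≡n (ℕₚ.m^n>0 2 (k ℕ.∸ 1))))
        (≡.trans (≡.cong (λ n → h ℕ.+ n ℕ.∸ 1) (≡.sym (ℕₚ.+-identityʳ h)))
                 (≡.cong (λ n → 2 ℕ.^ n ℕ.∸ 1) (ℕₚ.m+[n∸m]≡n (ℕ.>-nonZero⁻¹ k))))

    linear g g̃ : Carrier → Carrier
    linear x = P * x + P′ * conj x
    g x = frob r x * linear x
    g̃ x = g x * N x ^ J

    linear-cong : ∀ {x y} → x ≈ y → linear x ≈ linear y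
    linear-cong x≈y = +-cong (*-congˡ x≈y) (*-congˡ (conj-cong x≈y))

    g̃-cong : ∀ {x y} → x ≈ y → g̃ x ≈ g̃ y
    g̃-cong x≈y = *-cong (*-cong (frob-cong r x≈y) (linear-cong x≈y))
                        (^-congˡ J (*-cong x≈y (conj-cong x≈y)))

    s^[1+R+2J]≈s : ∀ {s} → conj s ≈ s → s * (s ^ R * (s ^ J * s ^ J)) ≈ s
    s^[1+R+2J]≈s {s} s-fixed = zero-or-unit s
      (λ s≈0 → trans (*-congʳ s≈0) (trans (zeroˡ _) (sym s≈0)))
      (λ s≉0 → begin
        s * (s ^ R * (s ^ J * s ^ J))     ≈⟨ *-congˡ (*-congˡ (^-homo-* s J J)) ⟨
        s * (s ^ R * s ^ (J ℕ.+ J))       ≈⟨ *-congˡ (^-homo-* s R (J ℕ.+ J)) ⟨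
        s * s ^ (R ℕ.+ (J ℕ.+ J))         ≡⟨ ≡.cong (λ n → s * s ^ n) R+2J≡[q-1]R ⟩
        s * s ^ (q-1 ℕ.* R)               ≈⟨ *-congˡ (^-assocʳ s q-1 R) ⟨
        s * (s ^ q-1) ^ R                 ≈⟨ *-congˡ (^-congˡ R (s^q-1≈1 s-fixed s≉0)) ⟩
        s * 1# ^ R                        ≈⟨ *-congˡ (1^m≈1 R) ⟩
        s * 1#                            ≈⟨ *-identityʳ s ⟩
        s                                 ∎)

    g̃-homogeneous : ∀ {s} x → conj s ≈ s → g̃ (s * x) ≈ s * g̃ x
    g̃-homogeneous {s} x s-fixed = begin
      frob r (s * x) * (P * (s * x) + P′ * conj (s * x)) * N (s * x) ^ J
        ≈⟨ *-cong (*-cong (frob-* r s x) (+-congˡ (*-congˡ s̄x̄≈))) (^-congˡ J (*-congˡ s̄x̄≈)) ⟩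
      frob r s * frob r x * (P * (s * x) + P′ * (s * conj x)) * ((s * x) * (s * conj x)) ^ J
        ≈⟨ *-congˡ (^-congˡ J (Plain.solve 3 (λ s x y → s P.⊗ x P.⊗ (s P.⊗ y) P.⊜ s P.⊗ s P.⊗ (x P.⊗ y)) refl s x (conj x))) ⟩
      frob r s * frob r x * (P * (s * x) + P′ * (s * conj x)) * (s * s * N x) ^ J
        ≈⟨ *-congˡ (trans (^-distrib-* _ _ J) (*-congʳ (^-distrib-* s s J))) ⟩
      frob r s * frob r x * (P * (s * x) + P′ * (s * conj x)) * (s ^ J * s ^ J * N x ^ J)
        ≈⟨ Plain.solve 9 (λ R X p s x p′ x′ j n → R P.⊗ X P.⊗ (p P.⊗ (s P.⊗ x) P.⊕ p′ P.⊗ (s P.⊗ x′)) P.⊗ (j P.⊗ j P.⊗ n)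
              P.⊜ s P.⊗ (R P.⊗ (j P.⊗ j)) P.⊗ (X P.⊗ (p P.⊗ x P.⊕ p′ P.⊗ x′) P.⊗ n)) refl
              (frob r s) (frob r x) P s x P′ (conj x) (s ^ J) (N x ^ J) ⟩
      s * (s ^ R * (s ^ J * s ^ J)) * g̃ x
        ≈⟨ *-congʳ (s^[1+R+2J]≈s s-fixed) ⟩
      s * g̃ x ∎
      where
      module P = Plain
      s̄x̄≈ : conj (s * x) ≈ s * conj x
      s̄x̄≈ = trans (frob-* k s x) (*-congʳ s-fixed)

    g̃-≉0 : ∀ {x} → ¬ x ≈ 0# → ¬ g̃ x ≈ 0#
    g̃-≉0 x≉0 = *-≉0 (lineInjective⇒≉0 g-inj x≉0) (^-≉0 J (N-≉0 x≉0))

    g̃-0 : ∀ {x} → x ≈ 0# → g̃ x ≈ 0#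
    g̃-0 x≈0 = trans (*-congʳ (trans (*-congʳ (trans (frob-cong r x≈0) (frob-0 r))) (zeroˡ _))) (zeroˡ _)

    -- Injectivity on lines gives y = s x with s in 𝔽_q, and homogeneity of degree one then forces s
    -- = 1.
    g̃-injective : ∀ {x y} → g̃ x ≈ g̃ y → x ≈ y
    g̃-injective {x} {y} g̃x≈g̃y = zero-or-unit x
      (λ x≈0 → zero-or-unit y (λ y≈0 → trans x≈0 (sym y≈0))
        (λ y≉0 → contradiction (trans (sym g̃x≈g̃y) (g̃-0 x≈0)) (g̃-≉0 y≉0)))
      (λ x≉0 → zero-or-unit y
        (λ y≈0 → contradiction (trans g̃x≈g̃y (g̃-0 y≈0)) (g̃-≉0 x≉0))
        (λ y≉0 → nonzero x≉0 y≉0))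
      where
      fixed-N^J : ∀ x → conj (N x ^ J) ≈ N x ^ J
      fixed-N^J x = trans (^-swap (N x) J q) (^-congˡ J (conj-N x))
      gx∧gy≈0 : ¬ x ≈ 0# → ¬ y ≈ 0# → g x ∧ g y ≈ 0#
      gx∧gy≈0 x≉0 y≉0 = x*y≈0⇒y≈0 (*-≉0 (^-≉0 J (N-≉0 x≉0)) (^-≉0 J (N-≉0 y≉0))) (begin
        N x ^ J * N y ^ J * (g x ∧ g y)
          ≈⟨ solve 4 (λ m n g h → m ⊗ n ⊗ (g :∧ h) ⊜ (g ⊗ m) ⊗ (h ⁻ ⊗ n) ⊕ (g ⁻ ⊗ m) ⊗ (h ⊗ n)) refl (N x ^ J) (N y ^ J) (g x) (g y) ⟩
        (g x * N x ^ J) * (conj (g y) * N y ^ J) + (conj (g x) * N x ^ J) * (g y * N y ^ J)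
          ≈⟨ +-cong (*-congˡ (trans (frob-* k _ _) (*-congˡ (fixed-N^J y)))) (*-congʳ (trans (frob-* k _ _) (*-congˡ (fixed-N^J x)))) ⟨
        g̃ x ∧ g̃ y   ≈⟨ ∧-cong g̃x≈g̃y refl ⟩
        g̃ y ∧ g̃ y   ≈⟨ x∧x≈0 (g̃ y) ⟩
        0#          ∎)
      s≈1 : ¬ x ≈ 0# → ∀ {s} → conj s ≈ s → y ≈ s * x → s ≈ 1#
      s≈1 x≉0 {s} s-fixed y≈sx = *-cancelˡ (g̃-≉0 x≉0) (begin
        g̃ x * s         ≈⟨ *-comm _ _ ⟩
        s * g̃ x         ≈⟨ g̃-homogeneous x s-fixed ⟨
        g̃ (s * x)       ≈⟨ g̃-cong y≈sx ⟨
        g̃ y             ≈⟨ g̃x≈g̃y ⟨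
        g̃ x             ≈⟨ *-identityʳ _ ⟨
        g̃ x * 1#        ∎)
      multiple⇒≈ : ¬ x ≈ 0# → (∃ λ s → conj s ≈ s × y ≈ s * x) → x ≈ y
      multiple⇒≈ x≉0 (s , s-fixed , y≈sx) =
        sym (trans y≈sx (trans (*-congʳ (s≈1 x≉0 s-fixed y≈sx)) (*-identityˡ x)))
      nonzero : ¬ x ≈ 0# → ¬ y ≈ 0# → x ≈ y
      nonzero x≉0 y≉0 = multiple⇒≈ x≉0 (dependent⇒multiple x≉0 (g-inj x y (gx∧gy≈0 x≉0 y≉0)))

    coefficient : ℕ → Carrier
    coefficient i = P ^ (q-1 ℕ.∸ i) * P′ ^ i

    -- Each factor `x` that is replaced by its conjugate adds q - 1 to the exponent, so all
    -- exponents are multiples of q - 1.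
    exponent : ∀ i → i ℕ.< q → R ℕ.* q-1 ℕ.+ ((q-1 ℕ.∸ i) ℕ.+ q ℕ.* i) ≡ q-1 ℕ.* (R ℕ.+ 1 ℕ.+ i)
    exponent i i<q = ≡.subst₂ (λ m n → R ℕ.* m ℕ.+ (i′ ℕ.+ n ℕ.* i) ≡ m ℕ.* (R ℕ.+ 1 ℕ.+ i)) i′+i≡ (≡.trans (≡.cong suc i′+i≡) (≡.sym q≡1+[q-1])) (identity R i′ i)
      where
      i′ = q-1 ℕ.∸ i
      i′+i≡ : i′ ℕ.+ i ≡ q-1
      i′+i≡ = ℕₚ.m∸n+n≡m (ℕₚ.≤-pred (≡.subst (i ℕ.<_) q≡1+[q-1] i<q))
      identity : ∀ R m i → R ℕ.* (m ℕ.+ i) ℕ.+ (m ℕ.+ suc (m ℕ.+ i) ℕ.* i) ≡ (m ℕ.+ i) ℕ.* (R ℕ.+ 1 ℕ.+ i)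
      identity = solve-∀

    expand-term : ∀ x i → i ℕ.< q →
      frob r x ^ q-1 * ((P * x) ^ (q-1 ℕ.∸ i) * (P′ * conj x) ^ i) ≈ coefficient i * x ^ (q-1 ℕ.* (R ℕ.+ 1 ℕ.+ i))
    expand-term x i i<q = begin
      frob r x ^ q-1 * ((P * x) ^ i′ * (P′ * conj x) ^ i)
        ≈⟨ *-cong (^-assocʳ x R q-1) (*-cong (^-distrib-* P x i′) (trans (^-distrib-* P′ _ i) (*-congˡ (^-assocʳ x q i)))) ⟩
      x ^ (R ℕ.* q-1) * ((P ^ i′ * x ^ i′) * (P′ ^ i * x ^ (q ℕ.* i)))
        ≈⟨ Plain.solve 5 (λ a b c d e → a P.⊗ (b P.⊗ c P.⊗ (d P.⊗ e)) P.⊜ b P.⊗ d P.⊗ (a P.⊗ (c P.⊗ e))) refl _ _ _ _ _ ⟩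
      coefficient i * (x ^ (R ℕ.* q-1) * (x ^ i′ * x ^ (q ℕ.* i)))
        ≈⟨ *-congˡ (trans (^-homo-* x (R ℕ.* q-1) _) (*-congˡ (^-homo-* x i′ (q ℕ.* i)))) ⟨
      coefficient i * x ^ (R ℕ.* q-1 ℕ.+ (i′ ℕ.+ q ℕ.* i))
        ≡⟨ ≡.cong (λ n → coefficient i * x ^ n) (exponent i i<q) ⟩
      coefficient i * x ^ (q-1 ℕ.* (R ℕ.+ 1 ℕ.+ i)) ∎
      where
      module P = Plain
      i′ = q-1 ℕ.∸ i

    frob^*N^≈frob^ : ∀ x → frob r x ^ q-1 * (N x ^ J) ^ q-1 ≈ frob r x ^ q-1
    frob^*N^≈frob^ x = zero-or-unit x
      (λ x≈0 → trans (*-congʳ (vanish x≈0)) (trans (zeroˡ _) (sym (vanish x≈0))))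
      (λ x≉0 → trans (*-congˡ (trans (^-swap (N x) J q-1) (trans (^-congˡ J (s^q-1≈1 (conj-N x) (N-≉0 x≉0))) (1^m≈1 J)))) (*-identityʳ _))
      where
      vanish : ∀ {x} → x ≈ 0# → frob r x ^ q-1 ≈ 0#
      vanish x≈0 = trans (^-congˡ q-1 (trans (frob-cong r x≈0) (frob-0 r))) (0^m≈0 q-1 {{ℕ.>-nonZero 0<q-1}})

    g̃^[q-1] : ∀ x → g̃ x ^ q-1 ≈ ∑< q (λ i → coefficient i * x ^ (q-1 ℕ.* (R ℕ.+ 1 ℕ.+ i)))
    g̃^[q-1] x = begin
      (frob r x * linear x * N x ^ J) ^ q-1
        ≈⟨ trans (^-distrib-* _ _ q-1) (*-congʳ (^-distrib-* _ _ q-1)) ⟩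
      frob r x ^ q-1 * linear x ^ q-1 * (N x ^ J) ^ q-1
        ≈⟨ Plain.solve 3 (λ a b c → a Plain.⊗ b Plain.⊗ c Plain.⊜ a Plain.⊗ c Plain.⊗ b) refl _ _ _ ⟩
      frob r x ^ q-1 * (N x ^ J) ^ q-1 * linear x ^ q-1
        ≈⟨ *-cong (frob^*N^≈frob^ x) ([x+y]^[2^j-1] k (P * x) (P′ * conj x)) ⟩
      frob r x ^ q-1 * ∑< q (λ i → (P * x) ^ (q-1 ℕ.∸ i) * (P′ * conj x) ^ i)
        ≈⟨ ∑<-*ˡ q _ _ ⟨
      ∑< q (λ i → frob r x ^ q-1 * ((P * x) ^ (q-1 ℕ.∸ i) * (P′ * conj x) ^ i))
        ≈⟨ ∑<-cong q (expand-term x) ⟩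
      ∑< q (λ i → coefficient i * x ^ (q-1 ℕ.* (R ℕ.+ 1 ℕ.+ i))) ∎

    ∑ᶠg̃^[q-1]≈0 : ∑ᶠ (λ x → g̃ x ^ q-1) ≈ 0#
    ∑ᶠg̃^[q-1]≈0 = trans (sym (∑ᶠ-reindex (_^ q-1) g̃ (^-congˡ q-1) g̃-cong g̃-injective))
      (trans (reflexive (≡.cong (λ n → ∑ᶠ (_^ n)) (≡.sym (ℕₚ.*-identityʳ q-1))))
             (∑ᶠ-power-multiple-below 1 (s≤s z≤n) (ℕₚ.≤-trans 2≤q (ℕₚ.m≤m+n q 1))))

    -- The only index whose exponent is q² - 1, that is, with R + 1 + i = q + 1. Summing over the
    -- field isolates its coefficient.
    i₀ : ℕ
    i₀ = q ℕ.∸ R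

    coefficient≈0 : coefficient i₀ ≈ 0#
    coefficient≈0 = begin
      coefficient i₀
        ≈⟨ *-identityʳ _ ⟨
      coefficient i₀ * 1#
        ≈⟨ *-congˡ ∑ᶠ-power≈1 ⟨
      coefficient i₀ * ∑ᶠ (_^ (q-1 ℕ.* (q ℕ.+ 1)))
        ≡⟨ ≡.cong (λ n → coefficient i₀ * ∑ᶠ (_^ (q-1 ℕ.* n))) R+1+i₀≡q+1 ⟨
      coefficient i₀ * ∑ᶠ (_^ (q-1 ℕ.* (R ℕ.+ 1 ℕ.+ i₀)))
        ≈⟨ ∑<-single q i₀ (ℕₚ.∸-monoʳ-< (ℕₚ.m^n>0 2 r) (ℕₚ.<⇒≤ R<q)) others ⟨
      ∑< q (λ i → coefficient i * ∑ᶠ (_^ (q-1 ℕ.* (R ℕ.+ 1 ℕ.+ i))))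
        ≈⟨ ∑<-cong q (λ i _ → ∑ᶠ-*ˡ (coefficient i) (_^ (q-1 ℕ.* (R ℕ.+ 1 ℕ.+ i)))) ⟨
      ∑< q (λ i → ∑ᶠ (λ x → coefficient i * x ^ (q-1 ℕ.* (R ℕ.+ 1 ℕ.+ i))))
        ≈⟨ ∑ᶠ-∑< q (λ i x → coefficient i * x ^ (q-1 ℕ.* (R ℕ.+ 1 ℕ.+ i))) ⟨
      ∑ᶠ (λ x → ∑< q (λ i → coefficient i * x ^ (q-1 ℕ.* (R ℕ.+ 1 ℕ.+ i))))
        ≈⟨ ∑ᶠ-cong g̃^[q-1] ⟨
      ∑ᶠ (λ x → g̃ x ^ q-1)
        ≈⟨ ∑ᶠg̃^[q-1]≈0 ⟩
      0# ∎
      where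
      R+1+i≡ : ∀ i → R ℕ.+ 1 ℕ.+ i ≡ R ℕ.+ i ℕ.+ 1
      R+1+i≡ i = ≡.trans (ℕₚ.+-assoc R 1 i) (≡.trans (≡.cong (R ℕ.+_) (ℕₚ.+-comm 1 i)) (≡.sym (ℕₚ.+-assoc R i 1)))
      R+1+i₀≡q+1 : R ℕ.+ 1 ℕ.+ i₀ ≡ q ℕ.+ 1
      R+1+i₀≡q+1 = ≡.trans (R+1+i≡ i₀) (≡.cong (ℕ._+ 1) (ℕₚ.m+[n∸m]≡n (ℕₚ.<⇒≤ R<q)))
      others : ∀ i → i ℕ.< q → i ≢ i₀ → coefficient i * ∑ᶠ (_^ (q-1 ℕ.* (R ℕ.+ 1 ℕ.+ i))) ≈ 0#
      others i i<q i≢i₀ = trans (*-congˡ (∑ᶠ-power-multiple≈0 (R ℕ.+ 1 ℕ.+ i)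
          (ℕₚ.≤-trans (ℕₚ.m≤n+m 1 R) (ℕₚ.m≤m+n (R ℕ.+ 1) i))
          (ℕₚ.+-mono-< (ℕₚ.+-monoˡ-< 1 R<q) (ℕₚ.<-trans i<q (ℕₚ.m<m+n q (s≤s z≤n))))
          λ eq → i≢i₀ (ℕₚ.+-cancelˡ-≡ (R ℕ.+ 1) _ _ (≡.trans eq (≡.sym R+1+i₀≡q+1))))) (zeroʳ _)

    P*P′≈0 : P * P′ ≈ 0#
    -- For R = 1 the exponent of `P` is zero, and the first alternative says 1 = 0; `x^m≈0⇒x≈0`
    -- holds for that exponent too.
    P*P′≈0 = [ (λ P^≈0  → trans (*-congʳ (x^m≈0⇒x≈0 (q-1 ℕ.∸ i₀) P^≈0)) (zeroˡ _))
             , (λ P′^≈0 → trans (*-congˡ (x^m≈0⇒x≈0 i₀ P′^≈0)) (zeroʳ _)) ]′ (x*y≈0⇒x≈0∨y≈0 coefficient≈0)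

-- The forms Φ

module Forms {c ℓ} (k l : ℕ) .{{_ : NonZero k}} (F : FiniteField c ℓ ((2 ℕ.^ k) ℕ.^ 2)) where
  open QuadraticField k F
  open PowerSums k F
  open Wedge k F
  open SetoidReasoning setoid
  open Solver using (Expr; _⊕_; _⊗_; _⁻; _⊜_; solve)

  -- The theorem has `d = 1#`. A general `d` makes the family closed under the combinations of Φ and
  -- its conjugate in `Recombination`.
  Φ : (d a b c z w : Carrier) → Carrier
  Φ d a b c z w = d * (z * w) + a * (conj z * conj w) + b * (conj z * w) + c * (z * conj w)

  φ : (d a b c w : Carrier) → Carrier
  φ d a b c w = Φ d a b c (frob l w) w

  e U V : (d a b c : Carrier) → Carrier
  e d a b c = N d + N a + N b + N c
  U d a b c = d * conj c + conj a * b
  V d a b c = d * conj b + conj a * c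

  -- With E = e the diagonal of B is, for W = U (respectively W = V), the determinant of
  -- the 𝔽_q-linear map z ↦ Φ z w (respectively w ↦ Φ z w).
  B : (E W x y : Carrier) → Carrier
  B E W x y = E * (x * conj y) + T (W * (x * y))

  β γ : (d a b c w : Carrier) → Carrier
  β d a b c w = B (e d a b c) (U d a b c) w w
  γ d a b c z = B (e d a b c) (V d a b c) z z

  module _ {n : ℕ} where
    :Φ : (d a b c z w : Expr n) → Expr n
    :Φ d a b c z w = d ⊗ (z ⊗ w) ⊕ a ⊗ (z ⁻ ⊗ w ⁻) ⊕ b ⊗ (z ⁻ ⊗ w) ⊕ c ⊗ (z ⊗ w ⁻)

    :e :U :V : (d a b c : Expr n) → Expr n
    :e d a b c = :N d ⊕ :N a ⊕ :N b ⊕ :N c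
    :U d a b c = d ⊗ c ⁻ ⊕ a ⁻ ⊗ b
    :V d a b c = d ⊗ b ⁻ ⊕ a ⁻ ⊗ c

    :B : (E W x y : Expr n) → Expr n
    :B E W x y = E ⊗ (x ⊗ y ⁻) ⊕ :T (W ⊗ (x ⊗ y))

    :β :γ : (d a b c w : Expr n) → Expr n
    :β d a b c w = :B (:e d a b c) (:U d a b c) w w
    :γ d a b c z = :B (:e d a b c) (:V d a b c) z z

  Φ-∧-Φ : ∀ d a b c z w g h → Φ d a b c z w ∧ Φ d a b c g h ≈
    B (e d a b c) (V d a b c) z g * (w ∧ h) + B (e d a b c) (U d a b c) w h * (z ∧ g) + (N d + N a) * (z ∧ g) * (w ∧ h)
  Φ-∧-Φ = solve 8 (λ d a b c z w g h → :Φ d a b c z w :∧ :Φ d a b c g h ⊜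
    :B (:e d a b c) (:V d a b c) z g ⊗ (w :∧ h) ⊕ :B (:e d a b c) (:U d a b c) w h ⊗ (z :∧ g)
      ⊕ (:N d ⊕ :N a) ⊗ (z :∧ g) ⊗ (w :∧ h)) refl

  -- This relation links β and γ: for `e = 0` it ties together the eigenvalues belonging to `U` and
  -- `V`, and for a matched form it becomes an Artin-Schreier relation for t.
  NU+NV : ∀ d a b c → N (U d a b c) + N (V d a b c) ≈ (N d + N a) * (N b + N c)
  NU+NV = solve 4 (λ d a b c → :N (:U d a b c) ⊕ :N (:V d a b c) ⊜ (:N d ⊕ :N a) ⊗ (:N b ⊕ :N c)) refl

  conj-e : ∀ d a b c → conj (e d a b c) ≈ e d a b c
  conj-e = solve 4 (λ d a b c → (:e d a b c) ⁻ ⊜ :e d a b c) refl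

  -- An element of 𝔽_q is put in the form T p, so that the solver knows it is fixed by conj.
  fixed⇒T : ∀ {x} → conj x ≈ x → ∃ λ p → x ≈ T p
  fixed⇒T {x} x-fixed with trace-one-over-𝔽q
  ... | ρ , ρ̄≈ρ+1 = ρ * x , sym (begin
    ρ * x + conj (ρ * x)        ≈⟨ +-congˡ (trans (frob-* k ρ x) (*-cong ρ̄≈ρ+1 x-fixed)) ⟩
    ρ * x + (ρ + 1#) * x        ≈⟨ Plain.solve 2 (λ ρ x → ρ P.⊗ x P.⊕ (ρ P.⊕ P.:1) P.⊗ x P.⊜ x) refl ρ x ⟩
    x                           ∎)
    where module P = Plain

  fixed-⁻¹ : ∀ {x} → conj x ≈ x → (x≉0 : ¬ x ≈ 0#) → conj (x ⁻¹⟨ x≉0 ⟩) ≈ x ⁻¹⟨ x≉0 ⟩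
  fixed-⁻¹ {x} x-fixed x≉0 = *-cancelˡ x≉0 (begin
    x * conj x⁻¹        ≈⟨ *-congʳ x-fixed ⟨
    conj x * conj x⁻¹   ≈⟨ frob-* k x x⁻¹ ⟨
    conj (x * x⁻¹)      ≈⟨ conj-cong (inverseʳ x≉0) ⟩
    conj 1#             ≈⟨ frob-1 k ⟩
    1#                  ≈⟨ inverseʳ x≉0 ⟨
    x * x⁻¹             ∎)
    where x⁻¹ = x ⁻¹⟨ x≉0 ⟩

  fixed-* : ∀ {x y} → conj x ≈ x → conj y ≈ y → conj (x * y) ≈ x * y
  fixed-* x-fixed y-fixed = trans (frob-* k _ _) (*-cong x-fixed y-fixed)

  fixed-+ : ∀ {x y} → conj x ≈ x → conj y ≈ y → conj (x + y) ≈ x + y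
  fixed-+ x-fixed y-fixed = trans (frob-+ k _ _) (+-cong x-fixed y-fixed)

  frob-surjective : ∀ j t → ∃ λ x → frob j x ≈ t
  frob-surjective j = field-injective⇒surjective (frob-cong j) (frob-injective j)

  Φ-cong : ∀ d a b c {z z′ w w′} → z ≈ z′ → w ≈ w′ → Φ d a b c z w ≈ Φ d a b c z′ w′
  Φ-cong d a b c z≈ w≈ = +-cong (+-cong (+-cong (*-congˡ (*-cong z≈ w≈)) (*-congˡ (*-cong (conj-cong z≈) (conj-cong w≈))))
    (*-congˡ (*-cong (conj-cong z≈) w≈))) (*-congˡ (*-cong z≈ (conj-cong w≈)))

  -- The shear keeps both wedges in `Φ-∧-Φ`, and each `B` there is 𝔽_q-linear in its second
  -- argument, so adding a multiple of the first argument contributes that multiple of a diagonal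
  -- value.
  φ-shear : ∀ d a b c w h {x} → conj x ≈ x →
    φ d a b c w ∧ φ d a b c (x * w + h) ≈
      γ d a b c (frob l w) * (w ∧ h) * frob l x + β d a b c w * frob l (w ∧ h) * x + φ d a b c w ∧ φ d a b c h
  φ-shear d a b c w h {x} x-fixed = by-T (fixed⇒T x-fixed)
    where
    z = frob l w
    g = frob l h
    by-T : (∃ λ p → x ≈ T p) → φ d a b c w ∧ φ d a b c (x * w + h) ≈
      γ d a b c (frob l w) * (w ∧ h) * frob l x + β d a b c w * frob l (w ∧ h) * x + φ d a b c w ∧ φ d a b c h
    by-T (p , x≈Tp) = begin
      φ d a b c w ∧ φ d a b c (x * w + h)
        ≈⟨ ∧-cong refl (Φ-cong d a b c (trans (frob-+ l _ h) (+-congʳ (trans (frob-* l x w) (*-congʳ frobx≈)))) (+-congʳ (*-congʳ x≈Tp))) ⟩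
      Φ d a b c z w ∧ Φ d a b c (T (frob l p) * z + g) (T p * w + h)
        ≈⟨ solve 10 (λ d a b c z w g h p p′ →
             :Φ d a b c z w :∧ :Φ d a b c (:T p′ ⊗ z ⊕ g) (:T p ⊗ w ⊕ h) ⊜
             :γ d a b c z ⊗ (w :∧ h) ⊗ :T p′ ⊕ :β d a b c w ⊗ (z :∧ g) ⊗ :T p ⊕ (:Φ d a b c z w :∧ :Φ d a b c g h))
             refl d a b c z w g h p (frob l p) ⟩
      γ d a b c z * (w ∧ h) * T (frob l p) + β d a b c w * (z ∧ g) * T p + φ d a b c w ∧ φ d a b c h
        ≈⟨ +-congʳ (+-cong (*-congˡ frobx≈) (*-cong (*-congˡ (frob-∧ l w h)) x≈Tp)) ⟨
      γ d a b c z * (w ∧ h) * frob l x + β d a b c w * frob l (w ∧ h) * x + φ d a b c w ∧ φ d a b c h ∎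
      where
      frobx≈ : frob l x ≈ T (frob l p)
      frobx≈ = trans (frob-cong l x≈Tp) (frob-T l p)

  x∧y-shear : ∀ w h {x} → conj x ≈ x → w ∧ (x * w + h) ≈ w ∧ h
  x∧y-shear w h {x} x-fixed = begin
    w * conj (x * w + h) + conj w * (x * w + h)
      ≈⟨ +-congʳ (*-congˡ (trans (frob-+ k _ _) (+-congʳ (trans (frob-* k x w) (*-congʳ x-fixed))))) ⟩
    w * (x * conj w + conj h) + conj w * (x * w + h)
      ≈⟨ Plain.solve 5 (λ w w′ h h′ x → w P.⊗ (x P.⊗ w′ P.⊕ h′) P.⊕ w′ P.⊗ (x P.⊗ w P.⊕ h) P.⊜ w P.⊗ h′ P.⊕ w′ P.⊗ h) refl w (conj w) h (conj h) x ⟩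
    w ∧ h ∎
    where module P = Plain

  conj-β : ∀ d a b c w → conj (β d a b c w) ≈ β d a b c w
  conj-β = solve 5 (λ d a b c w → (:β d a b c w) ⁻ ⊜ :β d a b c w) refl

  conj-γ : ∀ d a b c w → conj (γ d a b c w) ≈ γ d a b c w
  conj-γ = solve 5 (λ d a b c w → (:γ d a b c w) ⁻ ⊜ :γ d a b c w) refl

  -- If β vanishes at w but γ does not, then the additive polynomial in x of φ-shear is a
  -- multiple of its leading term, hence has a root.
  β≈0⇒γ≈0 : ∀ d a b c → LineInjective (φ d a b c) → ∀ {w} → ¬ w ≈ 0# → β d a b c w ≈ 0# → γ d a b c (frob l w) ≈ 0#
  β≈0⇒γ≈0 d a b c φ-inj {w} w≉0 β≈0 = zero-or-unit (γ d a b c (frob l w)) id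
    λ γ≉0 → contradiction-at γ≉0 (independent w≉0)
    where
    γw = γ d a b c (frob l w)
    contradiction-at : ¬ γw ≈ 0# → (∃ λ h → ¬ w ∧ h ≈ 0#) → γw ≈ 0#
    contradiction-at γ≉0 (h , σ≉0) = by-root (frob-surjective l t)
      where
      σ = w ∧ h
      A = φ d a b c w ∧ φ d a b c h
      γσ≉0 : ¬ γw * σ ≈ 0#
      γσ≉0 = *-≉0 γ≉0 σ≉0
      t = (γw * σ) ⁻¹⟨ γσ≉0 ⟩ * A
      t-fixed : conj t ≈ t
      t-fixed = fixed-* (fixed-⁻¹ (fixed-* (conj-γ d a b c (frob l w)) (conj-∧ w h)) γσ≉0) (conj-∧ _ _)
      by-root : (∃ λ x → frob l x ≈ t) → γw ≈ 0#
      by-root (x , x^Q≈t) = contradiction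
        (trans (sym (x∧y-shear w h x-fixed)) (φ-inj w (x * w + h) collision)) σ≉0
        where
        x-fixed : conj x ≈ x
        x-fixed = frob-injective l (trans (frob-conj l x) (trans (conj-cong x^Q≈t) (trans t-fixed (sym x^Q≈t))))
        collision : φ d a b c w ∧ φ d a b c (x * w + h) ≈ 0#
        collision = begin
          φ d a b c w ∧ φ d a b c (x * w + h)
            ≈⟨ φ-shear d a b c w h x-fixed ⟩
          γw * σ * frob l x + β d a b c w * frob l σ * x + A
            ≈⟨ +-congʳ (+-cong (*-congˡ x^Q≈t) (trans (*-congʳ (trans (*-congʳ β≈0) (zeroˡ _))) (zeroˡ x))) ⟩
          γw * σ * t + 0# + A
            ≈⟨ +-congʳ (trans (+-identityʳ _) (trans (sym (*-assoc _ _ _)) (trans (*-congʳ (inverseʳ γσ≉0)) (*-identityˡ A)))) ⟩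
          A + A
            ≈⟨ x+x≈0 A ⟩
          0# ∎

-- Vanishing e, and the matching condition for isotropic β

module Necessity {c ℓ} (k l : ℕ) .{{_ : NonZero k}} (F : FiniteField c ℓ ((2 ℕ.^ k) ℕ.^ 2)) where
  open QuadraticField k F
  open PowerSums k F
  open Wedge k F
  open Forms k l F
  open SetoidReasoning setoid
  open Solver using (#_; _⊕_; _⊗_; _⁻; _⊜_; solve)
  private module P = Plain

  fixed⇐T≈0 : ∀ {x} → T x ≈ 0# → conj x ≈ x
  fixed⇐T≈0 Tx≈0 = sym (x+y≈0⇒x≈y Tx≈0)

  square-root : ∀ x → ∃ λ y → y * y ≈ x
  square-root x = root (frob-surjective 1 x)
    where
    root : (∃ λ y → frob 1 y ≈ x) → ∃ λ y → y * y ≈ x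
    root (y , y²≈x) = y , trans (*-congˡ (sym (*-identityʳ y))) y²≈x

  x*x≈0⇒x≈0 : ∀ {x} → x * x ≈ 0# → x ≈ 0#
  x*x≈0⇒x≈0 xx≈0 = [ id , id ]′ (x*y≈0⇒x≈0∨y≈0 xx≈0)

  x*x≈y*y⇒x≈y : ∀ {x y} → x * x ≈ y * y → x ≈ y
  x*x≈y*y⇒x≈y {x} {y} eq = x+y≈0⇒x≈y (x*x≈0⇒x≈0 (trans
    (P.solve 2 (λ x y → (x P.⊕ y) P.⊗ (x P.⊕ y) P.⊜ x P.⊗ x P.⊕ y P.⊗ y) refl x y) (x≈y⇒x+y≈0 eq)))

  -- For `E = 0` such a vector makes `B E W w y` a multiple of `w ∧ y`. If w² is the conjugate of
  -- `W`, then W w = w̄² w = N w · w̄.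
  semilinear-eigenvector : ∀ W → ∃ λ w → ¬ w ≈ 0# × ∃ λ κ → conj κ ≈ κ × W * w ≈ κ * conj w
  semilinear-eigenvector W = zero-or-unit W
    (λ W≈0 → 1# , (λ 1≈0 → 0≉1 (sym 1≈0)) , 0# , frob-0 k , trans (*-congʳ W≈0) (trans (zeroˡ _) (sym (zeroˡ _))))
    (λ W≉0 → unit W≉0 (square-root (conj W)))
    where
    unit : ¬ W ≈ 0# → (∃ λ w → w * w ≈ conj W) → ∃ λ w → ¬ w ≈ 0# × ∃ λ κ → conj κ ≈ κ × W * w ≈ κ * conj w
    unit W≉0 (w , w²≈W̄) = w , (λ w≈0 → conj-≉0 W≉0 (trans (sym w²≈W̄) (trans (*-congʳ w≈0) (zeroˡ w))))
      , N w , conj-N w , (begin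
        W * w                        ≈⟨ *-congʳ (conj-involutive W) ⟨
        conj (conj W) * w            ≈⟨ *-congʳ (conj-cong w²≈W̄) ⟨
        conj (w * w) * w             ≈⟨ solve 1 (λ w → (w ⊗ w) ⁻ ⊗ w ⊜ :N w ⊗ w ⁻) refl w ⟩
        N w * conj w                 ∎)

  B-0-eigenvector : ∀ {E W x κ} y → E ≈ 0# → conj κ ≈ κ → W * x ≈ κ * conj x → B E W x y ≈ κ * (x ∧ y)
  B-0-eigenvector {E} {W} {x} {κ} y E≈0 κ-fixed Wx≈ = begin
    E * (x * conj y) + T (W * (x * y))             ≈⟨ +-cong (trans (*-congʳ E≈0) (zeroˡ _)) (+-cong W[xy]≈ (conj-cong W[xy]≈)) ⟩
    0# + (κ * (conj x * y) + conj (κ * (conj x * y)))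
                                                   ≈⟨ trans (+-identityˡ _) (+-congˡ (trans (frob-* k _ _) (*-congʳ κ-fixed))) ⟩
    κ * (conj x * y) + κ * conj (conj x * y)       ≈⟨ solve 3 (λ κ x y → κ ⊗ (x ⁻ ⊗ y) ⊕ κ ⊗ (x ⁻ ⊗ y) ⁻ ⊜ κ ⊗ (x :∧ y)) refl κ x y ⟩
    κ * (x ∧ y)                                    ∎
    where
    W[xy]≈ : W * (x * y) ≈ κ * (conj x * y)
    W[xy]≈ = trans (sym (*-assoc _ _ _)) (trans (*-congʳ Wx≈) (*-assoc _ _ _))

  eigenvalue²≈N : ∀ {W x κ} → ¬ x ≈ 0# → conj κ ≈ κ → W * x ≈ κ * conj x → κ * κ ≈ N W
  eigenvalue²≈N {W} {x} {κ} x≉0 κ-fixed Wx≈ = *-cancelˡ (N-≉0 x≉0) (begin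
    N x * (κ * κ)                    ≈⟨ *-congˡ (*-congˡ κ-fixed) ⟨
    N x * N κ                        ≈⟨ solve 2 (λ x κ → :N x ⊗ :N κ ⊜ :N (κ ⊗ x ⁻)) refl x κ ⟩
    N (κ * conj x)                   ≈⟨ *-cong Wx≈ (conj-cong Wx≈) ⟨
    N (W * x)                        ≈⟨ solve 2 (λ x W → :N (W ⊗ x) ⊜ :N x ⊗ :N W) refl x W ⟩
    N x * N W                        ∎)

  -- The hypothesis puts W x² into 𝔽_q, and its quotient by `N x` is the eigenvalue. For `e = 0`
  -- this turns a zero of γ into an eigenvector of `V`.
  T≈0⇒eigenvector : ∀ {W x} → ¬ x ≈ 0# → T (W * (x * x)) ≈ 0# → ∃ λ κ → conj κ ≈ κ × W * x ≈ κ * conj x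
  T≈0⇒eigenvector {W} {x} x≉0 T≈0 = κ , fixed-* (fixed⇐T≈0 T≈0) (fixed-⁻¹ (conj-N x) (N-≉0 x≉0)) , *-cancelˡ x≉0 (begin
    x * (W * x)                      ≈⟨ P.solve 2 (λ x W → x P.⊗ (W P.⊗ x) P.⊜ W P.⊗ (x P.⊗ x)) refl x W ⟩
    W * (x * x)                      ≈⟨ *-identityʳ _ ⟨
    W * (x * x) * 1#                 ≈⟨ *-congˡ (inverseˡ (N-≉0 x≉0)) ⟨
    W * (x * x) * (N⁻¹ * N x)        ≈⟨ P.solve 4 (λ A i x y → A P.⊗ (i P.⊗ (x P.⊗ y)) P.⊜ x P.⊗ (A P.⊗ i P.⊗ y)) refl (W * (x * x)) N⁻¹ x (conj x) ⟩
    x * (κ * conj x)                 ∎)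
    where
    N⁻¹ = N x ⁻¹⟨ N-≉0 x≉0 ⟩
    κ = W * (x * x) * N⁻¹

  -- When e = 0, the eigenvectors of U and V make φ w ∧ φ h vanish for one w and all h.
  e≉0 : ∀ d a b c → LineInjective (φ d a b c) → ¬ e d a b c ≈ 0#
  e≉0 d a b c φ-inj e≈0 = at (semilinear-eigenvector (U d a b c))
    where
    at : ¬ (∃ λ w → ¬ w ≈ 0# × ∃ λ κ → conj κ ≈ κ × U d a b c * w ≈ κ * conj w)
    at (w , w≉0 , κ , κ-fixed , Uw≈) = at′ (T≈0⇒eigenvector z≉0 (trans (sym γ≈T) (β≈0⇒γ≈0 d a b c φ-inj w≉0 β≈0)))
      where
      z = frob l w
      z≉0 : ¬ z ≈ 0#
      z≉0 = w≉0 ∘ frob≈0 l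
      β≈0 : β d a b c w ≈ 0#
      β≈0 = trans (B-0-eigenvector w e≈0 κ-fixed Uw≈) (trans (*-congˡ (x∧x≈0 w)) (zeroʳ κ))
      γ≈T : γ d a b c z ≈ T (V d a b c * (z * z))
      γ≈T = trans (+-congʳ (trans (*-congʳ e≈0) (zeroˡ _))) (+-identityˡ _)
      at′ : ¬ (∃ λ κ′ → conj κ′ ≈ κ′ × V d a b c * z ≈ κ′ * conj z)
      at′ (κ′ , κ′-fixed , Vz≈) = proj₂ (independent w≉0) (φ-inj w h (begin
        φ d a b c w ∧ φ d a b c h
          ≈⟨ Φ-∧-Φ d a b c z w g h ⟩
        B (e d a b c) (V d a b c) z g * (w ∧ h) + B (e d a b c) (U d a b c) w h * (z ∧ g) + (N d + N a) * (z ∧ g) * (w ∧ h)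
          ≈⟨ +-congʳ (+-cong (*-congʳ (B-0-eigenvector g e≈0 κ′-fixed Vz≈)) (*-congʳ (B-0-eigenvector h e≈0 κ-fixed Uw≈))) ⟩
        κ′ * (z ∧ g) * (w ∧ h) + κ * (w ∧ h) * (z ∧ g) + (N d + N a) * (z ∧ g) * (w ∧ h)
          ≈⟨ P.solve 5 (λ κ′ κ n σ τ → κ′ P.⊗ τ P.⊗ σ P.⊕ κ P.⊗ σ P.⊗ τ P.⊕ n P.⊗ τ P.⊗ σ P.⊜ (κ P.⊕ κ′ P.⊕ n) P.⊗ (σ P.⊗ τ)) refl κ′ κ (N d + N a) (w ∧ h) (z ∧ g) ⟩
        (κ + κ′ + (N d + N a)) * ((w ∧ h) * (z ∧ g))
          ≈⟨ *-congʳ (x≈y⇒x+y≈0 κ+κ′≈) ⟩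
        0# * ((w ∧ h) * (z ∧ g))
          ≈⟨ zeroˡ _ ⟩
        0# ∎))
        where
        h = proj₁ (independent w≉0)
        g = frob l h
        -- Squaring is injective, and `e = 0` makes the two factors on the right of `NU+NV` equal.
        κ+κ′≈ : κ + κ′ ≈ N d + N a
        κ+κ′≈ = x*x≈y*y⇒x≈y (begin
          (κ + κ′) * (κ + κ′)                 ≈⟨ P.solve 2 (λ x y → (x P.⊕ y) P.⊗ (x P.⊕ y) P.⊜ x P.⊗ x P.⊕ y P.⊗ y) refl κ κ′ ⟩
          κ * κ + κ′ * κ′                     ≈⟨ +-cong (eigenvalue²≈N w≉0 κ-fixed Uw≈) (eigenvalue²≈N z≉0 κ′-fixed Vz≈) ⟩
          N (U d a b c) + N (V d a b c)       ≈⟨ NU+NV d a b c ⟩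
          (N d + N a) * (N b + N c)           ≈⟨ *-congˡ (x+y≈0⇒x≈y (trans (P.solve 4 (λ d a b c → b P.⊕ c P.⊕ (d P.⊕ a) P.⊜ d P.⊕ a P.⊕ b P.⊕ c) refl (N d) (N a) (N b) (N c)) e≈0)) ⟩
          (N d + N a) * (N d + N a)           ∎)

  -- Condition (2) of the corollary, multiplied by e.
  Matched : (d a b c : Carrier) → Set _
  Matched d a b c = e d a b c * frob l (U d a b c) ≈ frob l (e d a b c) * V d a b c

  frob-β : ∀ d a b c w → frob l (β d a b c w) ≈ B (frob l (e d a b c)) (frob l (U d a b c)) (frob l w) (frob l w)
  frob-β d a b c w = frob-⟦⟧ l (:B (# zero) (# suc zero) (# suc (suc zero)) (# suc (suc zero))) (e d a b c ∷ U d a b c ∷ w ∷ [])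

  -- At a zero of β both β^Q and γ vanish, and the combination that eliminates their norm terms is
  -- T(D z²), where D = 0 is the claim. One zero leaves D undetermined up to a factor in 𝔽_q; a
  -- second zero on another line forces D = 0.
  isotropic⇒matched : ∀ d a b c → LineInjective (φ d a b c) → ∀ {w} → ¬ w ≈ 0# → β d a b c w ≈ 0# → Matched d a b c
  isotropic⇒matched d a b c φ-inj {w} w≉0 β≈0 = second (independent w≉0)
    where
    E = e d a b c
    E′ = frob l E
    U′ = frob l (U d a b c)
    E≉0 : ¬ E ≈ 0#
    E≉0 = e≉0 d a b c φ-inj
    D = E * U′ + E′ * V d a b c
    T[Dzz]≈0 : ∀ {w} → ¬ w ≈ 0# → β d a b c w ≈ 0# → T (D * (frob l w * frob l w)) ≈ 0#
    T[Dzz]≈0 {w} w≉0 β≈0 = begin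
      D * (z * z) + conj (D * (z * z))
        ≈⟨ +-congˡ (trans (frob-* k _ _) (*-congʳ (trans (frob-+ k _ _) (+-cong (trans (frob-* k _ _) (*-congʳ (conj-e d a b c)))
             (trans (frob-* k _ _) (*-congʳ (frob-fixes l (conj-e d a b c)))))))) ⟩
      D * (z * z) + (E * conj U′ + E′ * conj (V d a b c)) * conj (z * z)
        ≈⟨ solve 5 (λ E E′ U V z → (E ⊗ U ⊕ E′ ⊗ V) ⊗ (z ⊗ z) ⊕ (E ⊗ U ⁻ ⊕ E′ ⊗ V ⁻) ⊗ (z ⊗ z) ⁻ ⊜ E ⊗ :B E′ U z z ⊕ E′ ⊗ :B E V z z)
             refl E E′ U′ (V d a b c) z ⟩
      E * B E′ U′ z z + E′ * γ d a b c z
        ≈⟨ +-cong (*-congˡ (trans (sym (frob-β d a b c w)) (trans (frob-cong l β≈0) (frob-0 l)))) (*-congˡ (β≈0⇒γ≈0 d a b c φ-inj w≉0 β≈0)) ⟩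
      E * 0# + E′ * 0#
        ≈⟨ trans (+-cong (zeroʳ _) (zeroʳ _)) (+-identityˡ 0#) ⟩
      0# ∎
      where z = frob l w
    second : (∃ λ h → ¬ w ∧ h ≈ 0#) → Matched d a b c
    second (h , σ≉0) = x+y≈0⇒x≈y (x*y≈0⇒y≈0 (*-≉0 τ≉0 τ≉0) (begin
      (z ∧ z′) * (z ∧ z′) * D
        ≈⟨ solve 3 (λ z z′ D → (z :∧ z′) ⊗ (z :∧ z′) ⊗ D ⊜ :T (D ⊗ (z ⊗ z)) ⊗ (z′ ⊗ z′) ⁻ ⊕ :T (D ⊗ (z′ ⊗ z′)) ⊗ (z ⊗ z) ⁻) refl z z′ D ⟩
      T (D * (z * z)) * conj (z′ * z′) + T (D * (z′ * z′)) * conj (z * z)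
        ≈⟨ +-cong (*-congʳ (T[Dzz]≈0 w≉0 β≈0)) (*-congʳ (T[Dzz]≈0 w′≉0 β′≈0)) ⟩
      0# * conj (z′ * z′) + 0# * conj (z * z)
        ≈⟨ trans (+-cong (zeroˡ _) (zeroˡ _)) (+-identityˡ 0#) ⟩
      0# ∎))
      where
      σ = w ∧ h
      -- As β(w) = 0, β(x w + h) = β(h) + E σ x is linear in x, and this is its root.
      x = (E * σ) ⁻¹⟨ *-≉0 E≉0 σ≉0 ⟩ * β d a b c h
      x-fixed : conj x ≈ x
      x-fixed = fixed-* (fixed-⁻¹ (fixed-* (conj-e d a b c) (conj-∧ w h)) (*-≉0 E≉0 σ≉0)) (conj-β d a b c h)
      w′ = x * w + h
      z = frob l w
      z′ = frob l w′
      w∧w′≉0 : ¬ w ∧ w′ ≈ 0#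
      w∧w′≉0 eq = σ≉0 (trans (sym (x∧y-shear w h x-fixed)) eq)
      w′≉0 : ¬ w′ ≈ 0#
      w′≉0 w′≈0 = w∧w′≉0 (trans (∧-comm w w′) (0∧x≈0 w′≈0))
      τ≉0 : ¬ z ∧ z′ ≈ 0#
      τ≉0 τ≈0 = w∧w′≉0 (frob≈0 l (trans (frob-∧ l w w′) τ≈0))
      β′≈0 : β d a b c w′ ≈ 0#
      β′≈0 = by-T (fixed⇒T x-fixed)
        where
        by-T : (∃ λ p → x ≈ T p) → β d a b c w′ ≈ 0#
        by-T (p , x≈Tp) = begin
          β d a b c (x * w + h)
            ≈⟨ B-cong (+-congʳ (*-congʳ x≈Tp)) ⟩
          β d a b c (T p * w + h)
            ≈⟨ solve 7 (λ d a b c w h p → :β d a b c (:T p ⊗ w ⊕ h) ⊜ :β d a b c h ⊕ :T p ⊗ :T p ⊗ :β d a b c w ⊕ :e d a b c ⊗ (w :∧ h) ⊗ :T p) refl d a b c w h p ⟩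
          β d a b c h + T p * T p * β d a b c w + E * σ * T p
            ≈⟨ +-cong (trans (+-congˡ (trans (*-congˡ β≈0) (zeroʳ _))) (+-identityʳ _)) (*-congˡ (sym x≈Tp)) ⟩
          β d a b c h + E * σ * x
            ≈⟨ +-congˡ (trans (sym (*-assoc _ _ _)) (trans (*-congʳ (inverseʳ (*-≉0 E≉0 σ≉0))) (*-identityˡ _))) ⟩
          β d a b c h + β d a b c h
            ≈⟨ x+x≈0 _ ⟩
          0# ∎
          where
          B-cong : ∀ {w w′} → w ≈ w′ → β d a b c w ≈ β d a b c w′
          B-cong eq = +-cong (*-congˡ (*-cong eq (conj-cong eq))) (+-cong (*-congˡ (*-cong eq eq)) (conj-cong (*-congˡ (*-cong eq eq))))

-- The matching condition in general

module Matching {c ℓ} (k l : ℕ) .{{_ : NonZero k}} (F : FiniteField c ℓ ((2 ℕ.^ k) ℕ.^ 2)) where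
  open QuadraticField k F
  open PowerSums k F
  open AdditiveHilbert90 k F
  open Wedge k F
  open Forms k l F
  open Necessity k l F
  open SetoidReasoning setoid
  open Solver using (#_; :0; :1; _⊕_; _⊗_; _⁻; _⊜_; solve)
  private module P = Plain

  complement-mod-k : ∃ λ r → r ℕ.< k × ∃ λ j → r ℕ.+ l ≡ j ℕ.* k
  complement-mod-k = by (l DivMod.% k) (DivMod.m≡m%n+[m/n]*n l k) (DivMod.m%n<n l k)
    where
    by : ∀ s → l ≡ s ℕ.+ l DivMod./ k ℕ.* k → s ℕ.< k → ∃ λ r → r ℕ.< k × ∃ λ j → r ℕ.+ l ≡ j ℕ.* k
    by zero    l≡ _   = 0 , ℕ.>-nonZero⁻¹ k , l DivMod./ k , l≡
    by (suc s) l≡ s<k = k ℕ.∸ suc s , ℕₚ.∸-monoʳ-< (s≤s z≤n) (ℕₚ.<⇒≤ s<k) , suc (l DivMod./ k) ,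
      ≡.trans (≡.cong (k ℕ.∸ suc s ℕ.+_) l≡) (≡.trans (≡.sym (ℕₚ.+-assoc (k ℕ.∸ suc s) (suc s) _))
        (≡.cong (ℕ._+ l DivMod./ k ℕ.* k) (ℕₚ.m∸n+n≡m (ℕₚ.<⇒≤ s<k))))

  frob-jk : ∀ j → (∀ x → frob (j ℕ.* k) x ≈ x) ⊎ (∀ x → frob (j ℕ.* k) x ≈ conj x)
  frob-jk zero    = inj₁ *-identityʳ
  frob-jk (suc j) = step (frob-jk j)
    where
    step : (∀ x → frob (j ℕ.* k) x ≈ x) ⊎ (∀ x → frob (j ℕ.* k) x ≈ conj x) →
           (∀ x → frob (suc j ℕ.* k) x ≈ x) ⊎ (∀ x → frob (suc j ℕ.* k) x ≈ conj x)
    step (inj₁ id′)   = inj₂ λ x → trans (sym (frob-∘ k (j ℕ.* k) x)) (id′ (conj x))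
    step (inj₂ conj′) = inj₁ λ x → trans (sym (frob-∘ k (j ℕ.* k) x)) (trans (conj′ (conj x)) (conj-involutive x))

  LineInjective-resp : ∀ {g h} → (∀ x → g x ≈ h x) → LineInjective g → LineInjective h
  LineInjective-resp g≈h g-inj x y hx∧hy≈0 = g-inj x y (trans (∧-cong (g≈h x) (g≈h y)) hx∧hy≈0)

  LineInjective-frob : ∀ {g} j → LineInjective g → LineInjective (g ∘ frob j)
  LineInjective-frob j g-inj x y eq = frob≈0 j (trans (frob-∧ j x y) (g-inj _ _ eq))

  -- Up to conj, the substitution w = x^(2^r) turns w^(2^l) into x, so that r < k suffices in Hermite.
  diagonal⇒P*P′≈0 : ∀ A A′ → LineInjective (λ x → x * (A * frob l x + A′ * conj (frob l x))) → A * A′ ≈ 0#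
  diagonal⇒P*P′≈0 A A′ χ-inj = by complement-mod-k
    where
    χ : Carrier → Carrier
    χ x = x * (A * frob l x + A′ * conj (frob l x))
    by : (∃ λ r → r ℕ.< k × ∃ λ j → r ℕ.+ l ≡ j ℕ.* k) → A * A′ ≈ 0#
    by (r , r<k , j , r+l≡jk) = [ straight , twisted ]′ (frob-jk j)
      where
      frob-r+l : ∀ x → frob l (frob r x) ≈ frob (j ℕ.* k) x
      frob-r+l x = trans (frob-∘ r l x) (reflexive (≡.cong (λ n → frob n x) r+l≡jk))
      straight : (∀ x → frob (j ℕ.* k) x ≈ x) → A * A′ ≈ 0#
      straight id′ = Hermite.P*P′≈0 r r<k A A′
        (LineInjective-resp (λ x → *-congˡ (+-cong (*-congˡ (eq x)) (*-congˡ (conj-cong (eq x))))) (LineInjective-frob {χ} r χ-inj))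
        where
        eq : ∀ x → frob l (frob r x) ≈ x
        eq x = trans (frob-r+l x) (id′ x)
      twisted : (∀ x → frob (j ℕ.* k) x ≈ conj x) → A * A′ ≈ 0#
      twisted conj′ = trans (*-comm A A′) (Hermite.P*P′≈0 r r<k A′ A
        (LineInjective-resp (λ x → *-congˡ (trans (+-comm _ _)
            (+-cong (*-congˡ (trans (conj-cong (eq x)) (conj-involutive x))) (*-congˡ (eq x))))) (LineInjective-frob {χ} r χ-inj)))
        where
        eq : ∀ x → frob l (frob r x) ≈ conj x
        eq x = trans (frob-r+l x) (conj′ x)

  N-cong : ∀ {x y} → x ≈ y → N x ≈ N y
  N-cong eq = *-cong eq (conj-cong eq)

  -- The form w ↦ (frob l w + b · conj (frob l w)) (w + c · conj w), diagonalised by w = x + c · conj x.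
  singular-monic : ∀ b c → LineInjective (φ 1# (b * c) b c) → ¬ e 1# (b * c) b c ≈ 0# → Matched 1# (b * c) b c
  singular-monic b c φ-inj e≉0 = [ P≈0 , P′≈0 ]′ (x*y≈0⇒x≈0∨y≈0 (diagonal⇒P*P′≈0 A A′ χ-inj))
    where
    c′ = frob l c
    b′ = frob l b
    A A′ nc : Carrier
    A  = 1# + b * conj c′
    A′ = c′ + b
    nc = 1# + N c
    e≈ : e 1# (b * c) b c ≈ (1# + N b) * nc
    e≈ = solve 2 (λ b c → :e :1 (b ⊗ c) b c ⊜ (:1 ⊕ :N b) ⊗ (:1 ⊕ :N c)) refl b c
    nc≉0 : ¬ nc ≈ 0#
    nc≉0 nc≈0 = e≉0 (trans e≈ (trans (*-congˡ nc≈0) (zeroʳ _)))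
    χ lin : Carrier → Carrier
    χ x = x * (A * frob l x + A′ * conj (frob l x))
    lin x = x + c * conj x
    frob-lin : ∀ x → frob l (lin x) ≈ frob l x + c′ * conj (frob l x)
    frob-lin x = frob-⟦⟧ l (# zero ⊕ # suc zero ⊗ (# zero) ⁻) (x ∷ c ∷ [])
    φ∘lin : ∀ x → φ 1# (b * c) b c (lin x) ≈ nc * χ x
    φ∘lin x = trans (Φ-cong 1# (b * c) b c (frob-lin x) refl)
      (solve 5 (λ b c c′ x z → :Φ :1 (b ⊗ c) b c (z ⊕ c′ ⊗ z ⁻) (x ⊕ c ⊗ x ⁻) ⊜
        (:1 ⊕ :N c) ⊗ (x ⊗ ((:1 ⊕ b ⊗ c′ ⁻) ⊗ z ⊕ (c′ ⊕ b) ⊗ z ⁻))) refl b c c′ x (frob l x))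
    χ-inj : LineInjective χ
    χ-inj x y χx∧χy≈0 = x*y≈0⇒y≈0 nc≉0 (trans
      (solve 3 (λ c x y → (:1 ⊕ :N c) ⊗ (x :∧ y) ⊜ (x ⊕ c ⊗ x ⁻) :∧ (y ⊕ c ⊗ y ⁻)) refl c x y)
      (φ-inj (lin x) (lin y) (begin
        φ 1# (b * c) b c (lin x) ∧ φ 1# (b * c) b c (lin y)   ≈⟨ ∧-cong (φ∘lin x) (φ∘lin y) ⟩
        (nc * χ x) ∧ (nc * χ y)                               ≈⟨ solve 3 (λ c x y → ((:1 ⊕ :N c) ⊗ x) :∧ ((:1 ⊕ :N c) ⊗ y) ⊜
                                                                   (:1 ⊕ :N c) ⊗ (:1 ⊕ :N c) ⊗ (x :∧ y)) refl c (χ x) (χ y) ⟩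
        nc * nc * (χ x ∧ χ y)                                 ≈⟨ trans (*-congˡ χx∧χy≈0) (zeroʳ _) ⟩
        0#                                                    ∎)))
    frob-e : frob l (e 1# (b * c) b c) ≈ (1# + N b′) * (1# + N c′)
    frob-e = trans (frob-cong l e≈) (frob-⟦⟧ l ((:1 ⊕ :N (# zero)) ⊗ (:1 ⊕ :N (# suc zero))) (b ∷ c ∷ []))
    frob-U : frob l (U 1# (b * c) b c) ≈ conj c′ * (1# + N b′)
    frob-U = trans (frob-cong l (solve 2 (λ b c → :U :1 (b ⊗ c) b c ⊜ c ⁻ ⊗ (:1 ⊕ :N b)) refl b c))
      (frob-⟦⟧ l ((# suc zero) ⁻ ⊗ (:1 ⊕ :N (# zero))) (b ∷ c ∷ []))
    V≈ : V 1# (b * c) b c ≈ conj b * nc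
    V≈ = solve 2 (λ b c → :V :1 (b ⊗ c) b c ⊜ b ⁻ ⊗ (:1 ⊕ :N c)) refl b c
    -- With `c′` the Q-th power of `c`, the hypothesis holds both for c′ = b, where A′ = 0, and for
    -- c′ = 1 / b̄, where A = 0.
    matched : (1# + N b) * conj c′ ≈ (1# + N c′) * conj b → Matched 1# (b * c) b c
    matched eq = begin
      e 1# (b * c) b c * frob l (U 1# (b * c) b c)
        ≈⟨ *-cong e≈ frob-U ⟩
      (1# + N b) * nc * (conj c′ * (1# + N b′))
        ≈⟨ P.solve 4 (λ x y z w → x P.⊗ y P.⊗ (z P.⊗ w) P.⊜ x P.⊗ z P.⊗ (y P.⊗ w)) refl (1# + N b) nc (conj c′) (1# + N b′) ⟩
      (1# + N b) * conj c′ * (nc * (1# + N b′))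
        ≈⟨ *-congʳ eq ⟩
      (1# + N c′) * conj b * (nc * (1# + N b′))
        ≈⟨ P.solve 4 (λ x y z w → x P.⊗ y P.⊗ (z P.⊗ w) P.⊜ w P.⊗ x P.⊗ (y P.⊗ z)) refl (1# + N c′) (conj b) nc (1# + N b′) ⟩
      (1# + N b′) * (1# + N c′) * (conj b * nc)
        ≈⟨ *-cong frob-e V≈ ⟨
      frob l (e 1# (b * c) b c) * V 1# (b * c) b c ∎
    P≈0 : A ≈ 0# → Matched 1# (b * c) b c
    P≈0 A≈0 = matched (x+y≈0⇒x≈y (begin
      (1# + N b) * conj c′ + (1# + N c′) * conj b
        ≈⟨ solve 2 (λ b c → (:1 ⊕ :N b) ⊗ c ⁻ ⊕ (:1 ⊕ :N c) ⊗ b ⁻ ⊜ (:1 ⊕ b ⊗ c ⁻) ⊗ b ⁻ ⊕ (:1 ⊕ b ⊗ c ⁻) ⁻ ⊗ c ⁻) refl b c′ ⟩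
      A * conj b + conj A * conj c′
        ≈⟨ +-cong (*-congʳ A≈0) (*-congʳ (trans (conj-cong A≈0) (frob-0 k))) ⟩
      0# * conj b + 0# * conj c′
        ≈⟨ trans (+-cong (zeroˡ _) (zeroˡ _)) (+-identityˡ 0#) ⟩
      0# ∎))
    P′≈0 : A′ ≈ 0# → Matched 1# (b * c) b c
    P′≈0 A′≈0 = matched (*-cong (+-congˡ (N-cong (sym c′≈b))) (conj-cong c′≈b))
      where
      c′≈b : c′ ≈ b
      c′≈b = x+y≈0⇒x≈y A′≈0

  -- η Φ + η′ (conj Φ) is the form with coefficients d₁, a₁, b₁, c₁.
  module Recombination (η η′ d a b c : Carrier) where
    d₁ a₁ b₁ c₁ δ : Carrier
    d₁ = η * d + η′ * conj a
    a₁ = η * a + η′ * conj d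
    b₁ = η * b + η′ * conj c
    c₁ = η * c + η′ * conj b
    δ  = N η + N η′

    -- `δ` is the determinant of the 𝔽_q-linear map X ↦ η X + η′ X̄, so it scales every wedge; it
    -- scales `e`, `U` and `V` as well.
    lineInjective : ¬ δ ≈ 0# → LineInjective (φ d a b c) → LineInjective (φ d₁ a₁ b₁ c₁)
    lineInjective δ≉0 φ-inj x y φ₁∧φ₁≈0 = φ-inj x y (x*y≈0⇒y≈0 δ≉0 (trans (sym (begin
      φ d₁ a₁ b₁ c₁ x ∧ φ d₁ a₁ b₁ c₁ y
        ≈⟨ ∧-cong (recombine x) (recombine y) ⟩
      (η * φ d a b c x + η′ * conj (φ d a b c x)) ∧ (η * φ d a b c y + η′ * conj (φ d a b c y))
        ≈⟨ solve 4 (λ η η′ x y → (η ⊗ x ⊕ η′ ⊗ x ⁻) :∧ (η ⊗ y ⊕ η′ ⊗ y ⁻) ⊜ (:N η ⊕ :N η′) ⊗ (x :∧ y)) refl η η′ _ _ ⟩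
      δ * (φ d a b c x ∧ φ d a b c y) ∎)) φ₁∧φ₁≈0))
      where
      recombine : ∀ w → φ d₁ a₁ b₁ c₁ w ≈ η * φ d a b c w + η′ * conj (φ d a b c w)
      recombine w = solve 8 (λ η η′ d a b c z w →
        :Φ (η ⊗ d ⊕ η′ ⊗ a ⁻) (η ⊗ a ⊕ η′ ⊗ d ⁻) (η ⊗ b ⊕ η′ ⊗ c ⁻) (η ⊗ c ⊕ η′ ⊗ b ⁻) z w ⊜
        η ⊗ :Φ d a b c z w ⊕ η′ ⊗ (:Φ d a b c z w) ⁻) refl η η′ d a b c (frob l w) w

    e₁≈ : e d₁ a₁ b₁ c₁ ≈ δ * e d a b c
    e₁≈ = solve 6 (λ η η′ d a b c →
      :e (η ⊗ d ⊕ η′ ⊗ a ⁻) (η ⊗ a ⊕ η′ ⊗ d ⁻) (η ⊗ b ⊕ η′ ⊗ c ⁻) (η ⊗ c ⊕ η′ ⊗ b ⁻) ⊜ (:N η ⊕ :N η′) ⊗ :e d a b c) refl η η′ d a b c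

    U₁≈ : U d₁ a₁ b₁ c₁ ≈ δ * U d a b c
    U₁≈ = solve 6 (λ η η′ d a b c →
      :U (η ⊗ d ⊕ η′ ⊗ a ⁻) (η ⊗ a ⊕ η′ ⊗ d ⁻) (η ⊗ b ⊕ η′ ⊗ c ⁻) (η ⊗ c ⊕ η′ ⊗ b ⁻) ⊜ (:N η ⊕ :N η′) ⊗ :U d a b c) refl η η′ d a b c

    V₁≈ : V d₁ a₁ b₁ c₁ ≈ δ * V d a b c
    V₁≈ = solve 6 (λ η η′ d a b c →
      :V (η ⊗ d ⊕ η′ ⊗ a ⁻) (η ⊗ a ⊕ η′ ⊗ d ⁻) (η ⊗ b ⊕ η′ ⊗ c ⁻) (η ⊗ c ⊕ η′ ⊗ b ⁻) ⊜ (:N η ⊕ :N η′) ⊗ :V d a b c) refl η η′ d a b c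

    matched⁻ : ¬ δ ≈ 0# → Matched d₁ a₁ b₁ c₁ → Matched d a b c
    matched⁻ δ≉0 m = *-cancelˡ (*-≉0 δ≉0 (^-≉0 (2 ℕ.^ l) δ≉0)) (begin
      δ * frob l δ * (e d a b c * frob l (U d a b c))
        ≈⟨ P.solve 4 (λ x y z w → x P.⊗ y P.⊗ (z P.⊗ w) P.⊜ x P.⊗ z P.⊗ (y P.⊗ w)) refl δ (frob l δ) (e d a b c) (frob l (U d a b c)) ⟩
      δ * e d a b c * (frob l δ * frob l (U d a b c))
        ≈⟨ *-cong e₁≈ (trans (frob-cong l U₁≈) (frob-* l _ _)) ⟨
      e d₁ a₁ b₁ c₁ * frob l (U d₁ a₁ b₁ c₁)
        ≈⟨ m ⟩
      frob l (e d₁ a₁ b₁ c₁) * V d₁ a₁ b₁ c₁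
        ≈⟨ *-cong (trans (frob-cong l e₁≈) (frob-* l _ _)) V₁≈ ⟩
      frob l δ * frob l (e d a b c) * (δ * V d a b c)
        ≈⟨ P.solve 4 (λ x y z w → x P.⊗ y P.⊗ (z P.⊗ w) P.⊜ z P.⊗ x P.⊗ (y P.⊗ w)) refl (frob l δ) (frob l (e d a b c)) δ (V d a b c) ⟩
      δ * frob l δ * (frob l (e d a b c) * V d a b c) ∎)

  module _ {d a b c d′ a′ b′ c′ : Carrier} (d≈ : d ≈ d′) (a≈ : a ≈ a′) (b≈ : b ≈ b′) (c≈ : c ≈ c′) where

    φ-cong-coefficients : ∀ w → φ d a b c w ≈ φ d′ a′ b′ c′ w
    φ-cong-coefficients w = +-cong (+-cong (+-cong (*-congʳ d≈) (*-congʳ a≈)) (*-congʳ b≈)) (*-congʳ c≈)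

    Matched-resp : Matched d′ a′ b′ c′ → Matched d a b c
    Matched-resp m = trans (*-cong e-cong (frob-cong l (+-cong (*-cong d≈ (conj-cong c≈)) (*-cong (conj-cong a≈) b≈))))
      (trans m (sym (*-cong (frob-cong l e-cong) (+-cong (*-cong d≈ (conj-cong b≈)) (*-cong (conj-cong a≈) c≈)))))
      where
      e-cong : e d a b c ≈ e d′ a′ b′ c′
      e-cong = +-cong (+-cong (+-cong (N-cong d≈) (N-cong a≈)) (N-cong b≈)) (N-cong c≈)

  N1≈1 : N 1# ≈ 1#
  N1≈1 = trans (*-identityˡ _) (frob-1 k)

  singular-d≉0 : ∀ d a b c → ¬ d ≈ 0# → d * a ≈ b * c → LineInjective (φ d a b c) → Matched d a b c
  singular-d≉0 d a b c d≉0 da≈bc φ-inj = matched⁻ δ≉0 (Matched-resp d₁≈1 a₁≈b₁c₁ refl refl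
    (singular-monic b₁ c₁ φ₁-inj (Necessity.e≉0 k l F _ _ _ _ φ₁-inj)))
    where
    d⁻¹ = d ⁻¹⟨ d≉0 ⟩
    d⁻¹≉0 : ¬ d⁻¹ ≈ 0#
    d⁻¹≉0 eq = 0≉1 (trans (sym (trans (*-congʳ eq) (zeroˡ d))) (inverseˡ d≉0))
    open Recombination d⁻¹ 0# d a b c
    drop : ∀ x y → x + 0# * y ≈ x
    drop x y = trans (+-congˡ (zeroˡ y)) (+-identityʳ x)
    δ≉0 : ¬ δ ≈ 0#
    δ≉0 eq = N-≉0 d⁻¹≉0 (trans (sym (drop _ _)) eq)
    d₁≈1 : d₁ ≈ 1#
    d₁≈1 = trans (drop _ _) (inverseˡ d≉0)
    a₁≈b₁c₁ : a₁ ≈ b₁ * c₁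
    a₁≈b₁c₁ = begin
      a₁                                 ≈⟨ drop _ _ ⟩
      d⁻¹ * a                            ≈⟨ *-congˡ (trans (*-congʳ (inverseˡ d≉0)) (*-identityˡ a)) ⟨
      d⁻¹ * (d⁻¹ * d * a)                ≈⟨ *-congˡ (trans (*-assoc _ _ _) (*-congˡ da≈bc)) ⟩
      d⁻¹ * (d⁻¹ * (b * c))              ≈⟨ P.solve 3 (λ i b c → i P.⊗ (i P.⊗ (b P.⊗ c)) P.⊜ i P.⊗ b P.⊗ (i P.⊗ c)) refl d⁻¹ b c ⟩
      d⁻¹ * b * (d⁻¹ * c)                ≈⟨ *-cong (drop _ _) (drop _ _) ⟨
      b₁ * c₁                            ∎
    φ₁-inj : LineInjective (φ 1# (b₁ * c₁) b₁ c₁)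
    φ₁-inj = LineInjective-resp (φ-cong-coefficients d₁≈1 a₁≈b₁c₁ refl refl) (lineInjective δ≉0 φ-inj)

  -- Conjugating Φ puts ā in the place of `d`, so a nonzero `a` serves as well as a nonzero `d`. If
  -- both vanish, then U = V = 0.
  singular⇒matched : ∀ d a b c → d * a ≈ b * c → LineInjective (φ d a b c) → Matched d a b c
  singular⇒matched d a b c da≈bc φ-inj = zero-or-unit d
    (λ d≈0 → zero-or-unit a (both-zero d≈0) a≉0)
    (λ d≉0 → singular-d≉0 d a b c d≉0 da≈bc φ-inj)
    where
    both-zero : d ≈ 0# → a ≈ 0# → Matched d a b c
    both-zero d≈0 a≈0 = begin
      e d a b c * frob l (U d a b c)
        ≈⟨ *-congˡ (trans (frob-cong l (trans (+-cong (trans (*-congʳ d≈0) (zeroˡ _)) (trans (*-congʳ ā≈0) (zeroˡ _))) (+-identityˡ 0#))) (frob-0 l)) ⟩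
      e d a b c * 0#
        ≈⟨ trans (zeroʳ _) (sym (zeroʳ _)) ⟩
      frob l (e d a b c) * 0#
        ≈⟨ *-congˡ (trans (+-cong (trans (*-congʳ d≈0) (zeroˡ _)) (trans (*-congʳ ā≈0) (zeroˡ _))) (+-identityˡ 0#)) ⟨
      frob l (e d a b c) * V d a b c ∎
      where
      ā≈0 : conj a ≈ 0#
      ā≈0 = trans (conj-cong a≈0) (frob-0 k)
    a≉0 : ¬ a ≈ 0# → Matched d a b c
    a≉0 a≉0 = matched⁻ δ≉0 (singular-d≉0 d₁ a₁ b₁ c₁ d₁≉0 d₁a₁≈b₁c₁ (lineInjective δ≉0 φ-inj))
      where
      open Recombination 0# 1# d a b c
      δ≉0 : ¬ δ ≈ 0#
      δ≉0 eq = 0≉1 (trans (sym eq) (trans (+-congʳ (zeroˡ _)) (trans (+-identityˡ _) N1≈1)))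
      d₁≉0 : ¬ d₁ ≈ 0#
      d₁≉0 eq = conj-≉0 a≉0 (trans (sym (trans (+-congʳ (zeroˡ d)) (trans (+-identityˡ _) (*-identityˡ _)))) eq)
      d₁a₁≈b₁c₁ : d₁ * a₁ ≈ b₁ * c₁
      d₁a₁≈b₁c₁ = x+y≈0⇒x≈y (begin
        d₁ * a₁ + b₁ * c₁
          ≈⟨ solve 4 (λ d a b c → (:0 ⊗ d ⊕ :1 ⊗ a ⁻) ⊗ (:0 ⊗ a ⊕ :1 ⊗ d ⁻) ⊕ (:0 ⊗ b ⊕ :1 ⊗ c ⁻) ⊗ (:0 ⊗ c ⊕ :1 ⊗ b ⁻) ⊜
               (d ⊗ a ⊕ b ⊗ c) ⁻) refl d a b c ⟩
        conj (d * a + b * c)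
          ≈⟨ trans (conj-cong (x≈y⇒x+y≈0 da≈bc)) (frob-0 k) ⟩
        0# ∎)

  -- On 𝔽_q the trace from 𝔽_{q²} to 𝔽₂ is twice the trace from 𝔽_q, hence zero.
  trace-0-over-𝔽₂ : ∀ {s} → conj s ≈ s → ∃ λ y → y * y ≈ y + s
  trace-0-over-𝔽₂ {s} s-fixed = by (hilbert90 1 (k ℕ.+ k) (ℕₚ.*-identityʳ (k ℕ.+ k)) s (begin
    ∑< (k ℕ.+ k) (λ i → frob (i ℕ.* 1) s)
      ≈⟨ ∑<-split k k _ ⟩
    ∑< k (λ i → frob (i ℕ.* 1) s) + ∑< k (λ i → frob ((k ℕ.+ i) ℕ.* 1) s)
      ≈⟨ +-congˡ (∑<-cong k λ i _ → trans (reflexive (≡.cong (λ n → frob n s) (k+i≡ i))) (trans (sym (frob-∘ k (i ℕ.* 1) s)) (frob-cong (i ℕ.* 1) s-fixed))) ⟩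
    ∑< k (λ i → frob (i ℕ.* 1) s) + ∑< k (λ i → frob (i ℕ.* 1) s)
      ≈⟨ x+x≈0 _ ⟩
    0# ∎))
    where
    open RangeSums k F
    k+i≡ : ∀ i → (k ℕ.+ i) ℕ.* 1 ≡ k ℕ.+ i ℕ.* 1
    k+i≡ i = ≡.trans (ℕₚ.*-identityʳ (k ℕ.+ i)) (≡.cong (k ℕ.+_) (≡.sym (ℕₚ.*-identityʳ i)))
    by : (∃ λ y → frob 1 y ≈ y + s) → ∃ λ y → y * y ≈ y + s
    by (y , y²≈) = y , trans (*-congˡ (sym (*-identityʳ y))) y²≈

  x*x≈x⇒x≈0∨x≈1 : ∀ {x} → x * x ≈ x → x ≈ 0# ⊎ x ≈ 1#
  x*x≈x⇒x≈0∨x≈1 {x} xx≈x = [ inj₁ , (λ eq → inj₂ (x+y≈0⇒x≈y eq)) ]′ (x*y≈0⇒x≈0∨y≈0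
    (trans (P.solve 1 (λ x → x P.⊗ (x P.⊕ P.:1) P.⊜ x P.⊗ x P.⊕ x) refl x) (x≈y⇒x+y≈0 xx≈x)))

  -- The conjugate of `y` is a root of the same equation, so it is y or y + 1; the bit tells whether
  -- the roots lie in 𝔽_q.
  T-root : ∀ {s y} → conj s ≈ s → y * y ≈ y + s → T y ≈ 0# ⊎ T y ≈ 1#
  T-root {s} {y} s-fixed yy≈ = x*x≈x⇒x≈0∨x≈1 (begin
    T y * T y                        ≈⟨ solve 1 (λ y → :T y ⊗ :T y ⊜ :T (y ⊗ y)) refl y ⟩
    T (y * y)                        ≈⟨ +-cong yy≈ (trans (conj-cong yy≈) (trans (frob-+ k y s) (+-congˡ s-fixed))) ⟩
    y + s + (conj y + s)             ≈⟨ P.solve 3 (λ y s z → y P.⊕ s P.⊕ (z P.⊕ s) P.⊜ y P.⊕ z) refl y s (conj y) ⟩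
    T y                              ∎)

  -- Artin-Schreier theory splits the proof: roots of Y² + e Y + N U outside 𝔽_q give a zero of β,
  -- and roots in 𝔽_q give a singular combination of Φ and its conjugate.
  matched : ∀ d a b c → LineInjective (φ d a b c) → Matched d a b c
  matched d a b c φ-inj = by (trace-0-over-𝔽₂ s-fixed)
    where
    E = e d a b c
    W = U d a b c
    E≉0 : ¬ E ≈ 0#
    E≉0 = e≉0 d a b c φ-inj
    E⁻¹ = E ⁻¹⟨ E≉0 ⟩
    s = N W * (E⁻¹ * E⁻¹)
    s-fixed : conj s ≈ s
    s-fixed = fixed-* (conj-N W) (fixed-* (fixed-⁻¹ (conj-e d a b c) E≉0) (fixed-⁻¹ (conj-e d a b c) E≉0))
    by : (∃ λ y → y * y ≈ y + s) → Matched d a b c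
    by (y , yy≈) = [ (λ Ty≈0 → anisotropic (fixed-* (conj-e d a b c) (fixed⇐T≈0 Ty≈0))) , isotropic ]′ (T-root s-fixed yy≈)
      where
      Y = E * y
      -- β is anisotropic if the root Y of Y² + e Y + N U lies in 𝔽_q, and isotropic otherwise.
      YY≈ : Y * Y + E * Y + N W ≈ 0#
      YY≈ = x≈y⇒x+y≈0 (begin
        E * y * (E * y) + E * (E * y)         ≈⟨ P.solve 2 (λ E y → E P.⊗ y P.⊗ (E P.⊗ y) P.⊕ E P.⊗ (E P.⊗ y) P.⊜ E P.⊗ E P.⊗ (y P.⊗ y P.⊕ y)) refl E y ⟩
        E * E * (y * y + y)                   ≈⟨ *-congˡ (trans (+-congʳ yy≈) (P.solve 2 (λ y s → y P.⊕ s P.⊕ y P.⊜ s) refl y s)) ⟩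
        E * E * s                             ≈⟨ P.solve 3 (λ E i n → E P.⊗ E P.⊗ (n P.⊗ (i P.⊗ i)) P.⊜ E P.⊗ i P.⊗ (E P.⊗ i) P.⊗ n) refl E E⁻¹ (N W) ⟩
        E * E⁻¹ * (E * E⁻¹) * N W             ≈⟨ *-congʳ (*-cong (inverseʳ E≉0) (inverseʳ E≉0)) ⟩
        1# * 1# * N W                         ≈⟨ trans (*-congʳ (*-identityˡ 1#)) (*-identityˡ _) ⟩
        N W                                   ∎)

      isotropic : T y ≈ 1# → Matched d a b c
      -- A zero of β is a w for which W w / w̄ is a root of the quadratic. As Y Ȳ = N W, w = Y + W̄
      -- satisfies W w = Y w̄. If this w is zero, then W = Ȳ and w = 1 serves.
      isotropic Ty≈1 = zero-or-unit (Y + conj W)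
        (λ Y+W̄≈0 → isotropic⇒matched d a b c φ-inj (λ 1≈0 → 0≉1 (sym 1≈0)) (β[1]≈0 Y+W̄≈0))
        (λ w≉0 → isotropic⇒matched d a b c φ-inj w≉0 β[Y+W̄]≈0)
        where
        Ȳ≈ : conj Y ≈ Y + E
        Ȳ≈ = begin
          conj (E * y)        ≈⟨ trans (frob-* k E y) (*-congʳ (conj-e d a b c)) ⟩
          E * conj y          ≈⟨ *-congˡ (P.solve 2 (λ y z → z P.⊜ y P.⊕ (y P.⊕ z)) refl y (conj y)) ⟩
          E * (y + T y)       ≈⟨ *-congˡ (+-congˡ Ty≈1) ⟩
          E * (y + 1#)        ≈⟨ trans (distribˡ E y 1#) (+-congˡ (*-identityʳ E)) ⟩
          Y + E               ∎
        β[1]≈0 : Y + conj W ≈ 0# → β d a b c 1# ≈ 0#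
        β[1]≈0 Y+W̄≈0 = begin
          E * (1# * conj 1#) + T (W * (1# * 1#))
            ≈⟨ solve 2 (λ E W → E ⊗ (:1 ⊗ :1 ⁻) ⊕ :T (W ⊗ (:1 ⊗ :1)) ⊜ E ⊕ (W ⊕ W ⁻)) refl E W ⟩
          E + (W + conj W)
            ≈⟨ +-congˡ (+-cong (trans (sym (conj-involutive W)) (trans (conj-cong (sym (x+y≈0⇒x≈y Y+W̄≈0))) Ȳ≈)) (sym (x+y≈0⇒x≈y Y+W̄≈0))) ⟩
          E + (Y + E + Y)
            ≈⟨ P.solve 2 (λ E Y → E P.⊕ (Y P.⊕ E P.⊕ Y) P.⊜ P.:0) refl E Y ⟩
          0# ∎
        β[Y+W̄]≈0 : β d a b c (Y + conj W) ≈ 0#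
        β[Y+W̄]≈0 = begin
          β d a b c (Y + conj W)
            ≈⟨ solve 3 (λ E W Y → :B E W (Y ⊕ W ⁻) (Y ⊕ W ⁻) ⊜
                 E ⊗ ((Y ⊕ W ⁻) ⊗ (Y ⁻ ⊕ W)) ⊕ (W ⊗ (Y ⊗ Y ⊕ W ⁻ ⊗ W ⁻) ⊕ W ⁻ ⊗ (Y ⁻ ⊗ Y ⁻ ⊕ W ⊗ W))) refl E W Y ⟩
          E * ((Y + conj W) * (conj Y + W)) + (W * (Y * Y + conj W * conj W) + conj W * (conj Y * conj Y + W * W))
            ≈⟨ +-cong (*-congˡ (*-congˡ (+-congʳ Ȳ≈))) (+-congˡ (*-congˡ (+-congʳ (*-cong Ȳ≈ Ȳ≈)))) ⟩
          E * ((Y + conj W) * (Y + E + W)) + (W * (Y * Y + conj W * conj W) + conj W * ((Y + E) * (Y + E) + W * W))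
            ≈⟨ P.solve 4 (λ E W W̄ Y → E P.⊗ ((Y P.⊕ W̄) P.⊗ (Y P.⊕ E P.⊕ W)) P.⊕ (W P.⊗ (Y P.⊗ Y P.⊕ W̄ P.⊗ W̄) P.⊕ W̄ P.⊗ ((Y P.⊕ E) P.⊗ (Y P.⊕ E) P.⊕ W P.⊗ W))
                 P.⊜ (E P.⊕ W P.⊕ W̄) P.⊗ (Y P.⊗ Y P.⊕ E P.⊗ Y P.⊕ W P.⊗ W̄)) refl E W (conj W) Y ⟩
          (E + W + conj W) * (Y * Y + E * Y + N W)
            ≈⟨ trans (*-congˡ YY≈) (zeroʳ _) ⟩
          0# ∎

      -- The members η Φ + η′ (conj Φ) with G η² + e η η′ + conj G η′² = 0 are singular.
      anisotropic : conj Y ≈ Y → Matched d a b c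
      -- For a root η the determinant δ equals e η, so η must be nonzero; if η₀ vanishes, the other
      -- root η₀ + e is taken.
      anisotropic Y-fixed = zero-or-unit η₀
        (λ η₀≈0 → choose (trans (conj-+ η₀ E) (+-cong η₀-fixed (conj-e d a b c)))
          (λ eq → E≉0 (trans (sym (trans (+-congʳ η₀≈0) (+-identityˡ E))) eq))
          (trans (P.solve 3 (λ η E n → (η P.⊕ E) P.⊗ (η P.⊕ E) P.⊕ E P.⊗ (η P.⊕ E) P.⊕ n P.⊜ η P.⊗ η P.⊕ E P.⊗ η P.⊕ n) refl η₀ E (N G)) root))
        (λ η₀≉0 → choose η₀-fixed η₀≉0 root)
        where
        conj-+ = frob-+ k
        G η₀ : Carrier
        G = d * a + b * c
        -- The shift by N a + N c, an element of 𝔽_q, turns the quadratic with constant term N U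
        -- into the one with constant term N G.
        η₀ = Y + (N a + N c)
        η₀-fixed : conj η₀ ≈ η₀
        η₀-fixed = fixed-+ Y-fixed (fixed-+ (conj-N a) (conj-N c))
        root : η₀ * η₀ + E * η₀ + N G ≈ 0#
        root = trans (solve 5 (λ d a b c Y →
            (Y ⊕ (:N a ⊕ :N c)) ⊗ (Y ⊕ (:N a ⊕ :N c)) ⊕ :e d a b c ⊗ (Y ⊕ (:N a ⊕ :N c)) ⊕ :N (d ⊗ a ⊕ b ⊗ c) ⊜
            Y ⊗ Y ⊕ :e d a b c ⊗ Y ⊕ :N (:U d a b c)) refl d a b c Y) YY≈
        choose : ∀ {η} → conj η ≈ η → ¬ η ≈ 0# → η * η + E * η + N G ≈ 0# → Matched d a b c
        choose {η} η-fixed η≉0 ηη≈ = matched⁻ δ≉0 (singular⇒matched d₁ a₁ b₁ c₁ (x+y≈0⇒x≈y d₁a₁+b₁c₁≈0) (lineInjective δ≉0 φ-inj))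
          where
          open Recombination η G d a b c
          δ≉0 : ¬ δ ≈ 0#
          δ≉0 δ≈0 = *-≉0 E≉0 η≉0 (begin
            E * η                                     ≈⟨ P.solve 3 (λ a b c → b P.⊜ a P.⊕ b P.⊕ c P.⊕ (a P.⊕ c)) refl (η * η) (E * η) (N G) ⟩
            η * η + E * η + N G + (η * η + N G)       ≈⟨ +-cong ηη≈ (trans (+-congʳ (*-congˡ (sym η-fixed))) δ≈0) ⟩
            0# + 0#                                   ≈⟨ +-identityˡ 0# ⟩
            0#                                        ∎)
          d₁a₁+b₁c₁≈0 : d₁ * a₁ + b₁ * c₁ ≈ 0#
          d₁a₁+b₁c₁≈0 = begin
            d₁ * a₁ + b₁ * c₁
              ≈⟨ solve 6 (λ η d a b c G → (η ⊗ d ⊕ G ⊗ a ⁻) ⊗ (η ⊗ a ⊕ G ⊗ d ⁻) ⊕ (η ⊗ b ⊕ G ⊗ c ⁻) ⊗ (η ⊗ c ⊕ G ⊗ b ⁻) ⊜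
                   (d ⊗ a ⊕ b ⊗ c) ⊗ (η ⊗ η) ⊕ G ⊗ (:e d a b c ⊗ η) ⊕ G ⊗ G ⊗ (d ⊗ a ⊕ b ⊗ c) ⁻) refl η d a b c G ⟩
            G * (η * η) + G * (E * η) + G * G * conj G
              ≈⟨ P.solve 4 (λ G A B Ḡ → G P.⊗ A P.⊕ G P.⊗ B P.⊕ G P.⊗ G P.⊗ Ḡ P.⊜ G P.⊗ (A P.⊕ B P.⊕ G P.⊗ Ḡ)) refl G (η * η) (E * η) (conj G) ⟩
            G * (η * η + E * η + N G)
              ≈⟨ trans (*-congˡ ηη≈) (zeroʳ G) ⟩
            0# ∎

-- The trace condition

module TraceCondition {c ℓ} (k l : ℕ) .{{_ : NonZero k}} (F : FiniteField c ℓ ((2 ℕ.^ k) ℕ.^ 2))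
  (m n n′ : ℕ) .{{_ : NonZero m}} (k≡nm : k ≡ n ℕ.* m) (l≡n′m : l ≡ n′ ℕ.* m) where
  open QuadraticField k F
  open RangeSums k F
  open PowerSums k F
  open AdditiveHilbert90 k F
  open Wedge k F
  open Forms k l F
  open Necessity k l F
  open Matching k l F
  open SetoidReasoning setoid
  open Solver using (#_; :1; _⊕_; _⊗_; _⁻; _⊜_; solve)
  private module P = Plain

  Trₘ : Carrier → Carrier
  Trₘ x = ∑< n (λ i → frob (i ℕ.* m) x)

  -- Behaviour of the trace under Frobenius maps

  count : ℕ → Carrier
  count j = ∑< j (λ _ → 1#)

  ∑<-constant : ∀ j x → ∑< j (λ _ → x) ≈ x * count j
  ∑<-constant j x = trans (∑<-cong j (λ _ _ → sym (*-identityʳ x))) (∑<-*ˡ j x (λ _ → 1#))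

  Constant : Carrier → Set _
  Constant x = ∀ j → frob j x ≈ x

  0∨1⇒constant : ∀ {x} → x ≈ 0# ⊎ x ≈ 1# → Constant x
  0∨1⇒constant (inj₁ x≈0) j = trans (frob-cong j x≈0) (trans (frob-0 j) (sym x≈0))
  0∨1⇒constant (inj₂ x≈1) j = trans (frob-cong j x≈1) (trans (frob-1 j) (sym x≈1))

  frob-k : ∀ x → frob (n ℕ.* m) x ≈ conj x
  frob-k x = reflexive (≡.cong (λ j → frob j x) (≡.sym k≡nm))

  frob-l : ∀ x → frob (n′ ℕ.* m) x ≈ frob l x
  frob-l x = reflexive (≡.cong (λ j → frob j x) (≡.sym l≡n′m))

  frob-swap : ∀ i j x → frob i (frob j x) ≈ frob j (frob i x)
  frob-swap i j x = ^-swap x (2 ℕ.^ j) (2 ℕ.^ i)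

  frob-1+ : ∀ i x → frob (suc i ℕ.* m) x ≈ frob (i ℕ.* m) (frob m x)
  frob-1+ i x = sym (frob-∘ m (i ℕ.* m) x)

  Trₘ-+ : ∀ x y → Trₘ (x + y) ≈ Trₘ x + Trₘ y
  Trₘ-+ x y = trans (∑<-cong n (λ i _ → frob-+ (i ℕ.* m) x y)) (∑<-+ n _ _)

  -- The sum `Trₘ` has only k/m terms, so off 𝔽_q it need not be invariant: each step of `frob m`
  -- trades a term for its conjugate and thereby adds ν.
  Trₘ-frob : ∀ {r ν} → Constant ν → conj r ≈ r + ν → ∀ j → Trₘ (frob (j ℕ.* m) r) ≈ Trₘ r + ν * count j
  Trₘ-frob {r} {ν} ν-const r̄≈ zero    = trans (∑<-cong n (λ i _ → frob-cong (i ℕ.* m) (*-identityʳ r)))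
    (sym (trans (+-congˡ (zeroʳ ν)) (+-identityʳ _)))
  Trₘ-frob {r} {ν} ν-const r̄≈ (suc j) = begin
    ∑< n (λ i → frob (i ℕ.* m) (frob (suc j ℕ.* m) r))
      ≈⟨ ∑<-cong n (λ i _ → trans (frob-cong (i ℕ.* m) (trans (frob-1+ j r) (frob-swap (j ℕ.* m) m r))) (sym (frob-1+ i _))) ⟩
    ∑< n (λ i → frob (suc i ℕ.* m) x)
      ≈⟨ ∑<-shift n (λ i → frob (i ℕ.* m) x) ⟩
    Trₘ x + (frob 0 x + frob (n ℕ.* m) x)
      ≈⟨ +-cong (Trₘ-frob ν-const r̄≈ j) (+-cong (*-identityʳ x) (trans (frob-k x) (trans (sym (frob-conj (j ℕ.* m) r)) (trans (frob-cong (j ℕ.* m) r̄≈)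
           (trans (frob-+ (j ℕ.* m) r ν) (+-congˡ (ν-const (j ℕ.* m)))))))) ⟩
    Trₘ r + ν * count j + (x + (x + ν))
      ≈⟨ P.solve 5 (λ t ν c x o → t P.⊕ ν P.⊗ c P.⊕ (x P.⊕ (x P.⊕ ν)) P.⊜ t P.⊕ ν P.⊗ (c P.⊕ P.:1)) refl (Trₘ r) ν (count j) x 1# ⟩
    Trₘ r + ν * count (suc j) ∎
    where
    x = frob (j ℕ.* m) r

  Trₘ-cocycle : ∀ {r ν ε t} → Constant ν → Constant ε → conj r ≈ r + ν → frob l r ≈ r + (ε + t) →
                Trₘ t ≈ ε * count n + ν * count n′
  Trₘ-cocycle {r} {ν} {ε} {t} ν-const ε-const r̄≈ r^Q≈ = begin
    Trₘ t
      ≈⟨ ∑<-cong n (λ i _ → frob-cong (i ℕ.* m) (trans (P.solve 3 (λ r ε t → t P.⊜ ε P.⊕ (r P.⊕ (r P.⊕ (ε P.⊕ t)))) refl r ε t) (+-congˡ (+-congˡ (sym r^Q≈))))) ⟩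
    Trₘ (ε + (r + frob l r))
      ≈⟨ trans (Trₘ-+ ε _) (+-congˡ (Trₘ-+ r _)) ⟩
    Trₘ ε + (Trₘ r + Trₘ (frob l r))
      ≈⟨ +-cong (trans (∑<-cong n (λ i _ → ε-const (i ℕ.* m))) (∑<-constant n ε))
                (+-congˡ (trans (∑<-cong n (λ i _ → frob-cong (i ℕ.* m) (sym (frob-l r)))) (Trₘ-frob ν-const r̄≈ n′))) ⟩
    ε * count n + (Trₘ r + (Trₘ r + ν * count n′))
      ≈⟨ P.solve 3 (λ a b c → a P.⊕ (b P.⊕ (b P.⊕ c)) P.⊜ a P.⊕ c) refl (ε * count n) (Trₘ r) (ν * count n′) ⟩
    ε * count n + ν * count n′ ∎

  module MatchedForm (d a b c : Carrier) (m-d : Matched d a b c) (e≉0 : ¬ e d a b c ≈ 0#)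
    (t : Carrier) (et≈ : e d a b c * t ≈ N b + N c) where

    E θ : Carrier
    E = e d a b c
    θ = E ⁻¹⟨ e≉0 ⟩ * U d a b c

    Eθ≈U : E * θ ≈ U d a b c
    Eθ≈U = trans (sym (*-assoc _ _ _)) (trans (*-congʳ (inverseʳ e≉0)) (*-identityˡ _))

    -- The matching condition enters here: it makes the bilinear form of γ equal to E times the
    -- Frobenius image of `Y`.
    Eθ^Q≈V : E * frob l θ ≈ V d a b c
    Eθ^Q≈V = *-cancelˡ (^-≉0 (2 ℕ.^ l) e≉0) (begin
      frob l E * (E * frob l θ)    ≈⟨ P.solve 3 (λ x y z → x P.⊗ (y P.⊗ z) P.⊜ y P.⊗ (x P.⊗ z)) refl (frob l E) E (frob l θ) ⟩
      E * (frob l E * frob l θ)    ≈⟨ *-congˡ (trans (sym (frob-* l E θ)) (frob-cong l Eθ≈U)) ⟩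
      E * frob l (U d a b c)       ≈⟨ m-d ⟩
      frob l E * V d a b c         ∎)

    E[1+t]≈ : E * (1# + t) ≈ N d + N a
    E[1+t]≈ = begin
      E * (1# + t)              ≈⟨ trans (distribˡ E 1# t) (+-cong (*-identityʳ E) et≈) ⟩
      E + (N b + N c)           ≈⟨ P.solve 4 (λ d a b c → d P.⊕ a P.⊕ b P.⊕ c P.⊕ (b P.⊕ c) P.⊜ d P.⊕ a) refl (N d) (N a) (N b) (N c) ⟩
      N d + N a                 ∎

    E-fixed : conj E ≈ E
    E-fixed = conj-e d a b c

    Y : Carrier → Carrier → Carrier
    Y w h = B 1# θ w h

    B≈E*B : ∀ {W ϑ} x y → E * ϑ ≈ W → B E W x y ≈ E * B 1# ϑ x y
    B≈E*B {W} {ϑ} x y Eϑ≈W = begin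
      E * (x * conj y) + (W * (x * y) + conj (W * (x * y)))
        ≈⟨ +-congˡ (+-cong W[xy]≈ (trans (conj-cong W[xy]≈) (trans (frob-* k _ _) (*-congʳ E-fixed)))) ⟩
      E * (x * conj y) + (E * (ϑ * (x * y)) + E * conj (ϑ * (x * y)))
        ≈⟨ P.solve 4 (λ E a b c → E P.⊗ a P.⊕ (E P.⊗ b P.⊕ E P.⊗ c) P.⊜ E P.⊗ (P.:1 P.⊗ a P.⊕ (b P.⊕ c))) refl E (x * conj y) _ _ ⟩
      E * B 1# ϑ x y ∎
      where
      W[xy]≈ : W * (x * y) ≈ E * (ϑ * (x * y))
      W[xy]≈ = trans (*-congʳ (sym Eϑ≈W)) (*-assoc _ _ _)

    frob-Y : ∀ w h → frob l (Y w h) ≈ B 1# (frob l θ) (frob l w) (frob l h)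
    frob-Y w h = frob-⟦⟧ l (:B :1 (# zero) (# suc zero) (# suc (suc zero))) (θ ∷ w ∷ h ∷ [])

    -- Over the algebraic closure a matched form is equivalent to X^(Q+1) or to X^(Q−1);
    -- r plays the role of the cross ratio of w, h and the two roots of β.
    φ∧φ≈ : ∀ w h r → r * (w ∧ h) ≈ Y w h →
           φ d a b c w ∧ φ d a b c h ≈ E * ((w ∧ h) * frob l (w ∧ h)) * (frob l r + r + (1# + t))
    φ∧φ≈ w h r rσ≈Y = begin
      φ d a b c w ∧ φ d a b c h
        ≈⟨ Φ-∧-Φ d a b c z w g h ⟩
      B E (V d a b c) z g * σ + B E (U d a b c) w h * (z ∧ g) + (N d + N a) * (z ∧ g) * σ
        ≈⟨ +-cong (+-cong (*-congʳ (trans (B≈E*B z g Eθ^Q≈V) (*-congˡ (trans (sym (frob-Y w h)) (trans (frob-cong l (sym rσ≈Y)) (frob-* l r σ))))))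
             (*-cong (trans (B≈E*B w h Eθ≈U) (*-congˡ (sym rσ≈Y))) (sym (frob-∧ l w h))))
             (*-congʳ (*-cong (sym E[1+t]≈) (sym (frob-∧ l w h)))) ⟩
      E * (frob l r * frob l σ) * σ + E * (r * σ) * frob l σ + E * (1# + t) * frob l σ * σ
        ≈⟨ P.solve 6 (λ E r′ r σ σ′ t → E P.⊗ (r′ P.⊗ σ′) P.⊗ σ P.⊕ E P.⊗ (r P.⊗ σ) P.⊗ σ′ P.⊕ E P.⊗ t P.⊗ σ′ P.⊗ σ P.⊜
             E P.⊗ (σ P.⊗ σ′) P.⊗ (r′ P.⊕ r P.⊕ t)) refl E (frob l r) r σ (frob l σ) (1# + t) ⟩
      E * (σ * frob l σ) * (frob l r + r + (1# + t)) ∎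
      where
      z = frob l w
      g = frob l h
      σ = w ∧ h

    -- In `Y` only the term w h̄ is not fixed by `conj`, and it changes by w ∧ h.
    conj-r : ∀ w h r → ¬ w ∧ h ≈ 0# → r * (w ∧ h) ≈ Y w h → conj r ≈ r + 1#
    conj-r w h r σ≉0 rσ≈Y = *-cancelˡ σ≉0 (begin
      σ * conj r               ≈⟨ trans (*-comm σ (conj r)) (*-congˡ (sym (conj-∧ w h))) ⟩
      conj r * conj σ          ≈⟨ trans (sym (frob-* k r σ)) (conj-cong rσ≈Y) ⟩
      conj (Y w h)             ≈⟨ solve 3 (λ θ w h → (:B :1 θ w h) ⁻ ⊜ :B :1 θ w h ⊕ (w :∧ h)) refl θ w h ⟩
      Y w h + σ                ≈⟨ +-congʳ rσ≈Y ⟨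
      r * σ + σ                ≈⟨ P.solve 2 (λ r σ → r P.⊗ σ P.⊕ σ P.⊜ σ P.⊗ (r P.⊕ P.:1)) refl r σ ⟩
      σ * (r + 1#)             ∎)
      where σ = w ∧ h

    lineInjective : count n + count n′ ≈ 1# → Trₘ t ≈ 0# → LineInjective (φ d a b c)
    lineInjective odd Tr≈0 w h φ∧φ≈0 = zero-or-unit (w ∧ h) id λ σ≉0 → contradiction (no-collision σ≉0) λ ()
      where
      no-collision : ¬ ¬ w ∧ h ≈ 0#
      no-collision σ≉0 = 0≉1 (begin
        0#                                  ≈⟨ Tr≈0 ⟨
        Trₘ t                               ≈⟨ Trₘ-cocycle (0∨1⇒constant (inj₂ refl)) (0∨1⇒constant (inj₂ refl)) (conj-r w h r σ≉0 rσ≈Y) r^Q≈ ⟩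
        1# * count n + 1# * count n′        ≈⟨ +-cong (*-identityˡ _) (*-identityˡ _) ⟩
        count n + count n′                  ≈⟨ odd ⟩
        1#                                  ∎)
        where
        σ = w ∧ h
        r = Y w h * σ ⁻¹⟨ σ≉0 ⟩
        rσ≈Y : r * σ ≈ Y w h
        rσ≈Y = trans (*-assoc _ _ _) (trans (*-congˡ (inverseˡ σ≉0)) (*-identityʳ _))
        r^Q≈ : frob l r ≈ r + (1# + t)
        r^Q≈ = x+y≈0⇒x≈y (trans (sym (+-assoc _ _ _)) (x*y≈0⇒y≈0 (*-≉0 e≉0 (*-≉0 σ≉0 (^-≉0 (2 ℕ.^ l) σ≉0)))
          (trans (sym (φ∧φ≈ w h r rσ≈Y)) φ∧φ≈0)))

    -- The polar form of β is E (w ∧ h), so β cannot vanish at 1, h and 1 + h all at once.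
    β-nonvanishing : ∃ λ w → ¬ β d a b c w ≈ 0#
    β-nonvanishing = by (independent {1#} (λ 1≈0 → 0≉1 (sym 1≈0)))
      where
      by : (∃ λ h → ¬ 1# ∧ h ≈ 0#) → ∃ λ w → ¬ β d a b c w ≈ 0#
      by (h , σ≉0) = zero-or-unit (β d a b c 1#)
        (λ β1≈0 → zero-or-unit (β d a b c h)
          (λ βh≈0 → 1# + h , λ β≈0 → *-≉0 e≉0 σ≉0 (begin
            E * (1# ∧ h)                                           ≈⟨ P.solve 3 (λ x y z → z P.⊜ x P.⊕ y P.⊕ z P.⊕ x P.⊕ y) refl (β d a b c 1#) (β d a b c h) _ ⟩
            β d a b c 1# + β d a b c h + E * (1# ∧ h) + β d a b c 1# + β d a b c h
              ≈⟨ +-cong (+-cong (solve 6 (λ d a b c w h → :β d a b c w ⊕ :β d a b c h ⊕ :e d a b c ⊗ (w :∧ h) ⊜ :β d a b c (w ⊕ h)) refl d a b c 1# h) refl) refl ⟩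
            β d a b c (1# + h) + β d a b c 1# + β d a b c h        ≈⟨ +-cong (+-cong β≈0 β1≈0) βh≈0 ⟩
            0# + 0# + 0#                                           ≈⟨ trans (+-identityʳ _) (+-identityʳ _) ⟩
            0#                                                     ∎))
          (λ βh≉0 → h , βh≉0))
        (λ β1≉0 → 1# , β1≉0)

    -- Every r with r̄ = r + 1 is attained, by solving r (w ∧ h) = Y w h for h.
    collision : ∀ r → conj r ≈ r + 1# → frob l r ≈ r + (1# + t) → ¬ LineInjective (φ d a b c)
    collision r r̄≈ r^Q≈ φ-inj = by β-nonvanishing
      where
      by : ¬ (∃ λ w → ¬ β d a b c w ≈ 0#)
      by (w , β≉0) = σ≉0 (φ-inj w h (trans (φ∧φ≈ w h r rσ≈Y) (trans (*-congˡ
          (trans (+-assoc _ _ _) (x≈y⇒x+y≈0 r^Q≈))) (zeroʳ _))))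
        where
        -- Given r̄ = r + 1, the equation r (w ∧ h) = Y w h reads h̄ x = h x̄ with x = r̄ w + θ̄ w̄,
        -- so h = x solves it.
        h = conj r * w + conj θ * conj w
        Tr≈1 : T r ≈ 1#
        Tr≈1 = trans (+-congˡ r̄≈) (P.solve 1 (λ r → r P.⊕ (r P.⊕ P.:1) P.⊜ P.:1) refl r)
        σ≉0 : ¬ w ∧ h ≈ 0#
        σ≉0 σ≈0 = β≉0 (begin
          β d a b c w              ≈⟨ B≈E*B w w Eθ≈U ⟩
          E * B 1# θ w w           ≈⟨ *-congˡ (+-congʳ (*-congʳ Tr≈1)) ⟨
          E * B (T r) θ w w        ≈⟨ *-congˡ (solve 3 (λ r θ w → :B (:T r) θ w w ⊜ w :∧ (r ⁻ ⊗ w ⊕ θ ⁻ ⊗ w ⁻)) refl r θ w) ⟩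
          E * (w ∧ h)              ≈⟨ trans (*-congˡ σ≈0) (zeroʳ E) ⟩
          0#                       ∎)
        rσ≈Y : r * (w ∧ h) ≈ Y w h
        rσ≈Y = begin
          r * (w ∧ h)              ≈⟨ solve 3 (λ r θ w → r ⊗ (w :∧ (r ⁻ ⊗ w ⊕ θ ⁻ ⊗ w ⁻)) ⊜ :B (:T r) θ w (r ⁻ ⊗ w ⊕ θ ⁻ ⊗ w ⁻)) refl r θ w ⟩
          B (T r) θ w h            ≈⟨ +-congʳ (*-congʳ Tr≈1) ⟩
          B 1# θ w h               ∎

    -- This is `NU+NV` divided by E². It makes y + y^Q + t a root of X² + X whenever y² + y = N θ.
    Nθ+Nθ^Q≈t+t² : N θ + frob l (N θ) ≈ t + t * t
    Nθ+Nθ^Q≈t+t² = *-cancelˡ (*-≉0 e≉0 e≉0) (begin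
      E * E * (N θ + frob l (N θ))
        ≈⟨ *-congˡ (+-congˡ (frob-N l θ)) ⟩
      E * E * (N θ + N θ′)
        ≈⟨ *-congʳ (*-congˡ (sym E-fixed)) ⟩
      E * conj E * (N θ + N θ′)
        ≈⟨ solve 3 (λ E x y → E ⊗ E ⁻ ⊗ (:N x ⊕ :N y) ⊜ :N (E ⊗ x) ⊕ :N (E ⊗ y)) refl E θ θ′ ⟩
      N (E * θ) + N (E * θ′)
        ≈⟨ +-cong (N-cong Eθ≈U) (N-cong Eθ^Q≈V) ⟩
      N (U d a b c) + N (V d a b c)
        ≈⟨ NU+NV d a b c ⟩
      (N d + N a) * (N b + N c)
        ≈⟨ *-cong E[1+t]≈ et≈ ⟨
      E * (1# + t) * (E * t)
        ≈⟨ P.solve 2 (λ E t → E P.⊗ (P.:1 P.⊕ t) P.⊗ (E P.⊗ t) P.⊜ E P.⊗ E P.⊗ (t P.⊕ t P.⊗ t)) refl E t ⟩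
      E * E * (t + t * t) ∎)
      where θ′ = frob l θ

    frob-multiple : ∀ {r} → frob m r ≈ r + 1# → ∀ j → frob (j ℕ.* m) r ≈ r + count j
    frob-multiple {r} r^M≈ zero    = trans (*-identityʳ r) (sym (+-identityʳ r))
    frob-multiple {r} r^M≈ (suc j) = begin
      frob (suc j ℕ.* m) r                       ≈⟨ trans (frob-1+ j r) (frob-cong (j ℕ.* m) r^M≈) ⟩
      frob (j ℕ.* m) (r + 1#)                    ≈⟨ trans (frob-+ (j ℕ.* m) r 1#) (+-cong (frob-multiple r^M≈ j) (frob-1 (j ℕ.* m))) ⟩
      r + count j + 1#                           ≈⟨ +-assoc _ _ _ ⟩
      r + count (suc j)                          ∎

    -- The trace of 1 to the field of 2^m elements is n + n = 0. The solution moves by `n` under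
    -- `conj` and by `n′` under `frob l`, which makes it the correction term for the two bits.
    artin-schreier : ∃ λ r → frob m r ≈ r + 1#
    artin-schreier = hilbert90 m (n ℕ.+ n) (≡.trans (ℕₚ.*-distribʳ-+ m n n) (≡.sym (≡.cong₂ ℕ._+_ k≡nm k≡nm))) 1#
      (trans (∑<-cong (n ℕ.+ n) (λ i _ → frob-1 (i ℕ.* m))) (trans (∑<-split n n (λ _ → 1#)) (x+x≈0 (count n))))

    -- Adding α r, with r from `artin-schreier`, changes ν by α n and ε by α n′; once both bits are
    -- 1, `collision` applies.
    adjust : ∀ {y ν ε α} → Constant α → conj y ≈ y + ν → frob l y ≈ y + (ε + t) →
             ν + α * count n ≈ 1# → ε + α * count n′ ≈ 1# → ¬ LineInjective (φ d a b c)
    adjust {y} {ν} {ε} {α} α-const ȳ≈ y^Q≈ ν+≈1 ε+≈1 = by artin-schreier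
      where
      by : (∃ λ r → frob m r ≈ r + 1#) → ¬ LineInjective (φ d a b c)
      by (r , r^M≈) = collision (y + α * r)
        (begin
          conj (y + α * r)                          ≈⟨ trans (frob-+ k _ _) (+-cong ȳ≈ (trans (frob-* k α r) (*-cong (α-const k) (trans (sym (frob-k r)) (frob-multiple r^M≈ n))))) ⟩
          y + ν + α * (r + count n)                 ≈⟨ P.solve 5 (λ y ν α r n → y P.⊕ ν P.⊕ α P.⊗ (r P.⊕ n) P.⊜ y P.⊕ α P.⊗ r P.⊕ (ν P.⊕ α P.⊗ n)) refl y ν α r (count n) ⟩
          y + α * r + (ν + α * count n)             ≈⟨ +-congˡ ν+≈1 ⟩
          y + α * r + 1#                            ∎)
        (begin
          frob l (y + α * r)                        ≈⟨ trans (frob-+ l _ _) (+-cong y^Q≈ (trans (frob-* l α r) (*-cong (α-const l) (trans (sym (frob-l r)) (frob-multiple r^M≈ n′))))) ⟩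
          y + (ε + t) + α * (r + count n′)          ≈⟨ P.solve 6 (λ y ε t α r n → y P.⊕ (ε P.⊕ t) P.⊕ α P.⊗ (r P.⊕ n) P.⊜ y P.⊕ α P.⊗ r P.⊕ (ε P.⊕ α P.⊗ n P.⊕ t)) refl y ε t α r (count n′) ⟩
          y + α * r + (ε + α * count n′ + t)        ≈⟨ +-congˡ (+-congʳ ε+≈1) ⟩
          y + α * r + (1# + t)                      ∎)

    1+0∨1 : ∀ {x} → x ≈ 0# ⊎ x ≈ 1# → 1# + x ≈ 0# ⊎ 1# + x ≈ 1#
    1+0∨1 (inj₁ x≈0) = inj₂ (trans (+-congˡ x≈0) (+-identityʳ 1#))
    1+0∨1 (inj₂ x≈1) = inj₁ (trans (+-congˡ x≈1) (x+x≈0 1#))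

    -- By opposite parity the trace of t is a single bit, ν or ε, namely the one that `adjust`
    -- cannot change. If it is 1, the other bit can be made 1 too.
    trace≈0 : (count n ≈ 0# × count n′ ≈ 1#) ⊎ (count n ≈ 1# × count n′ ≈ 0#) → LineInjective (φ d a b c) → Trₘ t ≈ 0#
    trace≈0 parity φ-inj = by (trace-0-over-𝔽₂ (conj-N θ))
      where
      by : (∃ λ y → y * y ≈ y + N θ) → Trₘ t ≈ 0#
      by (y , yy≈) = zero-or-unit (Trₘ t) id λ Tr≉0 → contradiction φ-inj (not-injective Tr≉0 parity)
        where
        ν ε : Carrier
        ν = T y
        ε = t + frob l y + y
        ν-bit : ν ≈ 0# ⊎ ν ≈ 1#
        ν-bit = T-root (conj-N θ) yy≈
        ε-bit : ε ≈ 0# ⊎ ε ≈ 1#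
        ε-bit = x*x≈x⇒x≈0∨x≈1 (begin
          ε * ε
            ≈⟨ P.solve 3 (λ t y y′ → (t P.⊕ y′ P.⊕ y) P.⊗ (t P.⊕ y′ P.⊕ y) P.⊜ t P.⊗ t P.⊕ y′ P.⊗ y′ P.⊕ y P.⊗ y) refl t y (frob l y) ⟩
          t * t + frob l y * frob l y + y * y
            ≈⟨ +-cong (+-congˡ (trans (sym (frob-* l y y)) (trans (frob-cong l yy≈) (frob-+ l y (N θ))))) yy≈ ⟩
          t * t + (frob l y + frob l (N θ)) + (y + N θ)
            ≈⟨ P.solve 5 (λ t y′ s′ y s → t P.⊗ t P.⊕ (y′ P.⊕ s′) P.⊕ (y P.⊕ s) P.⊜ t P.⊗ t P.⊕ (s P.⊕ s′) P.⊕ y′ P.⊕ y) refl t (frob l y) (frob l (N θ)) y (N θ) ⟩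
          t * t + (N θ + frob l (N θ)) + frob l y + y
            ≈⟨ +-congʳ (+-congʳ (+-congˡ Nθ+Nθ^Q≈t+t²)) ⟩
          t * t + (t + t * t) + frob l y + y
            ≈⟨ +-congʳ (+-congʳ (P.solve 1 (λ t → t P.⊗ t P.⊕ (t P.⊕ t P.⊗ t) P.⊜ t) refl t)) ⟩
          ε ∎)
        ȳ≈ : conj y ≈ y + ν
        ȳ≈ = P.solve 2 (λ y z → z P.⊜ y P.⊕ (y P.⊕ z)) refl y (conj y)
        y^Q≈ : frob l y ≈ y + (ε + t)
        y^Q≈ = P.solve 3 (λ t y z → z P.⊜ y P.⊕ (t P.⊕ z P.⊕ y P.⊕ t)) refl t y (frob l y)
        Tr≈ : Trₘ t ≈ ε * count n + ν * count n′
        Tr≈ = Trₘ-cocycle (0∨1⇒constant ν-bit) (0∨1⇒constant ε-bit) ȳ≈ y^Q≈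
        nonzero-bit : ∀ {x} → x ≈ 0# ⊎ x ≈ 1# → ¬ x ≈ 0# → x ≈ 1#
        nonzero-bit (inj₁ x≈0) x≉0 = contradiction x≈0 x≉0
        nonzero-bit (inj₂ x≈1) x≉0 = x≈1
        x*0+y*1 : ∀ {x y u v} → u ≈ 0# → v ≈ 1# → x * u + y * v ≈ y
        x*0+y*1 u≈0 v≈1 = trans (+-cong (trans (*-congˡ u≈0) (zeroʳ _)) (trans (*-congˡ v≈1) (*-identityʳ _))) (+-identityˡ _)
        x+y*0 : ∀ {x y u} → u ≈ 0# → x + y * u ≈ x
        x+y*0 u≈0 = trans (+-congˡ (trans (*-congˡ u≈0) (zeroʳ _))) (+-identityʳ _)
        x+[1+x]*1 : ∀ {x u} → u ≈ 1# → x + (1# + x) * u ≈ 1#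
        x+[1+x]*1 {x} u≈1 = trans (+-congˡ (trans (*-congˡ u≈1) (*-identityʳ _))) (P.solve 1 (λ x → x P.⊕ (P.:1 P.⊕ x) P.⊜ P.:1) refl x)
        not-injective : ¬ Trₘ t ≈ 0# → (count n ≈ 0# × count n′ ≈ 1#) ⊎ (count n ≈ 1# × count n′ ≈ 0#) → ¬ LineInjective (φ d a b c)
        -- Here the trace is ν, so ν is already 1, and α = 1 + ε brings ε to 1; in the other case
        -- the roles are exchanged.
        not-injective Tr≉0 (inj₁ (n≈0 , n′≈1)) = adjust (0∨1⇒constant (1+0∨1 ε-bit)) ȳ≈ y^Q≈
          (trans (x+y*0 n≈0) (nonzero-bit ν-bit λ ν≈0 → Tr≉0 (trans Tr≈ (trans (x*0+y*1 n≈0 n′≈1) ν≈0))))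
          (x+[1+x]*1 n′≈1)
        not-injective Tr≉0 (inj₂ (n≈1 , n′≈0)) = adjust (0∨1⇒constant (1+0∨1 ν-bit)) ȳ≈ y^Q≈
          (x+[1+x]*1 n≈1)
          (trans (x+y*0 n′≈0) (nonzero-bit ε-bit λ ε≈0 → Tr≉0 (trans Tr≈ (trans (+-comm _ _) (trans (x*0+y*1 n′≈0 n≈1) ε≈0)))))

-- From the polynomial to the form

module PolynomialEvaluation {c ℓ} (R : CommutativeRing c ℓ) where
  open CommutativeRing R hiding (zero)
  open Polynomials R
  open SemiringExp semiring using (_^_)
  open CommutativeSemigroupProperties +-commutativeSemigroup using () renaming (interchange to +-interchange)
  open CommutativeSemigroupProperties *-commutativeSemigroup using () renaming (x∙yz≈y∙xz to x*yz≈y*xz)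
  open SetoidReasoning setoid

  eval-con : ∀ a x → eval (con a) x ≈ a
  eval-con a x = trans (+-congˡ (zeroʳ x)) (+-identityʳ a)

  eval-X : ∀ x → eval X x ≈ x
  eval-X x = trans (+-identityˡ _) (trans (*-congˡ (eval-con 1# x)) (*-identityʳ x))

  eval-⊕ : ∀ p q x → eval (p ⊕ q) x ≈ eval p x + eval q x
  eval-⊕ []      q       x = sym (+-identityˡ _)
  eval-⊕ (a ∷ p) []      x = sym (+-identityʳ _)
  eval-⊕ (a ∷ p) (b ∷ q) x = begin
    a + b + x * eval (p ⊕ q) x                ≈⟨ +-congˡ (trans (*-congˡ (eval-⊕ p q x)) (distribˡ x _ _)) ⟩
    a + b + (x * eval p x + x * eval q x)     ≈⟨ +-interchange a b _ _ ⟩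
    eval (a ∷ p) x + eval (b ∷ q) x           ∎

  eval-map : ∀ a q x → eval (List.map (a *_) q) x ≈ a * eval q x
  eval-map a []      x = sym (zeroʳ a)
  eval-map a (b ∷ q) x = begin
    a * b + x * eval (List.map (a *_) q) x    ≈⟨ +-congˡ (trans (*-congˡ (eval-map a q x)) (x*yz≈y*xz x a _)) ⟩
    a * b + a * (x * eval q x)                ≈⟨ distribˡ a b _ ⟨
    a * eval (b ∷ q) x                        ∎

  eval-⊗ : ∀ p q x → eval (p ⊗ q) x ≈ eval p x * eval q x
  eval-⊗ []      q x = sym (zeroˡ _)
  eval-⊗ (a ∷ p) q x = begin
    eval (List.map (a *_) q ⊕ (0# ∷ (p ⊗ q))) x           ≈⟨ eval-⊕ (List.map (a *_) q) _ x ⟩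
    eval (List.map (a *_) q) x + (0# + x * eval (p ⊗ q) x)
      ≈⟨ +-cong (eval-map a q x) (trans (+-identityˡ _) (trans (*-congˡ (eval-⊗ p q x)) (sym (*-assoc x _ _)))) ⟩
    a * eval q x + x * eval p x * eval q x                ≈⟨ distribʳ _ a _ ⟨
    eval (a ∷ p) x * eval q x                             ∎

  eval-^ₚ : ∀ p n x → eval (p ^ₚ n) x ≈ eval p x ^ n
  eval-^ₚ p zero    x = eval-con 1# x
  eval-^ₚ p (suc n) x = trans (eval-⊗ p (p ^ₚ n) x) (*-congˡ (eval-^ₚ p n x))

  eval-∘ₚ : ∀ p q x → eval (p ∘ₚ q) x ≈ eval p (eval q x)
  eval-∘ₚ []      q x = refl
  eval-∘ₚ (a ∷ p) q x = begin
    eval (con a ⊕ q ⊗ (p ∘ₚ q)) x             ≈⟨ eval-⊕ (con a) (q ⊗ (p ∘ₚ q)) x ⟩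
    eval (con a) x + eval (q ⊗ (p ∘ₚ q)) x    ≈⟨ +-cong (eval-con a x) (trans (eval-⊗ q _ x) (*-congˡ (eval-∘ₚ p q x))) ⟩
    eval (a ∷ p) (eval q x)                   ∎

-- Parity of k/m and ℓ/m

Even Odd : ℕ → Set
Even n = ∃ λ i → n ≡ i ℕ.+ i
Odd  n = ∃ λ i → n ≡ suc (i ℕ.+ i)

parity : ∀ n → Even n ⊎ Odd n
parity zero    = inj₁ (0 , ≡.refl)
parity (suc n) with parity n
... | inj₁ (i , n≡) = inj₂ (i , ≡.cong suc n≡)
... | inj₂ (i , n≡) = inj₁ (suc i , ≡.cong suc (≡.trans n≡ (≡.sym (ℕₚ.+-suc i i))))

-- Induction by M² (M^i + 1) = (M² - 1) + (M^(i+2) + 1), with M = p + 1 so that M² - 1 is written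
-- without subtraction.
M+1∣M^odd+1 : ∀ p i → suc p ℕ.+ 1 ∣ suc p ℕ.^ suc (i ℕ.+ i) ℕ.+ 1
M+1∣M^odd+1 p zero    = ≡.subst (λ n → suc p ℕ.+ 1 ∣ n ℕ.+ 1) (≡.sym (ℕₚ.*-identityʳ (suc p))) ∣-refl
M+1∣M^odd+1 p (suc i) = ≡.subst (λ n → M ℕ.+ 1 ∣ M ℕ.^ suc n ℕ.+ 1) (≡.cong suc (≡.sym (ℕₚ.+-suc i i)))
  (∣m+n∣m⇒∣n (≡.subst (M ℕ.+ 1 ∣_) (identity p (M ℕ.^ suc (i ℕ.+ i))) (∣-trans (M+1∣M^odd+1 p i) (n∣m*n (M ℕ.* M)))) (n∣m*n p))
  where
  M = suc p
  identity : ∀ p x → suc p ℕ.* suc p ℕ.* (x ℕ.+ 1) ≡ p ℕ.* (suc p ℕ.+ 1) ℕ.+ (suc p ℕ.* (suc p ℕ.* x) ℕ.+ 1)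
  identity = solve-∀

module CofactorParity (k ℓ : ℕ) .{{_ : NonZero k}} where
  m : ℕ
  m = 2 ℕ.^ ord₂ (gcd k ℓ)

  m∣k : m ∣ k
  m∣k = 2^ord₂[gcd]∣ˡ k ℓ

  m∣ℓ : m ∣ ℓ
  m∣ℓ = ∣-trans (ord₂-divides (gcd k ℓ)) (gcd[m,n]∣n k ℓ)

  n n′ : ℕ
  n  = quotient m∣k
  n′ = quotient m∣ℓ

  k≡nm : k ≡ n ℕ.* m
  k≡nm = _∣_.equality m∣k

  ℓ≡n′m : ℓ ≡ n′ ℕ.* m
  ℓ≡n′m = _∣_.equality m∣ℓ

  -- Otherwise 2m would be a power of 2 that divides the gcd, against the maximality of `ord₂`.
  not-both-even : Even n → ¬ Even n′
  not-both-even n-even n′-even = ℕₚ.1+n≰n (ord₂-greatest (gcd k ℓ) {{ℕ.≢-nonZero gcd≢0}} (suc (ord₂ (gcd k ℓ)))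
    (gcd-greatest (2m∣ k≡nm n-even) (2m∣ ℓ≡n′m n′-even)))
    where
    gcd≢0 : gcd k ℓ ≢ 0
    gcd≢0 = gcd[m,n]≢0 k ℓ (inj₁ (ℕ.≢-nonZero⁻¹ k))
    2m∣ : ∀ {x y} → x ≡ y ℕ.* m → Even y → 2 ℕ.* m ∣ x
    2m∣ x≡ (j , y≡) = divides j (≡.trans x≡ (≡.trans (≡.cong (ℕ._* m) y≡) (identity j m)))
      where
      identity : ∀ j m → (j ℕ.+ j) ℕ.* m ≡ j ℕ.* (2 ℕ.* m)
      identity = solve-∀

  -- For odd cofactors 2^m + 1 divides both Q + 1 and q + 1; this is where their coprimality enters.
  not-both-odd : gcd (2 ℕ.^ ℓ ℕ.+ 1) (2 ℕ.^ k ℕ.+ 1) ≡ 1 → Odd n → ¬ Odd n′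
  not-both-odd coprime n-odd n′-odd = ℕₚ.1+n≰n (ℕₚ.≤-trans 2≤M+1 (ℕₚ.≤-reflexive (∣1⇒≡1 (≡.subst (M ℕ.+ 1 ∣_) coprime
    (gcd-greatest (M+1∣ ℓ≡n′m n′-odd) (M+1∣ k≡nm n-odd))))))
    where
    M = 2 ℕ.^ m
    2≤M+1 : 2 ℕ.≤ M ℕ.+ 1
    2≤M+1 = ℕₚ.+-monoˡ-≤ 1 (ℕₚ.m^n>0 2 m)
    M≡ : M ≡ suc (M ℕ.∸ 1)
    M≡ = ≡.sym (ℕₚ.m+[n∸m]≡n (ℕₚ.m^n>0 2 m))
    M+1∣ : ∀ {x y} → x ≡ y ℕ.* m → Odd y → M ℕ.+ 1 ∣ 2 ℕ.^ x ℕ.+ 1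
    M+1∣ {x} {y} x≡ (j , y≡) = ≡.subst (λ z → M ℕ.+ 1 ∣ z ℕ.+ 1) M^y≡2^x
      (≡.subst (λ N → N ℕ.+ 1 ∣ N ℕ.^ suc (j ℕ.+ j) ℕ.+ 1) (≡.sym M≡) (M+1∣M^odd+1 (M ℕ.∸ 1) j))
      where
      M^y≡2^x : M ℕ.^ suc (j ℕ.+ j) ≡ 2 ℕ.^ x
      M^y≡2^x = ≡.trans (≡.cong (M ℕ.^_) (≡.sym y≡)) (≡.trans (ℕₚ.^-*-assoc 2 m y) (≡.cong (2 ℕ.^_) (≡.trans (ℕₚ.*-comm m y) (≡.sym x≡))))

  opposite-parity : gcd (2 ℕ.^ ℓ ℕ.+ 1) (2 ℕ.^ k ℕ.+ 1) ≡ 1 → (Even n × Odd n′) ⊎ (Odd n × Even n′)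
  opposite-parity coprime = by (parity n) (parity n′)
    where
    by : Even n ⊎ Odd n → Even n′ ⊎ Odd n′ → (Even n × Odd n′) ⊎ (Odd n × Even n′)
    by (inj₁ even) (inj₁ even′) = contradiction even′ (not-both-even even)
    by (inj₁ even) (inj₂ odd′)  = inj₁ (even , odd′)
    by (inj₂ odd)  (inj₁ even′) = inj₂ (odd , even′)
    by (inj₂ odd)  (inj₂ odd′)  = contradiction odd′ (not-both-odd coprime odd)

module Reduction {α β} (k l : ℕ) .{{_ : NonZero k}} (F : FiniteField α β ((2 ℕ.^ k) ℕ.^ 2))
  (u v : ℕ) .{{_ : NonZero u}}
  (u[Q+1]≡1 : u ℕ.* (2 ℕ.^ l ℕ.+ 1) ≡ 1 [mod 2 ℕ.^ k ℕ.+ 1 ])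
  (v[Q+1]≡Q : v ℕ.* (2 ℕ.^ l ℕ.+ 1) ≡ 2 ℕ.^ l [mod 2 ℕ.^ k ℕ.+ 1 ]) where
  open QuadraticField k F
  open PowerSums k F
  open Wedge k F
  open Forms k l F
  open SetoidReasoning setoid
  open Solver using (:0; :1; _⊜_; solve)
  private module P = Plain

  Q : ℕ
  Q = 2 ℕ.^ l

  ^[q+1] : ∀ x → x ^ (q ℕ.+ 1) ≈ N x
  ^[q+1] x = trans (^-homo-* x q 1) (trans (*-comm _ _) (*-congʳ (*-identityʳ x)))

  ^[Q+1] : ∀ x → x ^ (Q ℕ.+ 1) ≈ frob l x * x
  ^[Q+1] x = trans (^-homo-* x Q 1) (*-congˡ (*-identityʳ x))

  x*x^[q-1] : ∀ x → x * x ^ q-1 ≈ conj x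
  x*x^[q-1] x = reflexive (≡.cong (x ^_) (≡.sym q≡1+[q-1]))

  x^[i+jn]≈x^i : ∀ {x} n → x ^ n ≈ 1# → ∀ i j → x ^ (i ℕ.+ j ℕ.* n) ≈ x ^ i
  x^[i+jn]≈x^i {x} n x^n≈1 i j = begin
    x ^ (i ℕ.+ j ℕ.* n)     ≈⟨ ^-homo-* x i (j ℕ.* n) ⟩
    x ^ i * x ^ (j ℕ.* n)   ≈⟨ *-congˡ (trans (reflexive (≡.cong (x ^_) (ℕₚ.*-comm j n))) (trans (sym (^-assocʳ x n j)) (trans (^-congˡ j x^n≈1) (1^m≈1 j)))) ⟩
    x ^ i * 1#              ≈⟨ *-identityʳ _ ⟩
    x ^ i                   ∎

  ∸-divides : ∀ {i j n} → j ℕ.≤ i → n ∣ i ℕ.∸ j → ∃ λ t → i ≡ j ℕ.+ t ℕ.* n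
  ∸-divides {j = j} j≤i (divides t i∸j≡) = t , ≡.trans (≡.sym (ℕₚ.m+[n∸m]≡n j≤i)) (≡.cong (j ℕ.+_) i∸j≡)

  ^-cong-mod : ∀ {x i j} n → x ^ n ≈ 1# → i ≡ j [mod n ] → x ^ i ≈ x ^ j
  ^-cong-mod {x} {i} {j} n x^n≈1 i≡j =
    [ (λ i≤j → sym (reduce (∸-divides i≤j (≡.subst (n ∣_) (ℕₚ.m≤n⇒∣m-n∣≡n∸m i≤j) i≡j))))
    , (λ j≤i → reduce (∸-divides j≤i (≡.subst (n ∣_) (ℕₚ.m≤n⇒∣n-m∣≡n∸m j≤i) i≡j))) ]′ (ℕₚ.≤-total i j)
    where
    reduce : ∀ {i j} → (∃ λ t → i ≡ j ℕ.+ t ℕ.* n) → x ^ i ≈ x ^ j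
    reduce {i} {j} (t , i≡) = trans (reflexive (≡.cong (x ^_) i≡)) (x^[i+jn]≈x^i n x^n≈1 j t)

  [x^[q-1]]^[q+1]≈1 : ∀ {x} → ¬ x ≈ 0# → (x ^ q-1) ^ (q ℕ.+ 1) ≈ 1#
  [x^[q-1]]^[q+1]≈1 {x} x≉0 = trans (^-assocʳ x q-1 (q ℕ.+ 1)) (x^[q²-1]≈1 x≉0)

  u[Q+1]≡1+j[q+1] : ∃ λ j → u ℕ.* (Q ℕ.+ 1) ≡ 1 ℕ.+ j ℕ.* (q ℕ.+ 1)
  u[Q+1]≡1+j[q+1] = ∸-divides 1≤ (≡.subst (q ℕ.+ 1 ∣_) (ℕₚ.m≤n⇒∣n-m∣≡n∸m 1≤) u[Q+1]≡1)
    where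
    -- Positivity of `u` decides the sign of the difference in the congruence, so that the quotient
    -- `j` is a natural number.
    1≤ : 1 ℕ.≤ u ℕ.* (Q ℕ.+ 1)
    1≤ = ℕₚ.*-mono-≤ (ℕ.>-nonZero⁻¹ u) (ℕₚ.m≤n+m 1 Q)

  j : ℕ
  j = proj₁ u[Q+1]≡1+j[q+1]

  N^j : Carrier → Carrier
  N^j x = N x ^ j

  N^j-fixed : ∀ x → conj (N^j x) ≈ N^j x
  N^j-fixed x = trans (^-swap (N x) j q) (^-congˡ j (conj-N x))

  N^j-≉0 : ∀ {x} → ¬ x ≈ 0# → ¬ N^j x ≈ 0#
  N^j-≉0 x≉0 = ^-≉0 j (N-≉0 x≉0)

  x^[u[Q+1]] : ∀ x → x ^ (u ℕ.* (Q ℕ.+ 1)) ≈ N^j x * x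
  x^[u[Q+1]] x = begin
    x ^ (u ℕ.* (Q ℕ.+ 1))            ≡⟨ ≡.cong (x ^_) (proj₂ u[Q+1]≡1+j[q+1]) ⟩
    x * x ^ (j ℕ.* (q ℕ.+ 1))        ≡⟨ ≡.cong (λ n → x * x ^ n) (ℕₚ.*-comm j (q ℕ.+ 1)) ⟩
    x * x ^ ((q ℕ.+ 1) ℕ.* j)        ≈⟨ *-congˡ (trans (sym (^-assocʳ x (q ℕ.+ 1) j)) (^-congˡ j (^[q+1] x))) ⟩
    x * N^j x                        ≈⟨ *-comm _ _ ⟩
    N^j x * x                        ∎

  fixed-^ : ∀ {s} i → conj s ≈ s → conj (s ^ i) ≈ s ^ i
  fixed-^ {s} i s-fixed = trans (^-swap s i q) (^-congˡ i s-fixed)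

  ∧-scale : ∀ {s t} x y → conj s ≈ s → conj t ≈ t → (s * x) ∧ (t * y) ≈ s * t * (x ∧ y)
  ∧-scale {s} {t} x y s-fixed t-fixed = begin
    s * x * conj (t * y) + conj (s * x) * (t * y)
      ≈⟨ +-cong (*-congˡ (trans (frob-* k t y) (*-congʳ t-fixed))) (*-congʳ (trans (frob-* k s x) (*-congʳ s-fixed))) ⟩
    s * x * (t * conj y) + s * conj x * (t * y)
      ≈⟨ P.solve 6 (λ s t x y x̄ ȳ → s P.⊗ x P.⊗ (t P.⊗ ȳ) P.⊕ s P.⊗ x̄ P.⊗ (t P.⊗ y) P.⊜ s P.⊗ t P.⊗ (x P.⊗ ȳ P.⊕ x̄ P.⊗ y)) refl s t x y (conj x) (conj y) ⟩
    s * t * (x ∧ y) ∎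

  -- Raising to the power u (Q + 1) fixes every line.
  powers-dependent⇒dependent : ∀ {x y s} → ¬ x ≈ 0# → ¬ y ≈ 0# → conj s ≈ s →
    y ^ (u ℕ.* (Q ℕ.+ 1)) ≈ s * x ^ (u ℕ.* (Q ℕ.+ 1)) → x ∧ y ≈ 0#
  powers-dependent⇒dependent {x} {y} {s} x≉0 y≉0 s-fixed eq = x*y≈0⇒y≈0 (*-≉0 (N^j-≉0 x≉0) (N^j-≉0 y≉0)) (begin
    N^j x * N^j y * (x ∧ y)                ≈⟨ ∧-scale x y (N^j-fixed x) (N^j-fixed y) ⟨
    (N^j x * x) ∧ (N^j y * y)              ≈⟨ ∧-cong (sym (*-identityˡ _)) (trans (sym (x^[u[Q+1]] y)) (trans eq (*-congˡ (x^[u[Q+1]] x)))) ⟩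
    (1# * (N^j x * x)) ∧ (s * (N^j x * x)) ≈⟨ ∧-scale _ _ (frob-1 k) s-fixed ⟩
    1# * s * ((N^j x * x) ∧ (N^j x * x))   ≈⟨ trans (*-congˡ (x∧x≈0 _)) (zeroʳ _) ⟩
    0#                                     ∎)

  module _ (a b c : Carrier) where

    A f : Carrier → Carrier
    A y = 1# + a * y + b * y ^ v + c * y ^ u
    f x = x * A (x ^ q-1)

    A-cong : ∀ {x y} → x ≈ y → A x ≈ A y
    A-cong x≈y = +-cong (+-cong (+-congˡ (*-congˡ x≈y)) (*-congˡ (^-congˡ v x≈y))) (*-congˡ (^-congˡ u x≈y))

    f-cong : ∀ {x y} → x ≈ y → f x ≈ f y
    f-cong x≈y = *-cong x≈y (A-cong (^-congˡ q-1 x≈y))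

    f-0 : ∀ {x} → x ≈ 0# → f x ≈ 0#
    f-0 x≈0 = trans (*-congʳ x≈0) (zeroˡ _)

    f-homogeneous : ∀ {s} x → conj s ≈ s → ¬ s ≈ 0# → f (s * x) ≈ s * f x
    f-homogeneous {s} x s-fixed s≉0 = trans (*-assoc _ _ _) (*-congˡ (*-congˡ (A-cong
      (trans (^-distrib-* s x q-1) (trans (*-congʳ (s^q-1≈1 s-fixed s≉0)) (*-identityˡ _))))))

    -- For w nonzero, x = w^(q-1) satisfies x^(q+1) = 1, so the congruences make the `u`-th and
    -- `v`-th powers of x^(Q+1) equal to x and x^Q. Multiplication by these conjugates w and w^Q
    -- respectively.
    f[w^[Q+1]] : ∀ w → f (w ^ (Q ℕ.+ 1)) ≈ φ 1# a b c w
    f[w^[Q+1]] w = zero-or-unit w at-0 at-unit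
      where
      z = frob l w
      at-0 : w ≈ 0# → f (w ^ (Q ℕ.+ 1)) ≈ φ 1# a b c w
      at-0 w≈0 = trans (f-0 (trans (^[Q+1] w) (trans (*-congˡ w≈0) (zeroʳ _)))) (sym (trans
        (Φ-cong 1# a b c (trans (frob-cong l w≈0) (frob-0 l)) w≈0)
        (solve 3 (λ a b c → :Φ :1 a b c :0 :0 ⊜ :0) refl a b c)))
      at-unit : ¬ w ≈ 0# → f (w ^ (Q ℕ.+ 1)) ≈ φ 1# a b c w
      at-unit w≉0 = begin
        w ^ (Q ℕ.+ 1) * A ((w ^ (Q ℕ.+ 1)) ^ q-1)
          ≈⟨ *-cong (^[Q+1] w) (A-cong (^-swap w (Q ℕ.+ 1) q-1)) ⟩
        z * w * A (x ^ (Q ℕ.+ 1))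
          ≈⟨ *-congˡ (+-cong (+-cong (+-congˡ (*-congˡ (^[Q+1] x))) (*-congˡ (power v v[Q+1]≡Q)))
               (*-congˡ (trans (power u u[Q+1]≡1) (*-identityʳ x)))) ⟩
        z * w * (1# + a * (frob l x * x) + b * frob l x + c * x)
          ≈⟨ P.solve 7 (λ a b c z w x′ x → z P.⊗ w P.⊗ (P.:1 P.⊕ a P.⊗ (x′ P.⊗ x) P.⊕ b P.⊗ x′ P.⊕ c P.⊗ x) P.⊜
               P.:1 P.⊗ (z P.⊗ w) P.⊕ a P.⊗ (z P.⊗ x′ P.⊗ (w P.⊗ x)) P.⊕ b P.⊗ (z P.⊗ x′ P.⊗ w) P.⊕ c P.⊗ (z P.⊗ (w P.⊗ x))) refl a b c z w (frob l x) x ⟩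
        1# * (z * w) + a * (z * frob l x * (w * x)) + b * (z * frob l x * w) + c * (z * (w * x))
          ≈⟨ +-cong (+-cong (+-congˡ (*-congˡ (*-cong zx≈ wx≈))) (*-congˡ (*-congʳ zx≈))) (*-congˡ (*-congˡ wx≈)) ⟩
        φ 1# a b c w ∎
        where
        x = w ^ q-1
        wx≈ : w * x ≈ conj w
        wx≈ = x*x^[q-1] w
        zx≈ : z * frob l x ≈ conj z
        zx≈ = trans (sym (frob-* l w x)) (trans (frob-cong l wx≈) (frob-conj l w))
        power : ∀ i {t} → i ℕ.* (Q ℕ.+ 1) ≡ t [mod q ℕ.+ 1 ] → (x ^ (Q ℕ.+ 1)) ^ i ≈ x ^ t
        power i i[Q+1]≡t = trans (^-assocʳ x (Q ℕ.+ 1) i) (trans (reflexive (≡.cong (x ^_) (ℕₚ.*-comm (Q ℕ.+ 1) i)))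
          (^-cong-mod {x} {i ℕ.* (Q ℕ.+ 1)} (q ℕ.+ 1) ([x^[q-1]]^[q+1]≈1 w≉0) i[Q+1]≡t))

    -- Homogeneity moves the scalar between dependent values of `f` into the argument, and the
    -- `u`-th power undoes w ↦ w^(Q+1) up to a factor in 𝔽_q.
    f-injective⇒φ-lineInjective : (∀ {x y} → f x ≈ f y → x ≈ y) → LineInjective (φ 1# a b c)
    f-injective⇒φ-lineInjective f-inj w₁ w₂ φ∧φ≈0 = zero-or-unit w₁ 0∧x≈0 λ w₁≉0 →
      zero-or-unit w₂ (λ w₂≈0 → trans (∧-comm w₁ w₂) (0∧x≈0 w₂≈0)) λ w₂≉0 →
      by w₁≉0 w₂≉0 (dependent⇒multiple (f-≉0 (^-≉0 (Q ℕ.+ 1) w₁≉0)) (trans (∧-cong (f[w^[Q+1]] w₁) (f[w^[Q+1]] w₂)) φ∧φ≈0))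
      where
      x₁ = w₁ ^ (Q ℕ.+ 1)
      x₂ = w₂ ^ (Q ℕ.+ 1)
      f-≉0 : ∀ {x} → ¬ x ≈ 0# → ¬ f x ≈ 0#
      f-≉0 x≉0 fx≈0 = x≉0 (f-inj (trans fx≈0 (sym (f-0 refl))))
      by : ¬ w₁ ≈ 0# → ¬ w₂ ≈ 0# → (∃ λ s → conj s ≈ s × f x₂ ≈ s * f x₁) → w₁ ∧ w₂ ≈ 0#
      by w₁≉0 w₂≉0 (s , s-fixed , fx₂≈) = powers-dependent⇒dependent w₁≉0 w₂≉0 (fixed-^ u s-fixed) (begin
        w₂ ^ (u ℕ.* (Q ℕ.+ 1))           ≡⟨ ≡.cong (w₂ ^_) (ℕₚ.*-comm u (Q ℕ.+ 1)) ⟩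
        w₂ ^ ((Q ℕ.+ 1) ℕ.* u)           ≈⟨ ^-assocʳ w₂ (Q ℕ.+ 1) u ⟨
        x₂ ^ u                           ≈⟨ ^-congˡ u (f-inj (trans fx₂≈ (sym (f-homogeneous x₁ s-fixed s≉0)))) ⟩
        (s * x₁) ^ u                     ≈⟨ ^-distrib-* s x₁ u ⟩
        s ^ u * x₁ ^ u                   ≈⟨ *-congˡ (^-assocʳ w₁ (Q ℕ.+ 1) u) ⟩
        s ^ u * w₁ ^ ((Q ℕ.+ 1) ℕ.* u)   ≡⟨ ≡.cong (λ i → s ^ u * w₁ ^ i) (ℕₚ.*-comm (Q ℕ.+ 1) u) ⟩
        s ^ u * w₁ ^ (u ℕ.* (Q ℕ.+ 1))   ∎)
        where
        s≉0 : ¬ s ≈ 0#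
        s≉0 s≈0 = f-≉0 (^-≉0 (Q ℕ.+ 1) w₂≉0) (trans fx₂≈ (trans (*-congʳ s≈0) (zeroˡ _)))

    -- Up to a factor in 𝔽_q, `x ^ u` is a (Q+1)-st root of `x`, so every line is reached by the
    -- substitution.
    φ[x^u] : ∀ {x} → ¬ x ≈ 0# → φ 1# a b c (x ^ u) ≈ N^j x * f x
    φ[x^u] {x} x≉0 = begin
      φ 1# a b c (x ^ u)            ≈⟨ f[w^[Q+1]] (x ^ u) ⟨
      f ((x ^ u) ^ (Q ℕ.+ 1))       ≈⟨ f-cong (trans (^-assocʳ x u (Q ℕ.+ 1)) (x^[u[Q+1]] x)) ⟩
      f (N^j x * x)                 ≈⟨ f-homogeneous x (N^j-fixed x) (N^j-≉0 x≉0) ⟩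
      N^j x * f x                   ∎

    φ-lineInjective⇒f-injective : LineInjective (φ 1# a b c) → ∀ {x y} → f x ≈ f y → x ≈ y
    φ-lineInjective⇒f-injective φ-inj {x} {y} fx≈fy = zero-or-unit x
      (λ x≈0 → zero-or-unit y (λ y≈0 → trans x≈0 (sym y≈0)) (λ y≉0 → contradiction (trans (sym fx≈fy) (f-0 x≈0)) (f-≉0 y≉0)))
      (λ x≉0 → zero-or-unit y (λ y≈0 → contradiction (trans fx≈fy (f-0 y≈0)) (f-≉0 x≉0)) (λ y≉0 → both x≉0 y≉0))
      where
      f-≉0 : ∀ {x} → ¬ x ≈ 0# → ¬ f x ≈ 0#
      f-≉0 x≉0 fx≈0 = lineInjective⇒≉0 φ-inj (^-≉0 u x≉0) (trans (φ[x^u] x≉0) (trans (*-congˡ fx≈0) (zeroʳ _)))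
      both : ¬ x ≈ 0# → ¬ y ≈ 0# → x ≈ y
      both x≉0 y≉0 = by (dependent⇒multiple (^-≉0 u x≉0) (φ-inj (x ^ u) (y ^ u) (begin
          φ 1# a b c (x ^ u) ∧ φ 1# a b c (y ^ u)   ≈⟨ ∧-cong (φ[x^u] x≉0) (φ[x^u] y≉0) ⟩
          (N^j x * f x) ∧ (N^j y * f y)             ≈⟨ ∧-scale _ _ (N^j-fixed x) (N^j-fixed y) ⟩
          N^j x * N^j y * (f x ∧ f y)               ≈⟨ *-congˡ (trans (∧-cong fx≈fy refl) (x∧x≈0 (f y))) ⟩
          N^j x * N^j y * 0#                        ≈⟨ zeroʳ _ ⟩
          0#                                        ∎)))
        where
        by₂ : (∃ λ s → conj s ≈ s × y ≈ s * x) → x ≈ y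
        by₂ (s , s-fixed , y≈sx) = sym (trans y≈sx (trans (*-congʳ s≈1) (*-identityˡ x)))
          where
          s≉0 : ¬ s ≈ 0#
          s≉0 s≈0 = y≉0 (trans y≈sx (trans (*-congʳ s≈0) (zeroˡ x)))
          s≈1 : s ≈ 1#
          s≈1 = *-cancelˡ (f-≉0 x≉0) (begin
            f x * s         ≈⟨ *-comm _ _ ⟩
            s * f x         ≈⟨ f-homogeneous x s-fixed s≉0 ⟨
            f (s * x)       ≈⟨ f-cong y≈sx ⟨
            f y             ≈⟨ fx≈fy ⟨
            f x             ≈⟨ *-identityʳ _ ⟨
            f x * 1#        ∎)
        by : (∃ λ s → conj s ≈ s × y ^ u ≈ s * x ^ u) → x ≈ y
        by (s , s-fixed , y^u≈) = by₂ (dependent⇒multiple x≉0 (powers-dependent⇒dependent x≉0 y≉0 (fixed-^ (Q ℕ.+ 1) s-fixed) (begin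
          y ^ (u ℕ.* (Q ℕ.+ 1))                      ≈⟨ ^-assocʳ y u (Q ℕ.+ 1) ⟨
          (y ^ u) ^ (Q ℕ.+ 1)                        ≈⟨ ^-congˡ (Q ℕ.+ 1) y^u≈ ⟩
          (s * x ^ u) ^ (Q ℕ.+ 1)                    ≈⟨ ^-distrib-* s (x ^ u) (Q ℕ.+ 1) ⟩
          s ^ (Q ℕ.+ 1) * (x ^ u) ^ (Q ℕ.+ 1)        ≈⟨ *-congˡ (^-assocʳ x u (Q ℕ.+ 1)) ⟩
          s ^ (Q ℕ.+ 1) * x ^ (u ℕ.* (Q ℕ.+ 1))      ∎)))

-- Translation of the three conditions and the equivalence

module Conditions {α β} (k ℓ : ℕ) .{{_ : NonZero k}} (coprime : gcd (2 ℕ.^ ℓ ℕ.+ 1) (2 ℕ.^ k ℕ.+ 1) ≡ 1)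
  (F : FiniteField α β ((2 ℕ.^ k) ℕ.^ 2)) (u v : ℕ) .{{_ : NonZero u}}
  (u[Q+1]≡1 : u ℕ.* (2 ℕ.^ ℓ ℕ.+ 1) ≡ 1 [mod 2 ℕ.^ k ℕ.+ 1 ])
  (v[Q+1]≡Q : v ℕ.* (2 ℕ.^ ℓ ℕ.+ 1) ≡ 2 ℕ.^ ℓ [mod 2 ℕ.^ k ℕ.+ 1 ])
  (a b c : FiniteField.Carrier F) where
  open QuadraticField k F
  open RangeSums k F
  open PowerSums k F
  open Wedge k F
  open Forms k ℓ F using (φ; U; V) renaming (e to eᶠ)
  open Necessity k ℓ F using (e≉0; Matched)
  open Matching k ℓ F using (matched; N1≈1)
  open CofactorParity k ℓ
  open TraceCondition k ℓ F m n n′ {{ℕₚ.m^n≢0 2 (ord₂ (gcd k ℓ))}} k≡nm ℓ≡n′m using (Trₘ; count; module MatchedForm)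
  open Reduction k ℓ F u v u[Q+1]≡1 v[Q+1]≡Q using (Q; f; f-cong; ^[q+1]; f-injective⇒φ-lineInjective; φ-lineInjective⇒f-injective)
  open Polynomials commutativeRing using (Poly; Permutes; con; X; eval; _^ₚ_; _∘ₚ_) renaming (_⊕_ to infixl 6 _⊕_; _⊗_ to infixl 7 _⊗_)
  open PolynomialEvaluation commutativeRing
  open SetoidReasoning setoid

  A fₚ : Poly
  A = con 1# ⊕ con a ⊗ X ⊕ con b ⊗ X ^ₚ v ⊕ con c ⊗ X ^ₚ u
  fₚ = X ⊗ (A ∘ₚ (X ^ₚ (q ℕ.∸ 1)))

  e : Carrier
  e = 1# + a ^ (q ℕ.+ 1) + b ^ (q ℕ.+ 1) + c ^ (q ℕ.+ 1)

  eval-fₚ : ∀ x → eval fₚ x ≈ f a b c x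
  eval-fₚ x = trans (eval-⊗ X (A ∘ₚ (X ^ₚ (q ℕ.∸ 1))) x) (*-cong (eval-X x) (trans (eval-∘ₚ A (X ^ₚ (q ℕ.∸ 1)) x) (trans (eval-A _)
    (+-cong (+-cong (+-congˡ (*-congˡ y≈)) (*-congˡ (^-congˡ v y≈))) (*-congˡ (^-congˡ u y≈))))))
    where
    y≈ : eval (X ^ₚ (q ℕ.∸ 1)) x ≈ x ^ (q ℕ.∸ 1)
    y≈ = trans (eval-^ₚ X (q ℕ.∸ 1) x) (^-congˡ (q ℕ.∸ 1) (eval-X x))
    monomial : ∀ d i y → eval (con d ⊗ X ^ₚ i) y ≈ d * y ^ i
    monomial d i y = trans (eval-⊗ (con d) (X ^ₚ i) y) (*-cong (eval-con d y) (trans (eval-^ₚ X i y) (^-congˡ i (eval-X y))))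
    eval-A : ∀ y → eval A y ≈ 1# + a * y + b * y ^ v + c * y ^ u
    eval-A y = trans (eval-⊕ (con 1# ⊕ con a ⊗ X ⊕ con b ⊗ X ^ₚ v) (con c ⊗ X ^ₚ u) y)
      (+-cong (trans (eval-⊕ (con 1# ⊕ con a ⊗ X) (con b ⊗ X ^ₚ v) y)
        (+-cong (trans (eval-⊕ (con 1#) (con a ⊗ X) y) (+-cong (eval-con 1# y) (trans (eval-⊗ (con a) X y) (*-cong (eval-con a y) (eval-X y)))))
                (monomial b v y)))
        (monomial c u y))

  permutes⇒lineInjective : Permutes fₚ → LineInjective (φ 1# a b c)
  permutes⇒lineInjective (eval-inj , _) = f-injective⇒φ-lineInjective a b c
    λ {x} {y} fx≈fy → eval-inj (trans (eval-fₚ x) (trans fx≈fy (sym (eval-fₚ y))))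

  lineInjective⇒permutes : LineInjective (φ 1# a b c) → Permutes fₚ
  lineInjective⇒permutes φ-inj = eval-inj , λ y → surj (field-injective⇒surjective (f-cong a b c) f-inj y)
    where
    f-inj : ∀ {x y} → f a b c x ≈ f a b c y → x ≈ y
    f-inj = φ-lineInjective⇒f-injective a b c φ-inj
    eval-inj : ∀ {x y} → eval fₚ x ≈ eval fₚ y → x ≈ y
    eval-inj {x} {y} eq = f-inj (trans (sym (eval-fₚ x)) (trans eq (eval-fₚ y)))
    surj : ∀ {y} → (∃ λ x → f a b c x ≈ y) → ∃ λ x → ∀ {z} → z ≈ x → eval fₚ z ≈ y
    surj (x , fx≈y) = x , λ {z} z≈x → trans (eval-fₚ z) (trans (f-cong a b c z≈x) fx≈y)

  e≈ : e ≈ eᶠ 1# a b c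
  e≈ = +-cong (+-cong (+-cong (sym N1≈1) (^[q+1] a)) (^[q+1] b)) (^[q+1] c)

  U≈ : a ^ q * b + c ^ q ≈ U 1# a b c
  U≈ = trans (+-comm _ _) (+-congʳ (sym (*-identityˡ _)))

  V≈ : a ^ q * c + b ^ q ≈ V 1# a b c
  V≈ = trans (+-comm _ _) (+-congʳ (sym (*-identityˡ _)))

  Condition₂ : Set _
  Condition₂ = (a ^ q * b + c ^ q) ^ Q ≈ e ^ (Q ℕ.∸ 1) * (a ^ q * c + b ^ q)

  frob-e≈ : frob ℓ (eᶠ 1# a b c) ≈ e * e ^ (Q ℕ.∸ 1)
  frob-e≈ = trans (frob-cong ℓ (sym e≈)) (reflexive (≡.cong (e ^_) (≡.sym (ℕₚ.m+[n∸m]≡n (ℕₚ.m^n>0 2 ℓ)))))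

  matched⇒condition₂ : ¬ e ≈ 0# → Matched 1# a b c → Condition₂
  matched⇒condition₂ e≉0 form-matched = *-cancelˡ e≉0 (begin
    e * (a ^ q * b + c ^ q) ^ Q                      ≈⟨ *-cong e≈ (frob-cong ℓ U≈) ⟩
    eᶠ 1# a b c * frob ℓ (U 1# a b c)                ≈⟨ form-matched ⟩
    frob ℓ (eᶠ 1# a b c) * V 1# a b c                ≈⟨ *-cong frob-e≈ (sym V≈) ⟩
    e * e ^ (Q ℕ.∸ 1) * (a ^ q * c + b ^ q)          ≈⟨ *-assoc _ _ _ ⟩
    e * (e ^ (Q ℕ.∸ 1) * (a ^ q * c + b ^ q))        ∎)

  condition₂⇒matched : Condition₂ → Matched 1# a b c
  condition₂⇒matched eq = begin
    eᶠ 1# a b c * frob ℓ (U 1# a b c)                ≈⟨ *-cong e≈ (frob-cong ℓ U≈) ⟨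
    e * (a ^ q * b + c ^ q) ^ Q                      ≈⟨ *-congˡ eq ⟩
    e * (e ^ (Q ℕ.∸ 1) * (a ^ q * c + b ^ q))        ≈⟨ *-assoc _ _ _ ⟨
    e * e ^ (Q ℕ.∸ 1) * (a ^ q * c + b ^ q)          ≈⟨ *-cong frob-e≈ (sym V≈) ⟨
    frob ℓ (eᶠ 1# a b c) * V 1# a b c                ∎

  count-even : ∀ {i} → Even i → count i ≈ 0#
  count-even (i , ≡.refl) = trans (∑<-split i i (λ _ → 1#)) (x+x≈0 _)

  count-odd : ∀ {i} → Odd i → count i ≈ 1#
  count-odd (i , ≡.refl) = trans (+-congʳ (count-even (i , ≡.refl))) (+-identityˡ 1#)

  counts : (count n ≈ 0# × count n′ ≈ 1#) ⊎ (count n ≈ 1# × count n′ ≈ 0#)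
  counts = by (opposite-parity coprime)
    where
    by : (Even n × Odd n′) ⊎ (Odd n × Even n′) → (count n ≈ 0# × count n′ ≈ 1#) ⊎ (count n ≈ 1# × count n′ ≈ 0#)
    by (inj₁ (even , odd)) = inj₁ (count-even even , count-odd odd)
    by (inj₂ (odd , even)) = inj₂ (count-odd odd , count-even even)

  counts-sum : count n + count n′ ≈ 1#
  counts-sum = [ (λ (n≈0 , n′≈1) → trans (+-cong n≈0 n′≈1) (+-identityˡ 1#))
               , (λ (n≈1 , n′≈0) → trans (+-cong n≈1 n′≈0) (+-identityʳ 1#)) ]′ counts

  Tr≈Trₘ : ∀ x → Tr m∣k x ≈ Trₘ x
  Tr≈Trₘ x = trans (sum≈∑< n (λ i → x ^ ((2 ℕ.^ m) ℕ.^ i))) (∑<-cong n λ i _ → reflexive (≡.cong (x ^_)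
    (≡.trans (ℕₚ.^-*-assoc 2 m i) (≡.cong (2 ℕ.^_) (ℕₚ.*-comm m i)))))

  module _ (e≉0 : ¬ e ≈ 0#) where
    t : Carrier
    t = (b ^ (q ℕ.+ 1) + c ^ (q ℕ.+ 1)) / e ⟨ e≉0 ⟩

    et≈ : eᶠ 1# a b c * t ≈ N b + N c
    et≈ = begin
      eᶠ 1# a b c * t                                          ≈⟨ *-cong (sym e≈) (*-comm _ _) ⟩
      e * (e ⁻¹⟨ e≉0 ⟩ * (b ^ (q ℕ.+ 1) + c ^ (q ℕ.+ 1)))      ≈⟨ *-assoc _ _ _ ⟨
      e * e ⁻¹⟨ e≉0 ⟩ * (b ^ (q ℕ.+ 1) + c ^ (q ℕ.+ 1))        ≈⟨ trans (*-congʳ (inverseʳ e≉0)) (*-identityˡ _) ⟩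
      b ^ (q ℕ.+ 1) + c ^ (q ℕ.+ 1)                            ≈⟨ +-cong (^[q+1] b) (^[q+1] c) ⟩
      N b + N c                                                ∎

    eᶠ≉0 : ¬ eᶠ 1# a b c ≈ 0#
    eᶠ≉0 eᶠ≈0 = e≉0 (trans e≈ eᶠ≈0)

    condition₃ : Matched 1# a b c → LineInjective (φ 1# a b c) → Tr m∣k t ≈ 0#
    condition₃ form-matched φ-inj = trans (Tr≈Trₘ t) (MatchedForm.trace≈0 1# a b c form-matched eᶠ≉0 t et≈ counts φ-inj)

    conditions⇒lineInjective : Condition₂ → Tr m∣k t ≈ 0# → LineInjective (φ 1# a b c)
    conditions⇒lineInjective cond₂ Tr≈0 =
      MatchedForm.lineInjective 1# a b c (condition₂⇒matched cond₂) eᶠ≉0 t et≈ counts-sum (trans (sym (Tr≈Trₘ t)) Tr≈0)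

  necessity : Permutes fₚ → Σ (¬ e ≈ 0#) λ e≉0 → Condition₂ × Tr m∣k (t e≉0) ≈ 0#
  necessity permutes = e≉0′ , matched⇒condition₂ e≉0′ form-matched , condition₃ e≉0′ form-matched φ-inj
    where
    φ-inj : LineInjective (φ 1# a b c)
    φ-inj = permutes⇒lineInjective permutes
    form-matched : Matched 1# a b c
    form-matched = matched 1# a b c φ-inj
    e≉0′ : ¬ e ≈ 0#
    e≉0′ e≈0 = e≉0 1# a b c φ-inj (trans (sym e≈) e≈0)

  sufficiency : (Σ (¬ e ≈ 0#) λ e≉0 → Condition₂ × Tr m∣k (t e≉0) ≈ 0#) → Permutes fₚ
  sufficiency (e≉0 , cond₂ , Tr≈0) = lineInjective⇒permutes (conditions⇒lineInjective e≉0 cond₂ Tr≈0)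

corollary9p3 :
  ∀ {α β} (k ℓ : ℕ) .{{_ : NonZero k}} .{{_ : NonZero ℓ}} →
  let m = 2 ℕ.^ ord₂ (gcd k ℓ)
      q = 2 ℕ.^ k
      Q = 2 ℕ.^ ℓ
      m∣k : m ∣ k
      m∣k = 2^ord₂[gcd]∣ˡ k ℓ
  in
  gcd (Q ℕ.+ 1) (q ℕ.+ 1) ≡ 1 →
  (F : FiniteField α β (q ℕ.^ 2)) →
  let open FiniteField F
      open Polynomials commutativeRing
  in
  (a b c : Carrier) (u v : ℕ) .{{_ : NonZero u}} .{{_ : NonZero v}} →
  u ℕ.* (Q ℕ.+ 1) ≡ 1 [mod q ℕ.+ 1 ] →
  v ℕ.* (Q ℕ.+ 1) ≡ Q [mod q ℕ.+ 1 ] →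
  let A = con 1# ⊕ con a ⊗ X ⊕ con b ⊗ X ^ₚ v ⊕ con c ⊗ X ^ₚ u
      f = X ⊗ (A ∘ₚ (X ^ₚ (q ℕ.∸ 1)))
      e = 1# + a ^ (q ℕ.+ 1) + b ^ (q ℕ.+ 1) + c ^ (q ℕ.+ 1)
  in
  Permutes f ⇔
    (Σ (¬ e ≈ 0#) λ e≉0 →
      ((a ^ q * b + c ^ q) ^ Q ≈ e ^ (Q ℕ.∸ 1) * (a ^ q * c + b ^ q)) ×
      (Tr m∣k ((b ^ (q ℕ.+ 1) + c ^ (q ℕ.+ 1)) / e ⟨ e≉0 ⟩) ≈ 0#))
corollary9p3 k ℓ coprime F a b c u v u[Q+1]≡1 v[Q+1]≡Q = mk⇔ necessity sufficiency
  where open Conditions k ℓ coprime F u v u[Q+1]≡1 v[Q+1]≡Q a b c
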